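{- Let $n\ge 2$ be an integer, $q$ a prime power, and let $A\in \operatorname{GL}(n,q)$ be diagonalisable (over the algebraic closure $\overline{\mathbb F}_q$). Let $\tau$ be the multiplicative order of $A$ and $t$ the multiplicative order of $\det A\in\mathbb F_q^*$. Let $E_{n,q}(A)$ denote the number of quadruples $(x_1,x_2,x_3,x_4)$ of integers with $1\le x_1,x_2,x_3,x_4\le \tau$ such that $$A^{x_1}+A^{x_2}=A^{x_3}+A^{x_4}.$$ Then $$E_{n,q}(A)\ll \tau^3\min\left\{t\,\tau^{ -1/n^2},\ t^{n/(n-1)}\tau^{ -1/(n(n-1))}\right\}.$$ If moreover the characteristic polynomial of $A$ is irreducible over $\mathbb F_q$, then $$E_{n,q}(A)\ll t\,\tau^{3-1/n}.$$ The implied constants depend only on $n$.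
   Context: $\operatorname{GL}(n,q)$ is the group of invertible $n\times n$ matrices over the finite field $\mathbb F_q$ of $q$ elements. The multiplicative order of $A$ is the least integer $\tau\ge1$ with $A^\tau$ equal to the identity matrix. $U\ll V$ means $|U|\le cV$ for a constant $c>0$. -}

module Defs where

open import Level using (0ℓ)
open import Data.Nat as ℕ using (ℕ; zero; suc; _≤_; _<_)
open import Data.Nat.Properties using ()
open import Data.Fin using (Fin; zero; suc; toℕ; punchIn)
open import Data.Fin.Properties using (all?)
open import Data.Bool using (Bool; true; false; if_then_else_)
open import Data.List using (List; []; _∷_; map)
open import Data.Product using (Σ; ∃; _×_; _,_)
open import Data.Sum using (_⊎_)
open import Data.Unit using (⊤)
open import Relation.Nullary using (¬_; Dec; yes; no)
open import Relation.Nullary.Decidable using (isYes)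
open import Relation.Binary using (Decidable)
open import Relation.Binary.PropositionalEquality using (_≡_)
open import Algebra.Bundles using (CommutativeRing)
open import Algebra.Bundles.Raw using (RawRing)
open import Algebra.Morphism.Structures using (module RingMorphisms)

-- Finite fields with q elements (q is then automatically a prime power).

record FiniteField (q : ℕ) : Set₁ where
  field
    ring : CommutativeRing 0ℓ 0ℓ
  open CommutativeRing ring public hiding (ring)
  field
    _≟_      : Decidable _≈_
    0≉1      : ¬ (0# ≈ 1#)
    inverse  : ∀ x → ¬ (x ≈ 0#) → Σ Carrier (λ y → (x * y) ≈ 1#)
    enum     : Fin q → Carrier
    enum-inj : ∀ i j → enum i ≈ enum j → i ≡ j
    enum-sur : ∀ x → Σ (Fin q) (λ i → enum i ≈ x)

Mat : Set → ℕ → Set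
Mat A n = Fin n → Fin n → A

module RawMat (R : RawRing 0ℓ 0ℓ) where
  open RawRing R

  sumF : ∀ {m} → (Fin m → Carrier) → Carrier
  sumF {zero}  f = 0#
  sumF {suc m} f = f zero + sumF (λ i → f (suc i))

  sign : ℕ → Carrier → Carrier
  sign zero          x = x
  sign (suc zero)    x = - x
  sign (suc (suc k)) x = sign k x

  det : ∀ {n} → Mat Carrier n → Carrier
  det {zero}  M = 1#
  det {suc n} M =
    sumF (λ j → sign (toℕ j) (M zero j * det (λ i k → M (suc i) (punchIn j k))))

  _·_ : ∀ {n} → Mat Carrier n → Mat Carrier n → Mat Carrier n
  (M · N) i j = sumF (λ k → M i k * N k j)

  I : ∀ {n} → Mat Carrier n
  I i j = if isYes (i Data.Fin.≟ j) then 1# else 0#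

  _^_ : ∀ {n} → Mat Carrier n → ℕ → Mat Carrier n
  M ^ zero  = I
  M ^ suc k = M · (M ^ k)

  _⊕_ : ∀ {n} → Mat Carrier n → Mat Carrier n → Mat Carrier n
  (M ⊕ N) i j = M i j + N i j

  _≈M_ : ∀ {n} → Mat Carrier n → Mat Carrier n → Set
  M ≈M N = ∀ i j → M i j ≈ N i j

  Invertible : ∀ {n} → Mat Carrier n → Set
  Invertible M = Σ (Mat Carrier _) (λ N → ((M · N) ≈M I) × ((N · M) ≈M I))

  diag : ∀ {n} → (Fin n → Carrier) → Mat Carrier n
  diag d i j = if isYes (i Data.Fin.≟ j) then d i else 0#

  IsOrderM : ∀ {n} → Mat Carrier n → ℕ → Set
  IsOrderM M τ = (1 ≤ τ) × ((M ^ τ) ≈M I) × (∀ k → 1 ≤ k → k < τ → ¬ ((M ^ k) ≈M I))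

  powE : Carrier → ℕ → Carrier
  powE x zero    = 1#
  powE x (suc k) = x * powE x k

  IsOrderE : Carrier → ℕ → Set
  IsOrderE x t = (1 ≤ t) × (powE x t ≈ 1#) × (∀ k → 1 ≤ k → k < t → ¬ (powE x k ≈ 1#))

-- Polynomials over a field, as coefficient lists (constant term first).

module Poly {q : ℕ} (F : FiniteField q) where
  open FiniteField F using (Carrier; _≈_; _+_; _*_; -_; 0#; 1#)

  Pol : Set
  Pol = List Carrier

  _+P_ : Pol → Pol → Pol
  []       +P g        = g
  (a ∷ f)  +P []       = a ∷ f
  (a ∷ f)  +P (b ∷ g)  = (a + b) ∷ (f +P g)

  -P_ : Pol → Pol
  -P f = map -_ f

  scale : Carrier → Pol → Pol
  scale c f = map (c *_) f

  _*P_ : Pol → Pol → Pol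
  []      *P g = []
  (a ∷ f) *P g = scale a g +P (0# ∷ (f *P g))

  _≈P_ : Pol → Pol → Set
  []      ≈P []      = ⊤
  []      ≈P (b ∷ g) = (b ≈ 0#) × ([] ≈P g)
  (a ∷ f) ≈P []      = (a ≈ 0#) × (f ≈P [])
  (a ∷ f) ≈P (b ∷ g) = (a ≈ b) × (f ≈P g)

  polyRawRing : RawRing 0ℓ 0ℓ
  polyRawRing = record
    { Carrier = Pol ; _≈_ = _≈P_ ; _+_ = _+P_ ; _*_ = _*P_ ; -_ = -P_
    ; 0# = [] ; 1# = 1# ∷ [] }

  IsConstant : Pol → Set
  IsConstant f = Σ Carrier (λ c → f ≈P (c ∷ []))

  Irreducible : Pol → Set
  Irreducible p = ¬ IsConstant p × (∀ f g → (f *P g) ≈P p → IsConstant f ⊎ IsConstant g)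

  charPoly : ∀ {n} → Mat Carrier n → Pol
  charPoly A = RawMat.det polyRawRing
    (λ i j → if isYes (i Data.Fin.≟ j) then (- A i j) ∷ 1# ∷ [] else (- A i j) ∷ [])

-- Diagonalisable over the algebraic closure: diagonalisable over some
-- finite extension field K (every finite subextension of the closure is
-- a finite field, and all eigenvalues lie in one).

DiagonalisableOverClosure : ∀ {q n} (F : FiniteField q) → Mat (FiniteField.Carrier F) n → Set₁
DiagonalisableOverClosure {q} {n} F A =
  Σ ℕ λ m → Σ (FiniteField m) λ K →
  Σ (FiniteField.Carrier F → FiniteField.Carrier K) λ ι →
    RingMorphisms.IsRingHomomorphism (FiniteField.rawRing F) (FiniteField.rawRing K) ι ×
    Σ (Mat (FiniteField.Carrier K) n) λ P → Σ (Fin n → FiniteField.Carrier K) λ d →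
      RawMat.Invertible (FiniteField.rawRing K) P ×
      RawMat._≈M_ (FiniteField.rawRing K)
        (RawMat._·_ (FiniteField.rawRing K) P (λ i j → ι (A i j)))
        (RawMat._·_ (FiniteField.rawRing K) (RawMat.diag (FiniteField.rawRing K) d) P)

module Energy {q : ℕ} (F : FiniteField q) where
  open FiniteField F using (Carrier; _≟_; rawRing)
  open RawMat rawRing

  decM : ∀ {n} (M N : Mat Carrier n) → Dec (M ≈M N)
  decM M N = all? (λ i → all? (λ j → M i j ≟ N i j))

  sumℕ : ∀ {m} → (Fin m → ℕ) → ℕ
  sumℕ {zero}  f = 0
  sumℕ {suc m} f = f zero ℕ.+ sumℕ (λ i → f (suc i))

  ind : Bool → ℕ
  ind true  = 1
  ind false = 0

  E : ∀ {n} → Mat Carrier n → ℕ → ℕ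
  E A τ = sumℕ {τ} λ a → sumℕ {τ} λ b → sumℕ {τ} λ c → sumℕ {τ} λ d →
    let x : Fin τ → ℕ
        x i = suc (toℕ i)
    in ind (isYes (decM ((A ^ x a) ⊕ (A ^ x b)) ((A ^ x c) ⊕ (A ^ x d))))

{-# OPTIONS --safe #-}
module Submission where

-- Over a splitting field the matrix equation says λⱼ^x₁ + λⱼ^x₂ = λⱼ^x₃ + λⱼ^x₄ for every eigenvalue
-- λⱼ. Fix x₃ and the residue of x₄ modulo t, hence (det A)^x₄. Then ∏ⱼ (λⱼ^x₁ + (λⱼ^x₂ - λⱼ^x₃)) = ∏ⱼ λⱼ^x₄ is
-- constant, so the pairs (x₁, x₂) are edges of a projective norm graph (Kollár, Rónyai, Szabó): k
-- vertices x₁ whose powers differ in each of the k coordinates have at most k^k common neighbours.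
-- The Kővári-Sós-Turán double count then gives E^n μ ≪ (t τ³)^n, where μ is the least order of a λⱼ.
-- When the characteristic polynomial is irreducible the λⱼ are conjugate, so μ = τ.
--
-- In general an eigenvalue of small order o is discarded after fixing x₁ and x₂ modulo o. The
-- equation then determines x₄ modulo o, so nothing is lost, and the remaining eigenvalues, raised to
-- the power o, have joint order τ / o. Discarding repeatedly until all orders are large enough gives
-- both general bounds; the second also uses that for two eigenvalues each order is at least τ / t.
--
-- For the norm graph bound, k^k + 1 common neighbours would carry non-zero weights annihilating all
-- polynomials of degree less than k in each variable. The k equations, together with the point at
-- infinity, propagate this to polynomials of every degree, contradicting interpolation.

open import Defs
open import Level using (0ℓ)
open import Algebra.Bundles using (CommutativeRing)
open import Algebra.Bundles.Raw using (RawRing)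
open import Algebra.Morphism.Structures using (module RingMorphisms)
import Algebra.Properties.CommutativeMonoid.Sum
import Algebra.Properties.CommutativeSemiring.Exp
import Algebra.Properties.Ring
import Algebra.Properties.Semiring.Sum
import Algebra.Solver.Ring.NaturalCoefficients.Default
open import Data.Bool using (true; false; if_then_else_)
open import Data.Fin as Fin using (Fin; zero; suc; punchIn; toℕ)
import Data.Fin.Properties as Finₚ
open import Data.List as List using (List; []; _∷_)
import Data.List.Properties as Listₚ
open import Data.Nat as ℕ using (ℕ; zero; suc)
open import Data.Nat.Divisibility as ∣ using (_∣_; divides)
import Data.Nat.DivMod as DivMod
import Data.Nat.Properties as ℕₚ
open import Data.Nat.Tactic.RingSolver using (solve-∀)
open import Data.Product using (∃; ∃₂; _×_; _,_; proj₁; proj₂)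
open import Data.Sum using (_⊎_; inj₁; inj₂)
open import Data.Unit using (⊤; tt)
open import Data.Vec.Functional as Vector using (updateAt; insertAt; removeAt)
import Data.Vec.Functional.Properties as Vectorₚ
open import Function using (_∘_; const)
open import Relation.Binary.Definitions using (tri<; tri≈; tri>)
open import Relation.Binary.PropositionalEquality as ≡ using (_≡_; _≢_)
import Relation.Binary.Reasoning.Setoid
open import Relation.Nullary using (¬_; yes; no; contradiction; ¬?; isYes)
open import Relation.Nullary.Decidable using (decidable-stable)
open import Relation.Unary using (Decidable)

-- Fractional exponents never occur: a bound E ≪ X μ^(-1/k) is carried as the integer inequality E^k
-- μ ≤ C X^k, and is transformed by multiplying, raising to powers and cancelling.
--
-- Discarding an eigenvalue of order o leaves a norm graph with one coordinate less, whose bound is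
-- stronger, but divides the joint order by o, so it pays only for small o. The thresholds balance
-- the two effects. With k eigenvalues left and joint order N, the first bound compares o^k with N:
-- if all orders are large, N^(-1/k^2) is saved at once; a small order leaves N/o ≥ N^((k-1)/k), for
-- which the case k - 1 saves N^(-1/(k(k-1))), which is more than enough. The second bound compares
-- o^(k-1) t^k with N in the same way, and its recursion ends with two eigenvalues, which the
-- determinant ties to each other.

module Counting where
  open import Data.Nat using (_+_; _*_; _^_; _∸_; _≤_; _<_; _⊔_; z≤n; s≤s)
  open ℕₚ hiding (suc-injective)
  open ≤-Reasoning

  ^-distribʳ-* : ∀ m a b → (a * b) ^ m ≡ a ^ m * b ^ m
  ^-distribʳ-* zero    a b = ≡.refl
  ^-distribʳ-* (suc m) a b = ≡.trans (≡.cong (a * b *_) (^-distribʳ-* m a b)) (lemma a b (a ^ m) (b ^ m))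
    where
      lemma : ∀ a b p q → a * b * (p * q) ≡ a * p * (b * q)
      lemma = solve-∀

  -- Sums over initial segments of the natural numbers.

  ∑ : ℕ → (ℕ → ℕ) → ℕ
  ∑ zero    f = 0
  ∑ (suc n) f = f 0 + ∑ n (f ∘ suc)

  ∑-cong : ∀ n {f g : ℕ → ℕ} → (∀ i → i < n → f i ≡ g i) → ∑ n f ≡ ∑ n g
  ∑-cong zero    f≡g = ≡.refl
  ∑-cong (suc n) f≡g = ≡.cong₂ _+_ (f≡g 0 (s≤s z≤n)) (∑-cong n λ i i<n → f≡g (suc i) (s≤s i<n))

  ∑-mono : ∀ n {f g : ℕ → ℕ} → (∀ i → i < n → f i ≤ g i) → ∑ n f ≤ ∑ n g
  ∑-mono zero    f≤g = z≤n
  ∑-mono (suc n) f≤g = +-mono-≤ (f≤g 0 (s≤s z≤n)) (∑-mono n λ i i<n → f≤g (suc i) (s≤s i<n))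

  ∑-const : ∀ n c → ∑ n (λ _ → c) ≡ n * c
  ∑-const zero    c = ≡.refl
  ∑-const (suc n) c = ≡.cong (c +_) (∑-const n c)

  ∑-bounded : ∀ n {f c} → (∀ i → i < n → f i ≤ c) → ∑ n f ≤ n * c
  ∑-bounded n {c = c} f≤c = ≤-trans (∑-mono n f≤c) (≤-reflexive (∑-const n c))

  ∑-distrib-+ : ∀ n f g → ∑ n (λ i → f i + g i) ≡ ∑ n f + ∑ n g
  ∑-distrib-+ zero    f g = ≡.refl
  ∑-distrib-+ (suc n) f g rewrite ∑-distrib-+ n (f ∘ suc) (g ∘ suc) =
    lemma (f 0) (g 0) (∑ n (f ∘ suc)) (∑ n (g ∘ suc))
    where
      lemma : ∀ a b c d → (a + b) + (c + d) ≡ (a + c) + (b + d)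
      lemma = solve-∀

  ∑-distrib-* : ∀ n c f → c * ∑ n f ≡ ∑ n (λ i → c * f i)
  ∑-distrib-* zero    c f = *-zeroʳ c
  ∑-distrib-* (suc n) c f = ≡.trans (*-distribˡ-+ c (f 0) _) (≡.cong (c * f 0 +_) (∑-distrib-* n c (f ∘ suc)))

  ∑-comm : ∀ m n (f : ℕ → ℕ → ℕ) → ∑ m (λ i → ∑ n (f i)) ≡ ∑ n (λ j → ∑ m (λ i → f i j))
  ∑-comm zero    n f = ≡.sym (≡.trans (∑-const n 0) (*-zeroʳ n))
  ∑-comm (suc m) n f = ≡.trans (≡.cong (∑ n (f 0) +_) (∑-comm m n (f ∘ suc)))
    (≡.sym (∑-distrib-+ n (f 0) (λ j → ∑ m (λ i → f (suc i) j))))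

  ∑-split : ∀ m n f → ∑ (m + n) f ≡ ∑ m f + ∑ n (λ i → f (m + i))
  ∑-split zero    n f = ≡.refl
  ∑-split (suc m) n f = ≡.trans (≡.cong (f 0 +_) (∑-split m n (f ∘ suc))) (≡.sym (+-assoc (f 0) _ _))

  ∑-blocks : ∀ N M f → ∑ (N * M) f ≡ ∑ N (λ u → ∑ M (λ r → f (u * M + r)))
  ∑-blocks zero    M f = ≡.refl
  ∑-blocks (suc N) M f = ≡.trans (∑-split M (N * M) f) (≡.cong (∑ M f +_)
    (≡.trans (∑-blocks N M (f ∘ (M +_))) (∑-cong N λ u _ → ∑-cong M λ r _ →
      ≡.cong f (≡.sym (+-assoc M (u * M) r)))))

  δ : ℕ → ℕ → ℕ
  δ a b = if isYes (a ℕ.≟ b) then 1 else 0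

  δ≤1 : ∀ a b → δ a b ≤ 1
  δ≤1 a b with a ℕ.≟ b
  ... | yes _ = ≤-refl
  ... | no  _ = z≤n

  δ≢0 : ∀ a b → δ a b ≢ 0 → a ≡ b
  δ≢0 a b δ≢0 with a ℕ.≟ b
  ... | yes a≡b = a≡b
  ... | no  _   = contradiction ≡.refl δ≢0

  δ-suc : ∀ a b → δ (suc a) (suc b) ≡ δ a b
  δ-suc a b with a ℕ.≟ b | suc a ℕ.≟ suc b
  ... | yes _   | yes _     = ≡.refl
  ... | no _    | no _      = ≡.refl
  ... | yes a≡b | no sa≢sb  = contradiction (≡.cong suc a≡b) sa≢sb
  ... | no a≢b  | yes sa≡sb = contradiction (ℕₚ.suc-injective sa≡sb) a≢b

  ∑-δ : ∀ t a → a < t → ∑ t (δ a) ≡ 1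
  ∑-δ (suc t) zero    _         = ≡.cong suc (≡.trans (∑-const t 0) (*-zeroʳ t))
  ∑-δ (suc t) (suc a) (s≤s a<t) = ≡.trans (∑-cong t λ b _ → δ-suc a b) (∑-δ t a a<t)

  ∑-classes : ∀ n t (c : ℕ → ℕ) → (∀ i → c i < t) → ∀ f → ∑ n f ≡ ∑ t (λ b → ∑ n (λ i → f i * δ (c i) b))
  ∑-classes n t c c<t f = begin-equality
    ∑ n f  ≡⟨ ∑-cong n (λ i _ → *-identityʳ (f i)) ⟨
    ∑ n (λ i → f i * 1)  ≡⟨ ∑-cong n (λ i _ → ≡.cong (f i *_) (∑-δ t (c i) (c<t i))) ⟨
    ∑ n (λ i → f i * ∑ t (δ (c i)))  ≡⟨ ∑-cong n (λ i _ → ∑-distrib-* t (f i) (δ (c i))) ⟩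
    ∑ n (λ i → ∑ t (λ b → f i * δ (c i) b))   ≡⟨ ∑-comm n t _ ⟩
    ∑ t (λ b → ∑ n (λ i → f i * δ (c i) b))   ∎

  ∑-zero : ∀ n {f} → (∀ i → i < n → f i ≡ 0) → ∑ n f ≡ 0
  ∑-zero n f≡0 = ≡.trans (∑-cong n f≡0) (≡.trans (∑-const n 0) (*-zeroʳ n))

  ∑-nonzero : ∀ n f → ∑ n f ≢ 0 → ∃ λ i → i < n × f i ≢ 0
  ∑-nonzero zero    f ∑≢0 = contradiction ≡.refl ∑≢0
  ∑-nonzero (suc n) f ∑≢0 with f 0 ℕ.≟ 0
  ... | no f0≢0 = 0 , s≤s z≤n , f0≢0
  ... | yes f0≡0 with i , i<n , fi≢0 ← ∑-nonzero n (f ∘ suc) (λ eq → ∑≢0 (≡.cong₂ _+_ f0≡0 eq)) =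
    suc i , s≤s i<n , fi≢0

  ∑-unique : ∀ n f → (∀ i → f i ≤ 1) → (∀ i j → i < n → j < n → f i ≢ 0 → f j ≢ 0 → i ≡ j) → ∑ n f ≤ 1
  ∑-unique zero    f f≤1 unique = z≤n
  ∑-unique (suc n) f f≤1 unique with f 0 ℕ.≟ 0
  ... | yes f0≡0 rewrite f0≡0 = ∑-unique n (f ∘ suc) (f≤1 ∘ suc) λ i j i<n j<n fi≢0 fj≢0 →
    ℕₚ.suc-injective (unique (suc i) (suc j) (s≤s i<n) (s≤s j<n) fi≢0 fj≢0)
  ... | no f0≢0 = begin
    f 0 + ∑ n (f ∘ suc)  ≡⟨ ≡.cong (f 0 +_) (∑-zero n rest) ⟩
    f 0 + 0  ≡⟨ +-identityʳ (f 0) ⟩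
    f 0  ≤⟨ f≤1 0 ⟩
    1                    ∎
    where
      rest : ∀ i → i < n → f (suc i) ≡ 0
      rest i i<n with f (suc i) ℕ.≟ 0
      ... | yes eq = eq
      ... | no fi≢0 = contradiction (unique 0 (suc i) (s≤s z≤n) (s≤s i<n) f0≢0 fi≢0) λ ()

  ∑-extend : ∀ {m n} f → m ≤ n → ∑ m f ≤ ∑ n f
  ∑-extend f z≤n       = z≤n
  ∑-extend f (s≤s m≤n) = +-monoʳ-≤ (f 0) (∑-extend (f ∘ suc) m≤n)

  -- The segment is covered by n / μ + 1 blocks of length μ, and a block holds at most one index
  -- with a non-zero value.
  ∑-spaced : ∀ μ → 1 ≤ μ → ∀ n f → (∀ i → f i ≤ 1) → (∀ i j → i < j → f i ≢ 0 → f j ≢ 0 → i + μ ≤ j) →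
    ∑ n f * μ ≤ n + μ
  ∑-spaced (suc μ-1) _ n f f≤1 spaced = begin
    ∑ n f * μ  ≤⟨ *-monoˡ-≤ μ (∑-extend f n≤qμ) ⟩
    ∑ (suc (n ℕ./ μ) * μ) f * μ   ≡⟨ ≡.cong (_* μ) (∑-blocks (suc (n ℕ./ μ)) μ f) ⟩
    ∑ (suc (n ℕ./ μ)) (λ u → ∑ μ (λ r → f (u * μ + r))) * μ
                                  ≤⟨ *-monoˡ-≤ μ (∑-bounded (suc (n ℕ./ μ)) {c = 1} λ u _ → ∑-unique μ _ (λ r → f≤1 _) (block u)) ⟩
    suc (n ℕ./ μ) * 1 * μ  ≡⟨ ≡.cong (_* μ) (*-identityʳ (suc (n ℕ./ μ))) ⟩
    μ + n ℕ./ μ * μ  ≤⟨ +-monoʳ-≤ μ (m/n*n≤m n μ) ⟩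
    μ + n  ≡⟨ +-comm μ n ⟩
    n + μ                         ∎
    where
      open import Data.Nat.DivMod using (m/n*n≤m; m≡m%n+[m/n]*n; m%n<n)
      μ : ℕ
      μ = suc μ-1
      n≤qμ : n ≤ suc (n ℕ./ μ) * μ
      n≤qμ = ≤-trans (≤-reflexive (m≡m%n+[m/n]*n n μ)) (+-monoˡ-≤ _ (<⇒≤ (m%n<n n μ)))
      close : ∀ u r s → r < s → s < μ → f (u * μ + r) ≢ 0 → ¬ (f (u * μ + s) ≢ 0)
      close u r s r<s s<μ fr≢0 fs≢0 = <-irrefl ≡.refl (begin-strict
        u * μ + s      <⟨ +-monoʳ-< (u * μ) s<μ ⟩
        u * μ + μ      ≤⟨ +-monoˡ-≤ μ (m≤m+n (u * μ) r) ⟩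
        u * μ + r + μ  ≤⟨ spaced _ _ (+-monoʳ-< (u * μ) r<s) fr≢0 fs≢0 ⟩
        u * μ + s      ∎)
      block : ∀ u r s → r < μ → s < μ → f (u * μ + r) ≢ 0 → f (u * μ + s) ≢ 0 → r ≡ s
      block u r s r<μ s<μ fr≢0 fs≢0 with <-cmp r s
      ... | tri< r<s _ _ = contradiction fs≢0 (close u r s r<s s<μ fr≢0)
      ... | tri≈ _ r≡s _ = r≡s
      ... | tri> _ _ s<r = contradiction fr≢0 (close u s r s<r r<μ fs≢0)

  -- Turns a large count into that many distinct indices: the form in which too many common
  -- neighbours reach the norm graph argument.
  support : ∀ n f → (∀ i → f i ≤ 1) → ∀ {m} → m ≤ ∑ n f →
    ∃ λ (e : Fin m → ℕ) → (∀ i → e i < n × f (e i) ≢ 0) × (∀ i j → i ≢ j → e i ≢ e j)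
  support n       f f≤1 {zero}  _ = (λ ()) , (λ ()) , (λ ())
  support (suc n) f f≤1 {suc m} m<∑ with f 0 ℕ.≟ 0
  ... | yes f0≡0
    with e , hits , inj ← support n (f ∘ suc) (f≤1 ∘ suc) (≤-trans m<∑ (≤-reflexive (≡.cong (_+ ∑ n (f ∘ suc)) f0≡0)))
    = suc ∘ e , (λ i → s≤s (proj₁ (hits i)) , proj₂ (hits i)) , (λ i j i≢j → inj i j i≢j ∘ ℕₚ.suc-injective)
  ... | no f0≢0
    with e , hits , inj ← support n (f ∘ suc) (f≤1 ∘ suc) (≤-pred (≤-trans m<∑ (+-monoˡ-≤ (∑ n (f ∘ suc)) (f≤1 0))))
    = e⁺ , hits⁺ , inj⁺
    where
      e⁺ : Fin (suc m) → ℕ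
      e⁺ zero    = 0
      e⁺ (suc i) = suc (e i)
      hits⁺ : ∀ i → e⁺ i < suc n × f (e⁺ i) ≢ 0
      hits⁺ zero    = s≤s z≤n , f0≢0
      hits⁺ (suc i) = s≤s (proj₁ (hits i)) , proj₂ (hits i)
      inj⁺ : ∀ i j → i ≢ j → e⁺ i ≢ e⁺ j
      inj⁺ zero    zero    i≢j = contradiction ≡.refl i≢j
      inj⁺ zero    (suc j) i≢j = λ ()
      inj⁺ (suc i) zero    i≢j = λ ()
      inj⁺ (suc i) (suc j) i≢j = inj i j (i≢j ∘ ≡.cong suc) ∘ ℕₚ.suc-injective

  -- Chebyshev's sum inequality and power means.

  rearrangement-≤ : ∀ m {a b} → a ≤ b → a * b ^ m + a ^ m * b ≤ a * a ^ m + b * b ^ m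
  rearrangement-≤ m {a} {b} a≤b with c , ≡.refl ← m≤n⇒∃[o]m+o≡n a≤b = begin
    a * (a + c) ^ m + a ^ m * (a + c)  ≡⟨ lemma₁ a c ((a + c) ^ m) (a ^ m) ⟩
    a * a ^ m + (a * (a + c) ^ m + c * a ^ m) ≤⟨ +-monoʳ-≤ (a * a ^ m) (+-monoʳ-≤ _ (*-monoʳ-≤ c (^-monoˡ-≤ m a≤b))) ⟩
    a * a ^ m + (a * (a + c) ^ m + c * (a + c) ^ m) ≡⟨ ≡.cong (a * a ^ m +_) (*-distribʳ-+ ((a + c) ^ m) a c) ⟨
    a * a ^ m + (a + c) * (a + c) ^ m         ∎
    where
      lemma₁ : ∀ a c p q → a * p + q * (a + c) ≡ a * q + (a * p + c * q)
      lemma₁ = solve-∀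

  -- This is (a - b)(a ^ m - b ^ m) ≥ 0 multiplied out; the case split on the order of a and b
  -- avoids truncated subtraction.
  rearrangement : ∀ m a b → a * b ^ m + a ^ m * b ≤ a * a ^ m + b * b ^ m
  rearrangement m a b with ≤-total a b
  ... | inj₁ a≤b = rearrangement-≤ m a≤b
  ... | inj₂ b≤a = begin
    a * b ^ m + a ^ m * b  ≡⟨ lemma a b (a ^ m) (b ^ m) ⟩
    b * a ^ m + b ^ m * a  ≤⟨ rearrangement-≤ m b≤a ⟩
    b * b ^ m + a * a ^ m  ≡⟨ +-comm (b * b ^ m) (a * a ^ m) ⟩
    a * a ^ m + b * b ^ m  ∎
    where
      lemma : ∀ a b p q → a * q + p * b ≡ b * p + q * a
      lemma = solve-∀

  -- Induction on n: the new index meets every old one in a pair of cross terms, which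
  -- `rearrangement` bounds.
  chebyshev : ∀ m n d → ∑ n d * ∑ n (λ i → d i ^ m) ≤ n * ∑ n (λ i → d i ^ suc m)
  chebyshev m zero    d = z≤n
  chebyshev m (suc n) d = begin
    (a + S) * (p + T)  ≡⟨ lemma₁ a S p T ⟩
    a * p + (a * T + p * S) + S * T  ≤⟨ +-mono-≤ (+-monoʳ-≤ (a * p) cross) (chebyshev m n (d ∘ suc)) ⟩
    a * p + (n * (a * p) + U) + n * U  ≡⟨ lemma₂ n (a * p) U ⟩
    suc n * (a * p + U)                          ∎
    where
      a p S T U : ℕ
      a = d 0
      p = d 0 ^ m
      S = ∑ n (d ∘ suc)
      T = ∑ n (λ i → d (suc i) ^ m)
      U = ∑ n (λ i → d (suc i) ^ suc m)
      lemma₁ : ∀ a S p T → (a + S) * (p + T) ≡ a * p + (a * T + p * S) + S * T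
      lemma₁ = solve-∀
      lemma₂ : ∀ n x U → x + (n * x + U) + n * U ≡ (1 + n) * (x + U)
      lemma₂ = solve-∀
      cross : a * T + p * S ≤ n * (a * p) + U
      cross = begin
        a * T + p * S
          ≡⟨ ≡.cong₂ _+_ (∑-distrib-* n a _) (∑-distrib-* n p _) ⟩
        ∑ n (λ i → a * d (suc i) ^ m) + ∑ n (λ i → p * d (suc i))
          ≡⟨ ∑-distrib-+ n _ _ ⟨
        ∑ n (λ i → a * d (suc i) ^ m + p * d (suc i))
          ≤⟨ ∑-mono n (λ i _ → rearrangement m a (d (suc i))) ⟩
        ∑ n (λ i → a * p + d (suc i) ^ suc m)
          ≡⟨ ∑-distrib-+ n _ _ ⟩
        ∑ n (λ _ → a * p) + U
          ≡⟨ ≡.cong (_+ U) (∑-const n (a * p)) ⟩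
        n * (a * p) + U ∎

  -- Hölder's inequality for integer exponents, obtained by iterating `chebyshev`.
  power-mean : ∀ m n d → ∑ n d ^ suc m ≤ n ^ m * ∑ n (λ i → d i ^ suc m)
  power-mean zero    n d = ≤-reflexive (≡.trans (*-identityʳ _) (≡.trans
    (∑-cong n λ i _ → ≡.sym (*-identityʳ (d i))) (≡.sym (+-identityʳ _))))
  power-mean (suc m) n d = begin
    ∑ n d * ∑ n d ^ suc m  ≤⟨ *-monoʳ-≤ (∑ n d) (power-mean m n d) ⟩
    ∑ n d * (n ^ m * ∑ n (λ i → d i ^ suc m))      ≡⟨ lemma (∑ n d) (n ^ m) _ ⟩
    n ^ m * (∑ n d * ∑ n (λ i → d i ^ suc m))      ≤⟨ *-monoʳ-≤ (n ^ m) (chebyshev (suc m) n d) ⟩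
    n ^ m * (n * ∑ n (λ i → d i ^ suc (suc m)))    ≡⟨ lemma (n ^ m) n _ ⟩
    n * (n ^ m * ∑ n (λ i → d i ^ suc (suc m)))    ≡⟨ *-assoc n (n ^ m) _ ⟨
    n * n ^ m * ∑ n (λ i → d i ^ suc (suc m))      ∎
    where
      lemma : ∀ a b c → a * (b * c) ≡ b * (a * c)
      lemma = solve-∀

  -- `P` stands for a bound that cannot be solved for its argument in the integers. The maximum is
  -- one of the values, or 0, and so inherits `P`.
  bounded-maximum : ∀ (P : ℕ → Set) → P 0 → ∀ n (f : ℕ → ℕ) → (∀ i → i < n → P (f i)) →
    ∃ λ b → P b × (∀ i → i < n → f i ≤ b)
  bounded-maximum P P0 zero    f Pf = 0 , P0 , λ _ ()
  bounded-maximum P P0 (suc n) f Pf with bounded-maximum P P0 n (f ∘ suc) (λ i i<n → Pf (suc i) (s≤s i<n))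
  ... | b , Pb , f≤b = f 0 ⊔ b , P⊔ ,
    λ { zero _ → m≤m⊔n (f 0) b ; (suc i) (s≤s i<n) → ≤-trans (f≤b i i<n) (m≤n⊔m (f 0) b) }
    where
      P⊔ : P (f 0 ⊔ b)
      P⊔ with ⊔-sel (f 0) b
      ... | inj₁ eq rewrite eq = Pf 0 (s≤s z≤n)
      ... | inj₂ eq rewrite eq = Pb

  -- The sum is at most n times its largest term, and the largest term itself satisfies the
  -- hypothesis; in this way a bound on powers is summed without taking roots.
  ∑-power-bound : ∀ m μ Y n f → (∀ i → i < n → f i ^ suc m * μ ≤ Y) → ∑ n f ^ suc m * μ ≤ n ^ suc m * Y
  ∑-power-bound m μ Y n f f≤Y with bounded-maximum (λ b → b ^ suc m * μ ≤ Y) z≤n n f f≤Y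
  ... | b , b≤Y , f≤b = begin
    ∑ n f ^ suc m * μ  ≤⟨ *-monoˡ-≤ μ (^-monoˡ-≤ (suc m) (∑-bounded n f≤b)) ⟩
    (n * b) ^ suc m * μ  ≡⟨ ≡.cong (_* μ) (^-distribʳ-* (suc m) n b) ⟩
    n ^ suc m * b ^ suc m * μ      ≡⟨ *-assoc (n ^ suc m) (b ^ suc m) μ ⟩
    n ^ suc m * (b ^ suc m * μ)    ≤⟨ *-monoʳ-≤ (n ^ suc m) b≤Y ⟩
    n ^ suc m * Y                  ∎

  -- Sums and products over finite index sets, and sums over tuples.

  ∑ᶠ : ∀ {k} → (Fin k → ℕ) → ℕ
  ∑ᶠ {zero}  f = 0
  ∑ᶠ {suc k} f = f zero + ∑ᶠ (f ∘ suc)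

  ∑ᶠ-bounded : ∀ {k} (f : Fin k → ℕ) {c} → (∀ i → f i ≤ c) → ∑ᶠ f ≤ k * c
  ∑ᶠ-bounded {zero}  f f≤c = z≤n
  ∑ᶠ-bounded {suc k} f f≤c = +-mono-≤ (f≤c zero) (∑ᶠ-bounded (f ∘ suc) (f≤c ∘ suc))

  ∑ᶠ-zero : ∀ {k} (f : Fin k → ℕ) → ∑ᶠ f ≡ 0 → ∀ i → f i ≡ 0
  ∑ᶠ-zero {suc k} f eq zero    = m+n≡0⇒m≡0 (f zero) eq
  ∑ᶠ-zero {suc k} f eq (suc i) = ∑ᶠ-zero (f ∘ suc) (m+n≡0⇒n≡0 (f zero) eq) i

  ∑ᶠ-distribʳ-* : ∀ {k} (f : Fin k → ℕ) c → ∑ᶠ f * c ≡ ∑ᶠ (λ i → f i * c)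
  ∑ᶠ-distribʳ-* {zero}  f c = ≡.refl
  ∑ᶠ-distribʳ-* {suc k} f c = ≡.trans (*-distribʳ-+ c (f zero) _) (≡.cong (f zero * c +_) (∑ᶠ-distribʳ-* (f ∘ suc) c))

  ∑-∑ᶠ-comm : ∀ {k} n (f : ℕ → Fin k → ℕ) → ∑ n (λ u → ∑ᶠ (f u)) ≡ ∑ᶠ (λ i → ∑ n (λ u → f u i))
  ∑-∑ᶠ-comm {zero}  n f = ≡.trans (∑-const n 0) (*-zeroʳ n)
  ∑-∑ᶠ-comm {suc k} n f = ≡.trans (∑-distrib-+ n (λ u → f u zero) (λ u → ∑ᶠ (f u ∘ suc)))
    (≡.cong (∑ n (λ u → f u zero) +_) (∑-∑ᶠ-comm n (λ u → f u ∘ suc)))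

  ∏ᶠ : ∀ {k} → (Fin k → ℕ) → ℕ
  ∏ᶠ {zero}  f = 1
  ∏ᶠ {suc k} f = f zero * ∏ᶠ (f ∘ suc)

  ∏ᶠ≤1 : ∀ {k} (f : Fin k → ℕ) → (∀ i → f i ≤ 1) → ∏ᶠ f ≤ 1
  ∏ᶠ≤1 {zero}  f f≤1 = ≤-refl
  ∏ᶠ≤1 {suc k} f f≤1 = *-mono-≤ (f≤1 zero) (∏ᶠ≤1 (f ∘ suc) (f≤1 ∘ suc))

  ∏ᶠ≢0 : ∀ {k} (f : Fin k → ℕ) → ∏ᶠ f ≢ 0 → ∀ i → f i ≢ 0
  ∏ᶠ≢0 {suc k} f ∏≢0 zero    eq = ∏≢0 (≡.cong (_* ∏ᶠ (f ∘ suc)) eq)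
  ∏ᶠ≢0 {suc k} f ∏≢0 (suc i) eq = ∏ᶠ≢0 (f ∘ suc) (λ eq′ → ∏≢0 (≡.trans (≡.cong (f zero *_) eq′) (*-zeroʳ (f zero)))) i eq

  ∑ᵗ : ∀ k → ℕ → ((Fin k → ℕ) → ℕ) → ℕ
  ∑ᵗ zero    N F = F (λ ())
  ∑ᵗ (suc k) N F = ∑ N (λ u → ∑ᵗ k N (λ us → F (u Vector.∷ us)))

  ∑ᵗ-mono : ∀ k N {F G} → (∀ us → F us ≤ G us) → ∑ᵗ k N F ≤ ∑ᵗ k N G
  ∑ᵗ-mono zero    N F≤G = F≤G _
  ∑ᵗ-mono (suc k) N F≤G = ∑-mono N λ u _ → ∑ᵗ-mono k N λ us → F≤G _

  ∑ᵗ-const : ∀ k N c → ∑ᵗ k N (λ _ → c) ≡ N ^ k * c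
  ∑ᵗ-const zero    N c = ≡.sym (+-identityʳ c)
  ∑ᵗ-const (suc k) N c = ≡.trans (∑-cong N λ _ _ → ∑ᵗ-const k N c)
    (≡.trans (∑-const N (N ^ k * c)) (≡.sym (*-assoc N (N ^ k) c)))

  ∑ᵗ-distrib-+ : ∀ k N F G → ∑ᵗ k N (λ us → F us + G us) ≡ ∑ᵗ k N F + ∑ᵗ k N G
  ∑ᵗ-distrib-+ zero    N F G = ≡.refl
  ∑ᵗ-distrib-+ (suc k) N F G = ≡.trans (∑-cong N λ u _ → ∑ᵗ-distrib-+ k N _ _) (∑-distrib-+ N _ _)

  ∑ᵗ-distrib-* : ∀ k N c F → c * ∑ᵗ k N F ≡ ∑ᵗ k N (λ us → c * F us)
  ∑ᵗ-distrib-* zero    N c F = ≡.refl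
  ∑ᵗ-distrib-* (suc k) N c F = ≡.trans (∑-distrib-* N c _) (∑-cong N λ u _ → ∑ᵗ-distrib-* k N c _)

  ∑-∑ᵗ-comm : ∀ n k N (F : ℕ → (Fin k → ℕ) → ℕ) → ∑ n (λ v → ∑ᵗ k N (F v)) ≡ ∑ᵗ k N (λ us → ∑ n (λ v → F v us))
  ∑-∑ᵗ-comm n zero    N F = ≡.refl
  ∑-∑ᵗ-comm n (suc k) N F = ≡.trans (∑-comm n N _) (∑-cong N λ u _ → ∑-∑ᵗ-comm n k N _)

  ∑-power : ∀ k N g → ∑ N g ^ k ≡ ∑ᵗ k N (λ us → ∏ᶠ (g ∘ us))
  ∑-power zero    N g = ≡.refl
  ∑-power (suc k) N g = begin-equality
    ∑ N g * ∑ N g ^ k  ≡⟨ *-comm (∑ N g) _ ⟩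
    ∑ N g ^ k * ∑ N g  ≡⟨ ∑-distrib-* N (∑ N g ^ k) g ⟩
    ∑ N (λ u → ∑ N g ^ k * g u)  ≡⟨ ∑-cong N (λ u _ → *-comm (∑ N g ^ k) (g u)) ⟩
    ∑ N (λ u → g u * ∑ N g ^ k)  ≡⟨ ∑-cong N (λ u _ → ≡.cong (g u *_) (∑-power k N g)) ⟩
    ∑ N (λ u → g u * ∑ᵗ k N (λ us → ∏ᶠ (g ∘ us)))        ≡⟨ ∑-cong N (λ u _ → ∑ᵗ-distrib-* k N (g u) _) ⟩
    ∑ N (λ u → ∑ᵗ k N (λ us → g u * ∏ᶠ (g ∘ us)))        ∎

  -- A soft indicator of bad tuples: it vanishes on the tuples to which a bound on common neighbours
  -- will apply, and its sum over all tuples is easy to estimate.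
  conflicts : ∀ {k} → (ℕ → ℕ → ℕ) → (Fin k → ℕ) → ℕ
  conflicts {zero}  conf us = 0
  conflicts {suc k} conf us = ∑ᶠ (λ i → conf (us zero) (us (suc i))) + conflicts conf (us ∘ suc)

  -- Freezing every entry except the first of a pair, each pair contributes at most B N^k / μ. The
  -- factor `k * k` overcounts the pairs, which spares a division by 2.
  ∑ᵗ-conflicts : ∀ k N μ B conf → (∀ u′ → ∑ N (λ u → conf u u′) * μ ≤ B * N) →
    ∑ᵗ k N (conflicts conf) * μ ≤ k * k * B * N ^ k
  ∑ᵗ-conflicts zero    N μ B conf bound = z≤n
  ∑ᵗ-conflicts (suc k) N μ B conf bound = begin
    ∑ N (λ u → ∑ᵗ k N (λ us → head u us + conflicts conf us)) * μ
      ≡⟨ ≡.cong (_* μ) (∑-cong N λ u _ → ∑ᵗ-distrib-+ k N (head u) (conflicts conf)) ⟩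
    ∑ N (λ u → ∑ᵗ k N (head u) + ∑ᵗ k N (conflicts conf)) * μ
      ≡⟨ ≡.cong (_* μ) (∑-distrib-+ N _ _) ⟩
    (∑ N (λ u → ∑ᵗ k N (head u)) + ∑ N (λ _ → ∑ᵗ k N (conflicts conf))) * μ
      ≡⟨ ≡.cong₂ (λ a b → (a + b) * μ) (∑-∑ᵗ-comm N k N head) (∑-const N _) ⟩
    (∑ᵗ k N (λ us → ∑ N (λ u → head u us)) + N * ∑ᵗ k N (conflicts conf)) * μ
      ≡⟨ lemma₁ _ N _ μ ⟩
    μ * ∑ᵗ k N (λ us → ∑ N (λ u → head u us)) + N * (∑ᵗ k N (conflicts conf) * μ)
      ≤⟨ +-mono-≤ heads (*-monoʳ-≤ N (∑ᵗ-conflicts k N μ B conf bound)) ⟩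
    N ^ k * (k * (B * N)) + N * (k * k * B * N ^ k)
      -- The surplus completes k^2 + k to (k + 1)^2.
      ≤⟨ m≤m+n _ (N ^ k * N * B * suc k) ⟩
    N ^ k * (k * (B * N)) + N * (k * k * B * N ^ k) + N ^ k * N * B * suc k
      ≡⟨ lemma₂ k B N (N ^ k) ⟩
    suc k * suc k * B * (N * N ^ k) ∎
    where
      head : ℕ → (Fin k → ℕ) → ℕ
      head u us = ∑ᶠ (λ i → conf u (us i))
      lemma₁ : ∀ a N b μ → (a + N * b) * μ ≡ μ * a + N * (b * μ)
      lemma₁ = solve-∀
      lemma₂ : ∀ k B N P → P * (k * (B * N)) + N * (k * k * B * P) + P * N * B * (1 + k) ≡ (1 + k) * (1 + k) * B * (N * P)
      lemma₂ = solve-∀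
      heads : μ * ∑ᵗ k N (λ us → ∑ N (λ u → head u us)) ≤ N ^ k * (k * (B * N))
      heads = begin
        μ * ∑ᵗ k N (λ us → ∑ N (λ u → head u us))    ≡⟨ ∑ᵗ-distrib-* k N μ _ ⟩
        ∑ᵗ k N (λ us → μ * ∑ N (λ u → head u us))    ≤⟨ ∑ᵗ-mono k N (λ us → begin
          μ * ∑ N (λ u → head u us)  ≡⟨ *-comm μ _ ⟩
          ∑ N (λ u → head u us) * μ  ≡⟨ ≡.cong (_* μ) (∑-∑ᶠ-comm N (λ u i → conf u (us i))) ⟩
          ∑ᶠ (λ i → ∑ N (λ u → conf u (us i))) * μ     ≡⟨ ∑ᶠ-distribʳ-* (λ i → ∑ N (λ u → conf u (us i))) μ ⟩
          ∑ᶠ (λ i → ∑ N (λ u → conf u (us i)) * μ)     ≤⟨ ∑ᶠ-bounded _ (λ i → bound (us i)) ⟩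
          k * (B * N)                                  ∎) ⟩
        ∑ᵗ k N (λ _ → k * (B * N))  ≡⟨ ∑ᵗ-const k N _ ⟩
        N ^ k * (k * (B * N))                        ∎

  -- Counts the pairs of a vertex v and a k-tuple of its neighbours, k = suc m. The power mean
  -- bounds their number below in terms of the edges; above, a tuple without conflicts has at most B
  -- common neighbours, any other at most N. By `μ ≤ N` the contribution of the former is absorbed
  -- into the estimate for the latter.
  kővári-sós-turán : ∀ m N μ B C (g : ℕ → ℕ → ℕ) conf → μ ≤ N → (∀ u v → g u v ≤ 1) →
    (∀ (us : Fin (suc m) → ℕ) → conflicts conf us ≡ 0 → ∑ N (λ v → ∏ᶠ (λ i → g (us i) v)) ≤ B) →
    (∀ u′ → ∑ N (λ u → conf u u′) * μ ≤ C * N) →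
    ∑ N (λ u → ∑ N (g u)) ^ suc m * μ ≤ (B + suc m * suc m * C) * N ^ (2 * suc m)
  kővári-sós-turán m N μ B C g conf μ≤N g≤1 free bound = begin
    ∑ N (λ u → ∑ N (g u)) ^ k * μ
      ≡⟨ ≡.cong (λ x → x ^ k * μ) (∑-comm N N g) ⟩
    ∑ N (λ v → ∑ N (λ u → g u v)) ^ k * μ
      ≤⟨ *-monoˡ-≤ μ (power-mean m N _) ⟩
    N ^ m * ∑ N (λ v → ∑ N (λ u → g u v) ^ k) * μ
      ≡⟨ ≡.cong (λ x → N ^ m * x * μ) (≡.trans (∑-cong N λ v _ → ∑-power k N (λ u → g u v)) (∑-∑ᵗ-comm N k N (λ v us → ∏ᶠ (λ i → g (us i) v)))) ⟩
    N ^ m * ∑ᵗ k N (λ us → ∑ N (λ v → ∏ᶠ (λ i → g (us i) v))) * μ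
      ≤⟨ *-monoˡ-≤ μ (*-monoʳ-≤ (N ^ m) (∑ᵗ-mono k N common)) ⟩
    N ^ m * ∑ᵗ k N (λ us → B + N * conflicts conf us) * μ
      ≡⟨ ≡.cong (λ x → N ^ m * x * μ) (≡.trans (∑ᵗ-distrib-+ k N (λ _ → B) (λ us → N * conflicts conf us))
           (≡.cong₂ _+_ (∑ᵗ-const k N B) (≡.sym (∑ᵗ-distrib-* k N N (conflicts conf))))) ⟩
    N ^ m * (N ^ k * B + N * ∑ᵗ k N (conflicts conf)) * μ
      ≡⟨ lemma₁ (N ^ m) (N ^ k) B N _ μ ⟩
    N ^ m * (N ^ k * B * μ + N * (∑ᵗ k N (conflicts conf) * μ))
      ≤⟨ *-monoʳ-≤ (N ^ m) (+-mono-≤ (*-monoʳ-≤ (N ^ k * B) μ≤N) (*-monoʳ-≤ N (∑ᵗ-conflicts k N μ C conf bound))) ⟩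
    N ^ m * (N ^ k * B * N + N * (k * k * C * N ^ k))
      ≡⟨ lemma₂ N (N ^ m) B (k * k * C) ⟩
    (B + k * k * C) * (N ^ k * N ^ k)
      ≡⟨ ≡.cong ((B + k * k * C) *_) (≡.trans (≡.sym (^-distribˡ-+-* N k k)) (≡.cong (λ x → N ^ (k + x)) (≡.sym (+-identityʳ k)))) ⟩
    (B + k * k * C) * N ^ (2 * k) ∎
    where
      k : ℕ
      k = suc m
      lemma₁ : ∀ P Q B N s μ → P * (Q * B + N * s) * μ ≡ P * (Q * B * μ + N * (s * μ))
      lemma₁ = solve-∀
      lemma₂ : ∀ N P B D → P * (N * P * B * N + N * (D * (N * P))) ≡ (B + D) * (N * P * (N * P))
      lemma₂ = solve-∀
      common : ∀ us → ∑ N (λ v → ∏ᶠ (λ i → g (us i) v)) ≤ B + N * conflicts conf us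
      common us with conflicts conf us in eq
      ... | zero  = ≤-trans (free us eq) (m≤m+n B _)
      -- A single conflict already pays for the trivial bound N.
      ... | suc c = begin
        ∑ N (λ v → ∏ᶠ (λ i → g (us i) v))  ≤⟨ ∑-bounded N (λ v _ → ∏ᶠ≤1 _ (λ i → g≤1 (us i) v)) ⟩
        N * 1  ≤⟨ *-monoʳ-≤ N (s≤s z≤n) ⟩
        N * suc c  ≤⟨ m≤n+m _ B ⟩
        B + N * suc c                      ∎

-- Products, sums and linear systems over a finite field.

module FieldProperties {q : ℕ} (K : FiniteField q) where
  open FiniteField K public hiding (zero) renaming (_≟_ to infix 4 _≟_)
  module ≈-Reasoning = Relation.Binary.Reasoning.Setoid setoid
  open ≈-Reasoning
  open Algebra.Properties.Semiring.Sum semiring public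
  open Algebra.Properties.CommutativeMonoid.Sum *-commutativeMonoid public
    using ()
    renaming (sum to prod; sum-cong-≋ to prod-cong; sum-remove to prod-remove)
  open Algebra.Properties.Ring (CommutativeRing.ring ring) public
  module Solver = Algebra.Solver.Ring.NaturalCoefficients.Default commutativeSemiring

  *-nonzero : ∀ {x y} → ¬ (x ≈ 0#) → ¬ (y ≈ 0#) → ¬ (x * y ≈ 0#)
  *-nonzero {x} {y} x≉0 y≉0 xy≈0 with x⁻¹ , x*x⁻¹≈1 ← inverse x x≉0 = y≉0 (begin
    y  ≈⟨ *-identityˡ y ⟨
    1# * y  ≈⟨ *-congʳ x*x⁻¹≈1 ⟨
    x * x⁻¹ * y    ≈⟨ solve 3 (λ a b c → (a :* b :* c) := (b :* (a :* c))) refl x x⁻¹ y ⟩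
    x⁻¹ * (x * y)  ≈⟨ *-congˡ xy≈0 ⟩
    x⁻¹ * 0#       ≈⟨ zeroʳ x⁻¹ ⟩
    0#             ∎)
    where open Solver using (solve; _:*_; _:=_)

  1≉0 : ¬ (1# ≈ 0#)
  1≉0 1≈0 = 0≉1 (sym 1≈0)

  prod-zero : ∀ {n} (f : Fin n → Carrier) i → f i ≈ 0# → prod f ≈ 0#
  prod-zero {suc n} f i fi≈0 = begin
    prod f  ≈⟨ prod-remove {i = i} f ⟩
    f i * prod (removeAt f i)  ≈⟨ *-congʳ fi≈0 ⟩
    0# * prod (removeAt f i)   ≈⟨ zeroˡ _ ⟩
    0#                         ∎

  prod-nonzero : ∀ {n} (f : Fin n → Carrier) → (∀ i → ¬ (f i ≈ 0#)) → ¬ (prod f ≈ 0#)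
  prod-nonzero {zero}  f f≉0 = 1≉0
  prod-nonzero {suc n} f f≉0 = *-nonzero (f≉0 zero) (prod-nonzero (f ∘ suc) (f≉0 ∘ suc))

  sum-zero : ∀ {n} {f : Fin n → Carrier} → (∀ i → f i ≈ 0#) → sum f ≈ 0#
  sum-zero {n} f≈0 = trans (sum-cong-≋ f≈0) (sum-replicate-zero n)

  sum-single : ∀ {n} (f : Fin n → Carrier) i → (∀ j → j ≢ i → f j ≈ 0#) → sum f ≈ f i
  sum-single {suc n} f i f≈0 = begin
    sum f  ≈⟨ sum-remove {i = i} f ⟩
    f i + sum (removeAt f i) ≈⟨ +-congˡ (sum-zero λ j → f≈0 _ (Finₚ.punchInᵢ≢i i j)) ⟩
    f i + 0#  ≈⟨ +-identityʳ (f i) ⟩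
    f i                      ∎

  -- Gaussian elimination on the first equation: if it is zero, one unknown is set to 0; otherwise a
  -- pivot unknown is expressed through the others and substituted into the remaining equations.
  nontrivial-kernel : ∀ p (E : Fin p → Fin (suc p) → Carrier) →
    ∃ λ (w : Fin (suc p) → Carrier) →
      (∃ λ v → ¬ (w v ≈ 0#)) × (∀ i → ∑[ v < suc p ] (E i v * w v) ≈ 0#)
  nontrivial-kernel zero    E = (λ _ → 1#) , (zero , 1≉0) , λ ()
  nontrivial-kernel (suc p) E with Finₚ.any? (λ v → ¬? (E zero v ≟ 0#))
  ... | no E₀≈0
    with w , (v , wv≉0) , Ew≈0 ← nontrivial-kernel p (λ i v → E (suc i) (suc v))
    = w⁺ , (suc v , wv≉0) , λ
        { zero    → sum-zero λ u → begin
            E zero u * w⁺ u  ≈⟨ *-congʳ (decidable-stable (E zero u ≟ 0#) λ E₀u≉0 → E₀≈0 (u , E₀u≉0)) ⟩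
            0# * w⁺ u        ≈⟨ zeroˡ (w⁺ u) ⟩
            0#               ∎
        ; (suc i) → trans (+-cong (zeroʳ (E (suc i) zero)) (Ew≈0 i)) (+-identityˡ 0#)
        }
    where
      w⁺ : Fin (suc (suc p)) → Carrier
      w⁺ zero    = 0#
      w⁺ (suc v) = w v
  ... | yes (v₀ , e≉0)
    with e⁻¹ , e*e⁻¹≈1 ← inverse (E zero v₀) e≉0
    with w , (v , wv≉0) , Ew≈0 ← nontrivial-kernel p (λ i v →
      E (suc i) (punchIn v₀ v) + E (suc i) v₀ * (- e⁻¹ * E zero (punchIn v₀ v)))
    = w⁺ , (punchIn v₀ v , wv≉0 ∘ trans (reflexive (≡.sym (Vectorₚ.insertAt-punchIn w v₀ _ v)))) , λ
        { zero → begin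
            sum (λ u → E zero u * w⁺ u)  ≈⟨ pivot (E zero) ⟩
            E zero v₀ * (- e⁻¹ * s) + s  ≈⟨ +-congʳ (*-assoc _ _ _) ⟨
            E zero v₀ * - e⁻¹ * s + s    ≈⟨ +-congʳ (*-congʳ (-‿distribʳ-* _ _)) ⟨
            - (E zero v₀ * e⁻¹) * s + s  ≈⟨ +-congʳ (*-congʳ (-‿cong e*e⁻¹≈1)) ⟩
            - 1# * s + s  ≈⟨ +-congʳ (-1*x≈-x s) ⟩
            - s + s  ≈⟨ -‿inverseˡ s ⟩
            0#                           ∎
        ; (suc i) → begin
            sum (λ u → E (suc i) u * w⁺ u)
              ≈⟨ pivot (E (suc i)) ⟩
            E (suc i) v₀ * (- e⁻¹ * s) + sum (λ u → E (suc i) (punchIn v₀ u) * w u)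
              ≈⟨ +-comm _ _ ⟩
            sum (λ u → E (suc i) (punchIn v₀ u) * w u) + E (suc i) v₀ * (- e⁻¹ * s)
              ≈⟨ +-congˡ (trans (*-congˡ (*-distribˡ-sum _ (E₀w))) (*-distribˡ-sum _ (λ u → - e⁻¹ * E₀w u))) ⟩
            sum (λ u → E (suc i) (punchIn v₀ u) * w u) +
            sum (λ u → E (suc i) v₀ * (- e⁻¹ * E₀w u))
              ≈⟨ ∑-distrib-+ (λ u → E (suc i) (punchIn v₀ u) * w u) (λ u → E (suc i) v₀ * (- e⁻¹ * E₀w u)) ⟨
            sum (λ u → E (suc i) (punchIn v₀ u) * w u +
                       E (suc i) v₀ * (- e⁻¹ * E₀w u))
              ≈⟨ sum-cong-≋ {suc p} (λ u → solve 5 (λ x c a y z → x :* z :+ c :* (a :* (y :* z)) := (x :+ c :* (a :* y)) :* z)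
                   refl (E (suc i) (punchIn v₀ u)) (E (suc i) v₀) (- e⁻¹) (E zero (punchIn v₀ u)) (w u)) ⟩
            sum (λ u → (E (suc i) (punchIn v₀ u) + E (suc i) v₀ * (- e⁻¹ * E zero (punchIn v₀ u))) * w u)
              ≈⟨ Ew≈0 i ⟩
            0# ∎
        }
    where
      open Solver using (solve; _:+_; _:*_; _:=_)
      E₀w : Fin (suc p) → Carrier
      E₀w u = E zero (punchIn v₀ u) * w u
      s : Carrier
      s = sum E₀w
      w⁺ : Fin (suc (suc p)) → Carrier
      -- The value of the pivot unknown that the first equation forces.
      w⁺ = insertAt w v₀ (- e⁻¹ * s)
      pivot : ∀ (c : Fin (suc (suc p)) → Carrier) →
        sum (λ u → c u * w⁺ u) ≈ c v₀ * (- e⁻¹ * s) + sum (λ u → c (punchIn v₀ u) * w u)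
      pivot c = trans (sum-remove {i = v₀} (λ u → c u * w⁺ u)) (+-cong
        (*-congˡ (reflexive (Vectorₚ.insertAt-lookup w v₀ _)))
        (sum-cong-≋ {suc p} λ u → *-congˡ {c (punchIn v₀ u)} (reflexive (Vectorₚ.insertAt-punchIn w v₀ (- e⁻¹ * s) u))))

-- Common neighbours in norm graphs, by interpolation.

module NormGraph {q : ℕ} (K : FiniteField q) where
  open FieldProperties K
  open ≈-Reasoning
  open Solver using (solve; _:+_; _:*_; _:=_)

  -- The pair (a , b) is the form a x + b, with a = 0 allowed. Since (0 , 1) is the constant 1,
  -- products of exactly D forms include products of fewer forms.
  Lin : Set
  Lin = Carrier × Carrier

  app : Lin → Carrier → Carrier
  app (a , b) x = a * x + b

  ev : List Lin → Carrier → Carrier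
  ev []      x = 1#
  ev (ℓ ∷ L) x = app ℓ x * ev L x

  evAll : ∀ {r} → (Fin r → List Lin) → (Fin r → Carrier) → Carrier
  evAll Ls x = prod (λ j → ev (Ls j) (x j))

  -- Linear independence of two forms, stated as it is used: any further factor splits along the
  -- two.
  Spans : Lin → Lin → Set
  Spans ℓ m = ∀ k → ∃₂ λ α β → ∀ x → app k x ≈ α * app ℓ x + β * app m x

  spans-1 : ∀ a → Spans (1# , a) (0# , 1#)
  spans-1 a (c , d) = c , d - c * a , λ x → begin
    c * x + d  ≈⟨ +-congˡ (+-identityˡ d) ⟨
    c * x + (0# + d)  ≈⟨ +-congˡ (+-congʳ (-‿inverseʳ (c * a))) ⟨
    c * x + (c * a - c * a + d)  ≈⟨ +-cong (*-congˡ (sym (*-identityˡ x))) (trans (+-assoc _ _ _) (+-congˡ (+-comm _ _))) ⟩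
    c * (1# * x) + (c * a + (d - c * a))  ≈⟨ +-assoc _ _ _ ⟨
    c * (1# * x) + c * a + (d - c * a)  ≈⟨ +-cong (distribˡ c _ _) (trans (*-congˡ (trans (+-congʳ (zeroˡ x)) (+-identityˡ 1#))) (*-identityʳ _)) ⟨
    c * (1# * x + a) + (d - c * a) * (0# * x + 1#)         ∎

  spans-swap : ∀ {ℓ m} → Spans ℓ m → Spans m ℓ
  spans-swap s k with α , β , eq ← s k = β , α , λ x → trans (eq x) (+-comm _ _)

  -- The constant form is the difference quotient ((x + b) - (x + a)) / (b - a).
  spans-≉ : ∀ {a b} → ¬ (a ≈ b) → Spans (1# , a) (1# , b)
  spans-≉ {a} {b} a≉b k
    with g , [b-a]g≈1 ← inverse (b - a) (λ b-a≈0 → a≉b (sym (x∙y⁻¹≈ε⇒x≈y b a b-a≈0)))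
    with α , β , eq ← spans-1 a k
    = α - β * g , β * g , λ x → begin
        app k x  ≈⟨ eq x ⟩
        α * app (1# , a) x + β * app (0# , 1#) x  ≈⟨ +-congˡ (*-congˡ (one x)) ⟩
        α * app (1# , a) x + β * (g * (b - a))  ≈⟨ +-congˡ (*-assoc β g _) ⟨
        α * app (1# , a) x + β * g * (b - a)  ≈⟨ lemma (β * g) x ⟩
        (α - β * g) * app (1# , a) x + β * g * app (1# , b) x ∎
    where
      lemma : ∀ h x → α * app (1# , a) x + h * (b - a) ≈ (α - h) * app (1# , a) x + h * app (1# , b) x
      lemma h x = begin
        α * (1# * x + a) + h * (b - a)
          ≈⟨ +-identityˡ _ ⟨
        0# + (α * (1# * x + a) + h * (b - a))
          ≈⟨ +-congʳ (trans (*-congʳ (-‿inverseʳ h)) (zeroˡ (1# * x))) ⟨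
        (h - h) * (1# * x) + (α * (1# * x + a) + h * (b - a))
          ≈⟨ +-congˡ (+-congˡ (trans (distribˡ h b (- a)) (+-congˡ (trans (sym (-‿distribʳ-* h a)) (-‿distribˡ-* h a))))) ⟩
        (h - h) * (1# * x) + (α * (1# * x + a) + (h * b + - h * a))
          ≈⟨ solve 6 (λ h h⁻ α x a b → (h :+ h⁻) :* x :+ (α :* (x :+ a) :+ (h :* b :+ h⁻ :* a)) :=
                        (α :+ h⁻) :* (x :+ a) :+ h :* (x :+ b)) refl h (- h) α (1# * x) a b ⟩
        (α - h) * (1# * x + a) + h * (1# * x + b) ∎
      one : ∀ x → app (0# , 1#) x ≈ g * (b - a)
      one x = begin
        0# * x + 1#  ≈⟨ +-congʳ (zeroˡ x) ⟩
        0# + 1#      ≈⟨ +-identityˡ 1# ⟩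
        1#  ≈⟨ [b-a]g≈1 ⟨
        (b - a) * g  ≈⟨ *-comm _ _ ⟩
        g * (b - a)  ∎

  -- Homogeneous Lagrange interpolation: the products that omit one of r + 1 pairwise independent
  -- forms span all forms of degree r, and e surplus factors ride along. To drop `ℓ zero`, split a
  -- factor of L along `ℓ zero` and `ℓ (suc i)`: multiplying the product that omits both by either
  -- of them gives a product that omits only one.
  lagrange : ∀ {n} (y w : Fin n → Carrier) r (ℓ : Fin (suc r) → Lin) →
    (∀ i j → i ≢ j → Spans (ℓ i) (ℓ j)) → ∀ e →
    (∀ i L → List.length L ≡ e → ∑[ v < n ] (w v * (prod (λ i′ → app (ℓ (punchIn i i′)) (y v)) * ev L (y v))) ≈ 0#) →
    ∀ L → List.length L ≡ r ℕ.+ e → ∑[ v < n ] (w v * ev L (y v)) ≈ 0#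
  lagrange {n} y w zero    ℓ sp e kills L |L| = trans (sum-cong-≋ {n} λ v → *-congˡ {w v} (sym (*-identityˡ (ev L (y v))))) (kills zero L |L|)
  lagrange {n} y w (suc r) ℓ sp e kills L |L| =
    lagrange y w r (ℓ ∘ suc) (λ i j i≢j → sp (suc i) (suc j) (i≢j ∘ Finₚ.suc-injective)) (suc e)
      kills′ L (≡.trans |L| (≡.sym (ℕₚ.+-suc r e)))
    where
      kills′ : ∀ i L → List.length L ≡ suc e →
        sum (λ v → w v * (prod (λ i′ → app (ℓ (suc (punchIn i i′))) (y v)) * ev L (y v))) ≈ 0#
      kills′ i (m ∷ L) |L| with α , β , eq ← sp (suc i) zero (λ ()) m = begin
        sum (λ v → w v * (P v * (app m (y v) * ev L (y v))))
          ≈⟨ sum-cong-≋ (λ v → begin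
               w v * (P v * (app m (y v) * ev L (y v)))
                 ≈⟨ *-congˡ (*-congˡ (*-congʳ (eq (y v)))) ⟩
               w v * (P v * ((α * A v + β * B v) * ev L (y v)))
                 ≈⟨ solve 7 (λ w p α a β b e → w :* (p :* ((α :* a :+ β :* b) :* e)) :=
                               α :* (w :* ((a :* p) :* e)) :+ β :* (w :* ((b :* p) :* e)))
                      refl (w v) (P v) α (A v) β (B v) (ev L (y v)) ⟩
               α * (w v * ((A v * P v) * ev L (y v))) + β * (w v * ((B v * P v) * ev L (y v)))
                 ≈⟨ +-congʳ (*-congˡ (*-congˡ (*-congʳ (prod-remove {i = i} (λ i′ → app (ℓ (suc i′)) (y v)))))) ⟨
               α * X v + β * Y v ∎) ⟩
        sum (λ v → α * X v + β * Y v)  ≈⟨ ∑-distrib-+ (λ v → α * X v) (λ v → β * Y v) ⟩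
        sum (λ v → α * X v) + sum (λ v → β * Y v)  ≈⟨ +-cong (*-distribˡ-sum α X) (*-distribˡ-sum β Y) ⟨
        α * sum X + β * sum Y  ≈⟨ +-cong (*-congˡ (kills zero L (ℕₚ.suc-injective |L|))) (*-congˡ (kills (suc i) L (ℕₚ.suc-injective |L|))) ⟩
        α * 0# + β * 0#  ≈⟨ +-cong (zeroʳ α) (zeroʳ β) ⟩
        0# + 0#  ≈⟨ +-identityˡ 0# ⟩
        0#                             ∎
        where
          P A B X Y : Fin n → Carrier
          P v = prod (λ i′ → app (ℓ (suc (punchIn i i′))) (y v))
          A v = app (ℓ (suc i)) (y v)
          B v = app (ℓ zero) (y v)
          X v = w v * (prod (λ i′ → app (ℓ (suc i′)) (y v)) * ev L (y v))
          Y v = w v * (prod (λ i′ → app (ℓ (punchIn (suc i) i′)) (y v)) * ev L (y v))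

  ev-++ : ∀ L M x → ev (L List.++ M) x ≈ ev L x * ev M x
  ev-++ []      M x = sym (*-identityˡ _)
  ev-++ (ℓ ∷ L) M x = trans (*-congˡ (ev-++ L M x)) (sym (*-assoc _ _ _))

  ev-tabulate : ∀ {n} (f : Fin n → Lin) x → ev (List.tabulate f) x ≈ prod (λ i → app (f i) x)
  ev-tabulate {zero}  f x = refl
  ev-tabulate {suc n} f x = *-congˡ (ev-tabulate (f ∘ suc) x)

  -- The weights w annihilate every polynomial of degree at most D in each of the r variables.
  Kills : ∀ {n r} → (Fin n → Fin r → Carrier) → (Fin n → Carrier) → ℕ → Set
  Kills {n} {r} x w D = ∀ (Ls : Fin r → List Lin) → (∀ j → List.length (Ls j) ≡ D) →
    ∑[ v < n ] (w v * evAll Ls (x v)) ≈ 0#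

  -- Interpolation in the first coordinate with all r + 1 forms leaves products that miss a single
  -- row i there. The other coordinates recurse with the rows different from i. When the recursion
  -- asks for the rest of a row i′, the first entry of that row is already among the factors, so the
  -- whole row product appears and the hypothesis applies with degree d left. One row remains when
  -- the coordinates are used up.
  kills-extend : ∀ {n} r d → r ℕ.≤ suc d → (ρ : Fin (suc r) → Fin r → Lin) →
    (∀ j i i′ → i ≢ i′ → Spans (ρ i j) (ρ i′ j)) → (x : Fin n → Fin r → Carrier) (w : Fin n → Carrier) →
    (∀ i → Kills x (λ v → w v * prod (λ j → app (ρ i j) (x v j))) d) → Kills x w (suc d)
  kills-extend {n} zero    d r≤1+d ρ sp x w kills Ls |Ls| =
    trans (sum-cong-≋ {n} λ v → *-congʳ {1#} (sym (*-identityʳ (w v)))) (kills zero (λ ()) (λ ()))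
  kills-extend {n} (suc r) d r≤1+d ρ sp x w kills Ls |Ls| = begin
    sum (λ v → w v * (ev (Ls zero) (x v zero) * E v))
      ≈⟨ sum-cong-≋ {n} (λ v → x*yz≈xz*y (w v) (ev (Ls zero) (x v zero)) (E v)) ⟩
    sum (λ v → w v * E v * ev (Ls zero) (x v zero))
      ≈⟨ lagrange (λ v → x v zero) (λ v → w v * E v) (suc r) (λ i → ρ i zero) (sp zero) e kills₀ (Ls zero)
           (≡.trans (|Ls| zero) (≡.cong suc (≡.sym (ℕₚ.m+[n∸m]≡n r≤d)))) ⟩
    0# ∎
    where
      r≤d : r ℕ.≤ d
      r≤d = ℕₚ.≤-pred r≤1+d
      -- Interpolation in the first coordinate consumes r + 1 of the d + 1 factors; e is the rest.
      e : ℕ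
      e = d ℕ.∸ r
      E : Fin n → Carrier
      E v = evAll (Ls ∘ suc) (x v ∘ suc)
      x*yz≈xz*y : ∀ x y z → x * (y * z) ≈ x * z * y
      x*yz≈xz*y = solve 3 (λ x y z → x :* (y :* z) := x :* z :* y) refl
      kills₀ : ∀ i L → List.length L ≡ e →
        sum (λ v → w v * E v * (prod (λ i′ → app (ρ (punchIn i i′) zero) (x v zero)) * ev L (x v zero))) ≈ 0#
      kills₀ i L |L| = begin
        sum (λ v → w v * E v * w₀ v)    ≈⟨ sum-cong-≋ {n} (λ v → solve 3 (λ x y z → x :* y :* z := x :* z :* y) refl (w v) (E v) (w₀ v)) ⟩
        sum (λ v → w v * w₀ v * E v)    ≈⟨ kills-extend r d (ℕₚ.m≤n⇒m≤1+n r≤d) (λ i′ j → ρ (punchIn i i′) (suc j))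
                                             (λ j i₁ i₂ i₁≢i₂ → sp (suc j) _ _ (i₁≢i₂ ∘ Finₚ.punchIn-injective i i₁ i₂))
                                             (λ v → x v ∘ suc) (λ v → w v * w₀ v) kills′ (Ls ∘ suc) (|Ls| ∘ suc) ⟩
        0#                              ∎
        where
          w₀ : Fin n → Carrier
          w₀ v = prod (λ i′ → app (ρ (punchIn i i′) zero) (x v zero)) * ev L (x v zero)
          kills′ : ∀ i′ → Kills (λ v → x v ∘ suc) (λ v → w v * w₀ v * prod (λ j → app (ρ (punchIn i i′) (suc j)) (x v (suc j)))) d
          kills′ i′ Ms |Ms| = begin
            sum (λ v → w v * w₀ v * P v * evAll Ms (x v ∘ suc))
              ≈⟨ sum-cong-≋ {n} (λ v → begin
                   w v * (prod (λ i″ → app (ρ (punchIn i i″) zero) (x v zero)) * ev L (x v zero)) * P v * evAll Ms (x v ∘ suc)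
                     ≈⟨ *-congʳ {evAll Ms (x v ∘ suc)} (*-congʳ {P v} (*-congˡ {w v} (*-congʳ {ev L (x v zero)}
                          (prod-remove {i = i′} (λ i″ → app (ρ (punchIn i i″) zero) (x v zero)))))) ⟩
                   w v * (A v * Q v * ev L (x v zero)) * P v * evAll Ms (x v ∘ suc)
                     ≈⟨ solve 6 (λ w a q l p m → w :* (a :* q :* l) :* p :* m := w :* (a :* p) :* (q :* l :* m)) refl
                          (w v) (A v) (Q v) (ev L (x v zero)) (P v) (evAll Ms (x v ∘ suc)) ⟩
                   w v * (A v * P v) * (Q v * ev L (x v zero) * evAll Ms (x v ∘ suc))
                     ≈⟨ *-congˡ (*-congʳ (trans (*-congʳ (sym (ev-tabulate {r} (λ i″ → ρ (punchIn i (punchIn i′ i″)) zero) (x v zero))))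
                          (sym (ev-++ T L (x v zero))))) ⟩
                   w v * (A v * P v) * (ev (Ms⁺ zero) (x v zero) * evAll Ms (x v ∘ suc)) ∎) ⟩
            sum (λ v → w v * (A v * P v) * evAll Ms⁺ (x v))
              ≈⟨ kills (punchIn i i′) Ms⁺ |Ms⁺| ⟩
            0# ∎
            where
              A P Q : Fin n → Carrier
              A v = app (ρ (punchIn i i′) zero) (x v zero)
              P v = prod (λ j → app (ρ (punchIn i i′) (suc j)) (x v (suc j)))
              Q v = prod (λ i″ → app (ρ (punchIn i (punchIn i′ i″)) zero) (x v zero))
              T : List Lin
              T = List.tabulate {n = r} (λ i″ → ρ (punchIn i (punchIn i′ i″)) zero)
              Ms⁺ : Fin (suc r) → List Lin
              Ms⁺ zero    = T List.++ L
              Ms⁺ (suc j) = Ms j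
              |Ms⁺| : ∀ j → List.length (Ms⁺ j) ≡ d
              |Ms⁺| zero    = ≡.trans (Listₚ.length-++ T {L})
                (≡.trans (≡.cong₂ ℕ._+_ (Listₚ.length-tabulate (λ i″ → ρ (punchIn i (punchIn i′ i″)) zero)) |L|) (ℕₚ.m+[n∸m]≡n r≤d))
              |Ms⁺| (suc j) = |Ms| j

  -- In one variable the κ + 1 products omitting one row span the polynomials of degree at most κ;
  -- products of these over the coordinates, one for each of the (κ + 1)^r choices `c`, therefore
  -- suffice.
  kills-lagrange-basis : ∀ {n κ} r (ρ : Fin (suc κ) → Fin r → Lin) →
    (∀ j i i′ → i ≢ i′ → Spans (ρ i j) (ρ i′ j)) → (x : Fin n → Fin r → Carrier) (w : Fin n → Carrier) →
    (∀ (c : Fin r → Fin (suc κ)) →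
      ∑[ v < n ] (w v * prod (λ j → prod (λ i → app (ρ (punchIn (c j) i) j) (x v j)))) ≈ 0#) →
    Kills x w κ
  kills-lagrange-basis {n} {κ} zero    ρ sp x w kills Ls |Ls| = kills (λ ())
  kills-lagrange-basis {n} {κ} (suc r) ρ sp x w kills Ls |Ls| = begin
    sum (λ v → w v * (ev (Ls zero) (x v zero) * E v))
      ≈⟨ sum-cong-≋ {n} (λ v → solve 3 (λ x y z → x :* (y :* z) := x :* z :* y) refl (w v) (ev (Ls zero) (x v zero)) (E v)) ⟩
    sum (λ v → w v * E v * ev (Ls zero) (x v zero))
      ≈⟨ lagrange (λ v → x v zero) (λ v → w v * E v) κ (λ i → ρ i zero) (sp zero) 0 kills₀ (Ls zero)
           (≡.trans (|Ls| zero) (≡.sym (ℕₚ.+-identityʳ κ))) ⟩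
    0# ∎
    where
      E : Fin n → Carrier
      E v = evAll (Ls ∘ suc) (x v ∘ suc)
      kills₀ : ∀ i L → List.length L ≡ 0 →
        sum (λ v → w v * E v * (prod (λ i′ → app (ρ (punchIn i i′) zero) (x v zero)) * ev L (x v zero))) ≈ 0#
      kills₀ i [] _ = begin
        sum (λ v → w v * E v * (Q v * 1#))
          ≈⟨ sum-cong-≋ {n} (λ v → trans (*-congˡ (*-identityʳ (Q v))) (solve 3 (λ x y z → x :* y :* z := x :* z :* y) refl (w v) (E v) (Q v))) ⟩
        sum (λ v → w v * Q v * E v)
          ≈⟨ kills-lagrange-basis r (λ i′ j → ρ i′ (suc j)) (sp ∘ suc) (λ v → x v ∘ suc) (λ v → w v * Q v)
               (λ c → trans (sum-cong-≋ {n} λ v → *-assoc (w v) (Q v) _) (kills (λ { zero → i ; (suc j) → c j })))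
               (Ls ∘ suc) (|Ls| ∘ suc) ⟩
        0# ∎
        where
          Q : Fin n → Carrier
          Q v = prod (λ i′ → app (ρ (punchIn i i′) zero) (x v zero))

  -- The constant k^k is the number of Lagrange basis products of degree κ in each of k variables,
  -- hence the number of linear conditions on the weights; one more point forces a non-zero
  -- solution. Algebraic geometry gives k! here, but only the dependence on k alone matters. The
  -- common values of the products may be 0.
  norm-graph : ∀ κ → let k = suc κ in (α : Fin k → Fin k → Carrier) →
    (∀ j i i′ → i ≢ i′ → ¬ (α i j ≈ α i′ j)) → (x : Fin (suc (k ℕ.^ k)) → Fin k → Carrier) →
    (∀ u v → u ≢ v → ∃ λ j → ¬ (x u j ≈ x v j)) →
    ¬ (∀ i u v → prod (λ j → x u j + α i j) ≈ prod (λ j → x v j + α i j))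
  norm-graph κ α α-distinct x x-distinct f-constant
    with nontrivial-kernel (suc κ ℕ.^ suc κ) (λ c v →
      prod (λ j → prod (λ i → app (1# , α (punchIn (Fin.finToFun c j) i) j) (x v j))))
  ... | w , (v₀ , wv₀≉0) , Ew≈0 = *-nonzero wv₀≉0 ev₀≉0 (begin
      w v₀ * evAll Ls (x v₀)  ≈⟨ sum-single (λ v → w v * evAll Ls (x v)) v₀ others ⟨
      sum (λ v → w v * evAll Ls (x v))       ≈⟨ kills n Ls |Ls| ⟩
      0#                                     ∎)
    where
      k n : ℕ
      k = suc κ
      n = suc (k ℕ.^ k)

      -- The constant form in row 0 plays the role of the point at infinity of every column:
      -- a product of d linear forms and the constant form has degree at most d.
      ρ : Fin (suc k) → Fin k → Lin
      ρ zero    j = 0# , 1#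
      ρ (suc i) j = 1# , α i j

      ρ-spans : ∀ j i i′ → i ≢ i′ → Spans (ρ i j) (ρ i′ j)
      ρ-spans j zero    zero     i≢i′ = contradiction ≡.refl i≢i′
      ρ-spans j zero    (suc i′) i≢i′ = spans-swap (spans-1 (α i′ j))
      ρ-spans j (suc i) zero     i≢i′ = spans-1 (α i j)
      ρ-spans j (suc i) (suc i′) i≢i′ = spans-≉ (α-distinct j i i′ (i≢i′ ∘ ≡.cong suc))

      kills-κ : Kills x w κ
      kills-κ = kills-lagrange-basis k (λ i j → 1# , α i j) (λ j i i′ i≢i′ → spans-≉ (α-distinct j i i′ i≢i′)) x w λ c →
        trans (sum-cong-≋ {n} λ v → trans (*-comm _ _) (*-congʳ {w v} (prod-cong {k} λ j → prod-cong {κ} λ i →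
          reflexive (≡.cong (λ h → app (1# , α (punchIn h i) j) (x v j)) (≡.sym (Finₚ.finToFun-funToFin c j))))))
          (Ew≈0 (Fin.funToFin c))

      -- At the given points the product of row i + 1 is the constant `b i`, and the product of row
      -- 0 is 1. So every hypothesis of `kills-extend` is a multiple of the assumption on w itself.
      kills-suc : ∀ d → κ ℕ.≤ d → Kills x w d → Kills x w (suc d)
      kills-suc d κ≤d kills = kills-extend k d (ℕ.s≤s κ≤d) ρ ρ-spans x w λ
        { zero Ls |Ls| → trans
            (sum-cong-≋ {n} λ v → *-congʳ {evAll Ls (x v)} (trans (*-congˡ {w v} (trans
              (prod-cong {k} {λ j → 0# * x v j + 1#} {λ _ → 1#} λ j → trans (+-congʳ (zeroˡ (x v j))) (+-identityˡ 1#)) (prod-1 k)))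
              (*-identityʳ (w v))))
            (kills Ls |Ls|)
        ; (suc i) Ls |Ls| → begin
            sum (λ v → w v * prod (λ j → 1# * x v j + α i j) * evAll Ls (x v))
              ≈⟨ sum-cong-≋ {n} (λ v → *-congʳ {evAll Ls (x v)} (*-congˡ {w v} (trans
                   (prod-cong {k} {λ j → 1# * x v j + α i j} {λ j → x v j + α i j} λ j → +-congʳ (*-identityˡ (x v j))) (f-constant i v zero)))) ⟩
            sum (λ v → w v * b i * evAll Ls (x v))
              ≈⟨ sum-cong-≋ {n} (λ v → solve 3 (λ w b e → w :* b :* e := b :* (w :* e)) refl (w v) (b i) (evAll Ls (x v))) ⟩
            sum (λ v → b i * (w v * evAll Ls (x v)))
              ≈⟨ *-distribˡ-sum (b i) (λ v → w v * evAll Ls (x v)) ⟨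
            b i * sum (λ v → w v * evAll Ls (x v))
              ≈⟨ *-congˡ (kills Ls |Ls|) ⟩
            b i * 0#
              ≈⟨ zeroʳ (b i) ⟩
            0# ∎
        }
        where
          b : Fin k → Carrier
          b i = prod (λ j → x zero j + α i j)
          prod-1 : ∀ m → prod {m} (λ _ → 1#) ≈ 1#
          prod-1 zero    = refl
          prod-1 (suc m) = trans (*-identityˡ _) (prod-1 m)

      kills : ∀ e → Kills x w (e ℕ.+ κ)
      kills zero    = kills-κ
      kills (suc e) = kills-suc (e ℕ.+ κ) (ℕₚ.m≤n+m κ e) (kills e)

      form-at : Fin n → Fin k → Fin k → Lin
      form-at v j₀ j with j Fin.≟ j₀
      ... | yes _ = 1# , - x v j
      ... | no _  = 0# , 1#

      form : Fin n → Fin k → Lin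
      form v j with v Fin.≟ v₀
      ... | yes _ = 0# , 1#
      ... | no v≢v₀ = form-at v (proj₁ (x-distinct v v₀ v≢v₀)) j

      app-1 : ∀ y → app (0# , 1#) y ≈ 1#
      app-1 y = trans (+-congʳ (zeroˡ y)) (+-identityˡ 1#)

      form-zero : ∀ v → v ≢ v₀ → ∃ λ j → app (form v j) (x v j) ≈ 0#
      form-zero v v≢v₀ with v Fin.≟ v₀
      ... | yes v≡v₀ = contradiction v≡v₀ v≢v₀
      ... | no v≢v₀ with x-distinct v v₀ v≢v₀
      ...   | j₀ , _ = j₀ , vanishes
        where
          vanishes : app (form-at v j₀ j₀) (x v j₀) ≈ 0#
          vanishes with j₀ Fin.≟ j₀
          ... | yes _    = trans (+-congʳ (*-identityˡ _)) (-‿inverseʳ _)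
          ... | no j₀≢j₀ = contradiction ≡.refl j₀≢j₀

      form-nonzero : ∀ v j → ¬ (app (form v j) (x v₀ j) ≈ 0#)
      form-nonzero v j with v Fin.≟ v₀
      ... | yes _ = 1≉0 ∘ trans (sym (app-1 _))
      ... | no v≢v₀ with x-distinct v v₀ v≢v₀
      ...   | j₀ , xvj₀≉xv₀j₀ with j Fin.≟ j₀
      ...     | yes ≡.refl = λ eq → xvj₀≉xv₀j₀ (sym (x∙y⁻¹≈ε⇒x≈y _ _ (trans (+-congʳ (sym (*-identityˡ _))) eq)))
      ...     | no _  = 1≉0 ∘ trans (sym (app-1 _))

      -- The product over all points v of a form in one coordinate where v differs from `v₀`,
      -- vanishing at v and not at `v₀`. The κ constant factors bring the length to n + κ, where
      -- `kills n` applies.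
      Ls : Fin k → List Lin
      Ls j = List.tabulate (λ v → form v j) List.++ List.replicate κ (0# , 1#)

      |Ls| : ∀ j → List.length (Ls j) ≡ n ℕ.+ κ
      |Ls| j = ≡.trans (Listₚ.length-++ (List.tabulate (λ v → form v j)))
        (≡.cong₂ ℕ._+_ (Listₚ.length-tabulate (λ v → form v j)) (Listₚ.length-replicate κ))

      ev-Ls : ∀ j y → ev (Ls j) y ≈ prod (λ v → app (form v j) y)
      ev-Ls j y = begin
        ev (Ls j) y
          ≈⟨ ev-++ (List.tabulate (λ v → form v j)) (List.replicate κ (0# , 1#)) y ⟩
        ev (List.tabulate (λ v → form v j)) y * ev (List.replicate κ (0# , 1#)) y
          ≈⟨ *-cong (ev-tabulate (λ v → form v j) y) (ev-1 κ) ⟩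
        prod (λ v → app (form v j) y) * 1#
          ≈⟨ *-identityʳ _ ⟩
        prod (λ v → app (form v j) y) ∎
        where
          ev-1 : ∀ m → ev (List.replicate m (0# , 1#)) y ≈ 1#
          ev-1 zero    = refl
          ev-1 (suc m) = trans (*-cong (app-1 y) (ev-1 m)) (*-identityˡ 1#)

      others : ∀ v → v ≢ v₀ → w v * evAll Ls (x v) ≈ 0#
      others v v≢v₀ with j , eq ← form-zero v v≢v₀ = trans
        (*-congˡ (prod-zero (λ j → ev (Ls j) (x v j)) j
          (trans (ev-Ls j (x v j)) (prod-zero (λ u → app (form u j) (x v j)) v eq))))
        (zeroʳ (w v))

      ev₀≉0 : ¬ (evAll Ls (x v₀) ≈ 0#)
      ev₀≉0 = prod-nonzero (λ j → ev (Ls j) (x v₀ j)) λ j →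
        prod-nonzero (λ v → app (form v j) (x v₀ j)) (λ v → form-nonzero v j) ∘ trans (sym (ev-Ls j (x v₀ j)))

-- Powers and roots of unity.

module Powers {q : ℕ} (K : FiniteField q) where
  open FieldProperties K public
  open ≈-Reasoning
  open Algebra.Properties.CommutativeSemiring.Exp commutativeSemiring public

  1^n≈1 : ∀ n → 1# ^ n ≈ 1#
  1^n≈1 zero    = refl
  1^n≈1 (suc n) = trans (*-identityˡ _) (1^n≈1 n)

  ^-1-multiple : ∀ x m n → x ^ m ≈ 1# → x ^ (n ℕ.* m) ≈ 1#
  ^-1-multiple x m n x^m≈1 = begin
    x ^ (n ℕ.* m)  ≈⟨ ^-congʳ x (ℕₚ.*-comm n m) ⟩
    x ^ (m ℕ.* n)  ≈⟨ ^-assocʳ x m n ⟨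
    (x ^ m) ^ n    ≈⟨ ^-congˡ n x^m≈1 ⟩
    1# ^ n  ≈⟨ 1^n≈1 n ⟩
    1#             ∎

  ^-period : ∀ x m n r → x ^ m ≈ 1# → x ^ (n ℕ.* m ℕ.+ r) ≈ x ^ r
  ^-period x m n r x^m≈1 = begin
    x ^ (n ℕ.* m ℕ.+ r)    ≈⟨ ^-homo-* x (n ℕ.* m) r ⟩
    x ^ (n ℕ.* m) * x ^ r  ≈⟨ *-congʳ (^-1-multiple x m n x^m≈1) ⟩
    1# * x ^ r  ≈⟨ *-identityˡ _ ⟩
    x ^ r                  ∎

  ^-mod : ∀ x t .{{_ : ℕ.NonZero t}} a b → x ^ t ≈ 1# → a ℕ.% t ≡ b ℕ.% t → x ^ a ≈ x ^ b
  ^-mod x t a b x^t≈1 a≡b = begin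
    x ^ a  ≈⟨ reduce a ⟩
    x ^ (a ℕ.% t)  ≈⟨ ^-congʳ x a≡b ⟩
    x ^ (b ℕ.% t)  ≈⟨ reduce b ⟨
    x ^ b          ∎
    where
      reduce : ∀ a → x ^ a ≈ x ^ (a ℕ.% t)
      reduce a = trans (^-congʳ x (≡.trans (DivMod.m≡m%n+[m/n]*n a t) (ℕₚ.+-comm (a ℕ.% t) _))) (^-period x t (a ℕ./ t) (a ℕ.% t) x^t≈1)

  ^-nonzero : ∀ {x} → ¬ (x ≈ 0#) → ∀ n → ¬ (x ^ n ≈ 0#)
  ^-nonzero x≉0 zero    = 1≉0
  ^-nonzero x≉0 (suc n) = *-nonzero x≉0 (^-nonzero x≉0 n)

  root-of-unity-nonzero : ∀ {x n} → 1 ℕ.≤ n → x ^ n ≈ 1# → ¬ (x ≈ 0#)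
  root-of-unity-nonzero {x} {suc n} _ x^n≈1 x≈0 = 0≉1 (trans (sym (trans (*-congʳ x≈0) (zeroˡ _))) x^n≈1)

  *-cancelˡ : ∀ {x y z} → ¬ (x ≈ 0#) → x * y ≈ x * z → y ≈ z
  *-cancelˡ {x} {y} {z} x≉0 xy≈xz with x⁻¹ , x*x⁻¹≈1 ← inverse x x≉0 = begin
    y  ≈⟨ undo y ⟨
    x⁻¹ * (x * y)  ≈⟨ *-congˡ xy≈xz ⟩
    x⁻¹ * (x * z)  ≈⟨ undo z ⟩
    z              ∎
    where
      undo : ∀ y → x⁻¹ * (x * y) ≈ y
      undo y = trans (sym (*-assoc _ _ _)) (trans (*-congʳ (trans (*-comm _ _) x*x⁻¹≈1)) (*-identityˡ y))

  ^-cancel : ∀ {x} → ¬ (x ≈ 0#) → ∀ a d → x ^ a ≈ x ^ (a ℕ.+ d) → x ^ d ≈ 1#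
  ^-cancel {x} x≉0 a d eq = *-cancelˡ (^-nonzero x≉0 a) (trans (sym (^-homo-* x a d)) (trans (sym eq) (sym (*-identityʳ _))))

  prod-^ : ∀ {n} (f : Fin n → Carrier) d → prod (λ i → f i ^ d) ≈ prod f ^ d
  prod-^ {zero}  f d = sym (1^n≈1 d)
  prod-^ {suc n} f d = trans (*-congˡ (prod-^ (f ∘ suc) d)) (sym (^-distrib-* (f zero) (prod (f ∘ suc)) d))

-- The energy bound for a partly discarded spectrum.

module EnergyBound {q : ℕ} (K : FiniteField q) (Q : ℕ → ℕ → ℕ → ℕ → ℕ) (Q≤1 : ∀ a b c d → Q a b c d ℕ.≤ 1)
                   (τ t : ℕ) (1≤τ : 1 ℕ.≤ τ) (1≤t : 1 ℕ.≤ t) where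
  open Powers K
  open NormGraph K using (norm-graph)
  open Counting hiding (∑-distrib-+; ∑-comm)

  -- The eigenvalues are split into those still in play (λJ) and those already discarded (λR);
  -- M is the joint order of the discarded ones, and the others are only used through λ ^ M.
  record Spectrum {k l} (λJ : Fin k → Carrier) (λR : Fin l → Carrier) (M N : ℕ) : Set where
    field
      τ≡N*M  : τ ≡ N ℕ.* M
      solJ   : ∀ a b c d → Q a b c d ≢ 0 → ∀ j → λJ j ^ a + λJ j ^ b ≈ λJ j ^ c + λJ j ^ d
      solR   : ∀ a b c d → Q a b c d ≢ 0 → ∀ j → λR j ^ a + λR j ^ b ≈ λR j ^ c + λR j ^ d
      J^τ≈1  : ∀ j → λJ j ^ τ ≈ 1#
      R^M≈1  : ∀ j → λR j ^ M ≈ 1#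
      orderR : ∀ x → (∀ j → λR j ^ x ≈ 1#) → M ∣ x
      order  : ∀ x → (∀ j → λJ j ^ x ≈ 1#) → (∀ j → λR j ^ x ≈ 1#) → τ ∣ x
      det^t≈1 : (prod λJ * prod λR) ^ t ≈ 1#

  -- Indices from 0 to τ - 1 stand for exponents from 1 to τ, hence the successors.
  energy : ℕ
  energy = ∑ τ λ a → ∑ τ λ b → ∑ τ λ c → ∑ τ λ d → Q (suc a) (suc b) (suc c) (suc d)

  ∑∑-residues : ∀ N M (G : ℕ → ℕ → ℕ) → ∑ (N ℕ.* M) (λ a → ∑ (N ℕ.* M) (G a)) ≡
    ∑ M (λ r → ∑ M (λ s → ∑ N (λ u → ∑ N (λ v → G (u ℕ.* M ℕ.+ r) (v ℕ.* M ℕ.+ s)))))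
  ∑∑-residues N M G = begin
    ∑ (N ℕ.* M) (λ a → ∑ (N ℕ.* M) (G a))
      ≡⟨ ∑-blocks N M _ ⟩
    ∑ N (λ u → ∑ M (λ r → ∑ (N ℕ.* M) (G (u ℕ.* M ℕ.+ r))))
      ≡⟨ Counting.∑-comm N M _ ⟩
    ∑ M (λ r → ∑ N (λ u → ∑ (N ℕ.* M) (G (u ℕ.* M ℕ.+ r))))
      ≡⟨ ∑-cong M (λ r _ → ≡.trans
           (∑-cong N λ u _ → ≡.trans (∑-blocks N M (G (u ℕ.* M ℕ.+ r))) (Counting.∑-comm N M _))
           (Counting.∑-comm N M _)) ⟩
    ∑ M (λ r → ∑ M (λ s → ∑ N (λ u → ∑ N (λ v → G (u ℕ.* M ℕ.+ r) (v ℕ.* M ℕ.+ s))))) ∎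
    where open ≡.≡-Reasoning

  module _ {m l} {λJ : Fin (suc m) → Carrier} {λR : Fin l → Carrier} {M N} (S : Spectrum λJ λR M N) where
    open Spectrum S
    private
      k : ℕ
      k = suc m

      instance
        t-nonZero : ℕ.NonZero t
        t-nonZero = ℕ.>-nonZero 1≤t
        τ-nonZero : ℕ.NonZero τ
        τ-nonZero = ℕ.>-nonZero 1≤τ

    1≤N : 1 ℕ.≤ N
    1≤N = ℕ.>-nonZero⁻¹ N {{ℕₚ.m*n≢0⇒m≢0 N {{≡.subst ℕ.NonZero τ≡N*M τ-nonZero}}}}

    1≤M : 1 ℕ.≤ M
    1≤M = ℕ.>-nonZero⁻¹ M {{ℕₚ.m*n≢0⇒n≢0 N {{≡.subst ℕ.NonZero τ≡N*M τ-nonZero}}}}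

    J≉0 : ∀ j → ¬ (λJ j ≈ 0#)
    J≉0 j = root-of-unity-nonzero 1≤τ (J^τ≈1 j)

    R≉0 : ∀ j → ¬ (λR j ≈ 0#)
    R≉0 j = root-of-unity-nonzero 1≤M (R^M≈1 j)

    determined : ∀ {a b c d d′} → Q a b c d ≢ 0 → Q a b c d′ ≢ 0 → (∀ j → λJ j ^ d ≈ λJ j ^ d′) × (∀ j → λR j ^ d ≈ λR j ^ d′)
    determined {a} {b} {c} {d} {d′} Q≢0 Q′≢0 =
      (λ j → +-cancelˡ _ _ _ (trans (sym (solJ a b c d Q≢0 j)) (solJ a b c d′ Q′≢0 j))) ,
      (λ j → +-cancelˡ _ _ _ (trans (sym (solR a b c d Q≢0 j)) (solR a b c d′ Q′≢0 j)))

    exponent-unique-≤ : ∀ {d d′} → d ℕ.≤ d′ → d′ ℕ.< τ →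
      (∀ j → λJ j ^ suc d ≈ λJ j ^ suc d′) → (∀ j → λR j ^ suc d ≈ λR j ^ suc d′) → d ≡ d′
    exponent-unique-≤ {d} {d′} d≤d′ d′<τ eqJ eqR with ℕₚ.m≤n⇒∃[o]m+o≡n d≤d′
    ... | zero  , ≡.refl = ≡.sym (ℕₚ.+-identityʳ d)
    ... | suc e , ≡.refl = contradiction
      (∣.∣⇒≤ (order (suc e) (λ j → ^-cancel (J≉0 j) (suc d) (suc e) (eqJ j)) (λ j → ^-cancel (R≉0 j) (suc d) (suc e) (eqR j))))
      (ℕₚ.<⇒≱ (ℕₚ.≤-<-trans (ℕₚ.m≤n+m (suc e) d) d′<τ))

    exponent-unique : ∀ {d d′} → d ℕ.< τ → d′ ℕ.< τ →
      (∀ j → λJ j ^ suc d ≈ λJ j ^ suc d′) → (∀ j → λR j ^ suc d ≈ λR j ^ suc d′) → d ≡ d′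
    exponent-unique {d} {d′} d<τ d′<τ eqJ eqR with ℕₚ.≤-total d d′
    ... | inj₁ d≤d′ = exponent-unique-≤ d≤d′ d′<τ eqJ eqR
    ... | inj₂ d′≤d = ≡.sym (exponent-unique-≤ d′≤d d<τ (sym ∘ eqJ) (sym ∘ eqR))

    solutions-unique : ∀ a b c → ∑ τ (λ d → Q a b c (suc d)) ℕ.≤ 1
    solutions-unique a b c = ∑-unique τ _ (λ d → Q≤1 a b c (suc d)) λ d d′ d<τ d′<τ Q≢0 Q′≢0 →
      exponent-unique d<τ d′<τ (proj₁ (determined Q≢0 Q′≢0)) (proj₂ (determined Q≢0 Q′≢0))

    -- Three exponents determine the fourth, which gives τ^3; the factor t brings the bound to the
    -- quantity t τ^3 that the main estimate uses.
    energy-trivial : energy ℕ.≤ t ℕ.* τ ℕ.^ 3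
    energy-trivial = begin
      energy  ≤⟨ ∑-bounded τ (λ a _ → ∑-bounded τ λ b _ → ∑-bounded τ λ c _ → solutions-unique (suc a) (suc b) (suc c)) ⟩
      τ ℕ.* (τ ℕ.* (τ ℕ.* 1))  ≡⟨⟩
      τ ℕ.^ 3  ≤⟨ ℕₚ.m≤n*m (τ ℕ.^ 3) t ⟩
      t ℕ.* τ ℕ.^ 3                   ∎
      where open ℕₚ.≤-Reasoning

    -- μ bounds the orders of the powers λJ j ^ M from below: only exponents in one residue class
    -- modulo M are compared.
    module _ (μ : ℕ) (1≤μ : 1 ℕ.≤ μ) (order≥μ : ∀ j x → 1 ℕ.≤ x → x ℕ.< μ → ¬ (λJ j ^ (x ℕ.* M) ≈ 1#)) where

      μ≤N : μ ℕ.≤ N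
      μ≤N = ℕₚ.≮⇒≥ λ N<μ → order≥μ zero N 1≤N N<μ (trans (^-congʳ (λJ zero) (≡.sym τ≡N*M)) (J^τ≈1 zero))

      J-spaced : ∀ j r {u v} → u ℕ.< v → λJ j ^ suc (u ℕ.* M ℕ.+ r) ≈ λJ j ^ suc (v ℕ.* M ℕ.+ r) → u ℕ.+ μ ℕ.≤ v
      J-spaced j r {u} {v} u<v eq with ℕₚ.m≤n⇒∃[o]m+o≡n (ℕₚ.<⇒≤ u<v)
      ... | d , ≡.refl = ℕₚ.+-monoʳ-≤ u (ℕₚ.≮⇒≥ λ d<μ → order≥μ j d 1≤d d<μ
            (^-cancel (J≉0 j) (suc (u ℕ.* M ℕ.+ r)) (d ℕ.* M) (trans eq (^-congʳ (λJ j) (≡.cong suc (lemma u d M r))))))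
        where
          1≤d : 1 ℕ.≤ d
          1≤d = ℕₚ.+-cancelˡ-≤ u 1 d (≡.subst (ℕ._≤ u ℕ.+ d) (ℕₚ.+-comm 1 u) u<v)
          lemma : ∀ u d M r → (u ℕ.+ d) ℕ.* M ℕ.+ r ≡ u ℕ.* M ℕ.+ r ℕ.+ d ℕ.* M
          lemma = solve-∀

      -- One class of quadruples: after subtracting 1 from each exponent, x₃ is c, the residues of
      -- x₁ and x₂ modulo M are r and s, and that of x₄ modulo t is p. The quotients u and v remain
      -- free and are the vertices of the graph `g`.
      module Class (c r s p : ℕ) where
        hit : ℕ → ℕ → ℕ → ℕ
        hit u v d = Q (suc (u ℕ.* M ℕ.+ r)) (suc (v ℕ.* M ℕ.+ s)) (suc c) (suc d) ℕ.* δ (d ℕ.% t) p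

        g : ℕ → ℕ → ℕ
        g u v = ∑ τ (hit u v)

        hit-Q : ∀ u v d → hit u v d ≢ 0 → Q (suc (u ℕ.* M ℕ.+ r)) (suc (v ℕ.* M ℕ.+ s)) (suc c) (suc d) ≢ 0
        hit-Q u v d h≢0 Q≡0 = h≢0 (≡.cong (ℕ._* δ (d ℕ.% t) p) Q≡0)

        hit-p : ∀ u v d → hit u v d ≢ 0 → d ℕ.% t ≡ p
        hit-p u v d h≢0 = δ≢0 (d ℕ.% t) p λ δ≡0 → h≢0 (≡.trans (≡.cong (Q _ _ _ _ ℕ.*_) δ≡0) (ℕₚ.*-zeroʳ (Q _ _ _ _)))

        g≤1 : ∀ u v → g u v ℕ.≤ 1
        g≤1 u v = ℕₚ.≤-trans
          (∑-mono τ λ d _ → ℕₚ.≤-trans (ℕₚ.*-monoʳ-≤ (Q _ _ _ _) (δ≤1 (d ℕ.% t) p)) (ℕₚ.≤-reflexive (ℕₚ.*-identityʳ (Q _ _ _ _))))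
          (solutions-unique _ _ _)

        coincide : ℕ → ℕ → Fin k → ℕ
        coincide u v j = if isYes (λJ j ^ suc (u ℕ.* M ℕ.+ r) ≟ λJ j ^ suc (v ℕ.* M ℕ.+ r)) then 1 else 0

        coincide≤1 : ∀ u v j → coincide u v j ℕ.≤ 1
        coincide≤1 u v j with λJ j ^ suc (u ℕ.* M ℕ.+ r) ≟ λJ j ^ suc (v ℕ.* M ℕ.+ r)
        ... | yes _ = ℕₚ.≤-refl
        ... | no  _ = ℕ.z≤n

        coincide≢0 : ∀ u v j → coincide u v j ≢ 0 → λJ j ^ suc (u ℕ.* M ℕ.+ r) ≈ λJ j ^ suc (v ℕ.* M ℕ.+ r)
        coincide≢0 u v j ≢0 with λJ j ^ suc (u ℕ.* M ℕ.+ r) ≟ λJ j ^ suc (v ℕ.* M ℕ.+ r)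
        ... | yes eq = eq
        ... | no  _  = contradiction ≡.refl ≢0

        coincide≡0 : ∀ u v j → coincide u v j ≡ 0 → ¬ (λJ j ^ suc (u ℕ.* M ℕ.+ r) ≈ λJ j ^ suc (v ℕ.* M ℕ.+ r))
        coincide≡0 u v j ≡0 with λJ j ^ suc (u ℕ.* M ℕ.+ r) ≟ λJ j ^ suc (v ℕ.* M ℕ.+ r)
        ... | no ¬eq = ¬eq

        conf : ℕ → ℕ → ℕ
        conf u v = ∑ᶠ (coincide u v)

        -- In each of the k coordinates the u that agree with v lie at least μ apart, so there are
        -- at most N / μ + 1 ≤ 2 N / μ of them.
        conf-bound : ∀ v → ∑ N (λ u → conf u v) ℕ.* μ ℕ.≤ (k ℕ.* 2) ℕ.* N
        conf-bound v = begin
          ∑ N (λ u → conf u v) ℕ.* μ  ≡⟨ ≡.cong (ℕ._* μ) (∑-∑ᶠ-comm N (λ u → coincide u v)) ⟩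
          ∑ᶠ (λ j → ∑ N (λ u → coincide u v j)) ℕ.* μ   ≡⟨ ∑ᶠ-distribʳ-* (λ j → ∑ N (λ u → coincide u v j)) μ ⟩
          ∑ᶠ (λ j → ∑ N (λ u → coincide u v j) ℕ.* μ)   ≤⟨ ∑ᶠ-bounded (λ j → ∑ N (λ u → coincide u v j) ℕ.* μ) (λ j → ℕₚ.≤-trans
                                                             (∑-spaced μ 1≤μ N (λ u → coincide u v j) (λ u → coincide≤1 u v j) λ u u′ u<u′ ≢0 ≢0′ →
                                                               J-spaced j r u<u′ (trans (coincide≢0 u v j ≢0) (sym (coincide≢0 u′ v j ≢0′))))
                                                             (ℕₚ.+-monoʳ-≤ N (ℕₚ.≤-trans μ≤N (ℕₚ.≤-reflexive (≡.sym (ℕₚ.+-identityʳ N)))))) ⟩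
          k ℕ.* (2 ℕ.* N)  ≡⟨ ℕₚ.*-assoc k 2 N ⟨
          (k ℕ.* 2) ℕ.* N                               ∎
          where open ℕₚ.≤-Reasoning

        conflicts-≢ : ∀ {n} (us : Fin n → ℕ) → conflicts conf us ≡ 0 → ∀ j i i′ → i ≢ i′ →
          ¬ (λJ j ^ suc (us i ℕ.* M ℕ.+ r) ≈ λJ j ^ suc (us i′ ℕ.* M ℕ.+ r))
        conflicts-≢ us ≡0 j zero    zero     i≢i′ = contradiction ≡.refl i≢i′
        conflicts-≢ us ≡0 j zero    (suc i′) i≢i′ =
          coincide≡0 (us zero) (us (suc i′)) j (∑ᶠ-zero (coincide (us zero) (us (suc i′))) (∑ᶠ-zero (λ i → conf (us zero) (us (suc i))) (ℕₚ.m+n≡0⇒m≡0 _ ≡0) i′) j)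
        conflicts-≢ us ≡0 j (suc i) zero     i≢i′ = conflicts-≢ us ≡0 j zero (suc i) (i≢i′ ∘ ≡.sym) ∘ sym
        conflicts-≢ us ≡0 j (suc i) (suc i′) i≢i′ =
          conflicts-≢ (us ∘ suc) (ℕₚ.m+n≡0⇒n≡0 (∑ᶠ (λ i → conf (us zero) (us (suc i)))) ≡0) j i i′ (i≢i′ ∘ ≡.cong suc)

        -- The two exponents differ by a multiple of M, at which the discarded eigenvalues are 1; so
        -- agreement at the λJ makes τ = N * M divide that multiple.
        residue-unique-≤ : ∀ {u v} → u ℕ.≤ v → v ℕ.< N →
          (∀ j → λJ j ^ suc (u ℕ.* M ℕ.+ s) ≈ λJ j ^ suc (v ℕ.* M ℕ.+ s)) → u ≡ v
        residue-unique-≤ {u} {v} u≤v v<N eq with ℕₚ.m≤n⇒∃[o]m+o≡n u≤v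
        ... | zero  , ≡.refl = ≡.sym (ℕₚ.+-identityʳ u)
        ... | suc d , ≡.refl = contradiction
          (∣.∣⇒≤ (∣.*-cancelʳ-∣ M {{ℕ.>-nonZero 1≤M}} (≡.subst (_∣ suc d ℕ.* M) τ≡N*M (order (suc d ℕ.* M)
            (λ j → ^-cancel (J≉0 j) (suc (u ℕ.* M ℕ.+ s)) (suc d ℕ.* M) (trans (eq j) (^-congʳ (λJ j) (≡.cong suc (lemma u (suc d) M s)))))
            (λ j → ^-1-multiple (λR j) M (suc d) (R^M≈1 j))))))
          (ℕₚ.<⇒≱ (ℕₚ.≤-<-trans (ℕₚ.m≤n+m (suc d) u) v<N))
          where
            lemma : ∀ u d M r → (u ℕ.+ d) ℕ.* M ℕ.+ r ≡ u ℕ.* M ℕ.+ r ℕ.+ d ℕ.* M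
            lemma = solve-∀

        residue-unique : ∀ {u v} → u ℕ.< N → v ℕ.< N →
          (∀ j → λJ j ^ suc (u ℕ.* M ℕ.+ s) ≈ λJ j ^ suc (v ℕ.* M ℕ.+ s)) → u ≡ v
        residue-unique {u} {v} u<N v<N eq with ℕₚ.≤-total u v
        ... | inj₁ u≤v = residue-unique-≤ u≤v v<N eq
        ... | inj₂ v≤u = ≡.sym (residue-unique-≤ v≤u u<N (sym ∘ eq))

        -- The residue of x₄ modulo t fixes only the product over all eigenvalues, and the discarded
        -- factors have to be divided out. For these x₂ matters only modulo M, so with u, c, r and s
        -- fixed the equation gives the same power λR j ^ x₄ for v and v′.
        norm-constant : ∀ u v v′ d d′ → hit u v d ≢ 0 → hit u v′ d′ ≢ 0 →
          prod (λ j → λJ j ^ suc d) ≈ prod (λ j → λJ j ^ suc d′)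
        norm-constant u v v′ d d′ h h′ = *-cancelˡ (prod-nonzero (λ j → λR j ^ suc d) (λ j → ^-nonzero (R≉0 j) (suc d))) (begin
          prod (λ j → λR j ^ suc d) * prod (λ j → λJ j ^ suc d)    ≈⟨ full d ⟩
          (prod λJ * prod λR) ^ suc d  ≈⟨ *-congˡ (^-mod (prod λJ * prod λR) t d d′ det^t≈1 (≡.trans (hit-p u v d h) (≡.sym (hit-p u v′ d′ h′)))) ⟩
          (prod λJ * prod λR) ^ suc d′  ≈⟨ full d′ ⟨
          prod (λ j → λR j ^ suc d′) * prod (λ j → λJ j ^ suc d′)  ≈⟨ *-congʳ (prod-cong {_} {λ j → λR j ^ suc d} {λ j → λR j ^ suc d′} R-eq) ⟨
          prod (λ j → λR j ^ suc d) * prod (λ j → λJ j ^ suc d′)   ∎)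
          where
            open ≈-Reasoning
            full : ∀ d → prod (λ j → λR j ^ suc d) * prod (λ j → λJ j ^ suc d) ≈ (prod λJ * prod λR) ^ suc d
            full d = begin
              prod (λ j → λR j ^ suc d) * prod (λ j → λJ j ^ suc d)  ≈⟨ *-cong (prod-^ λR (suc d)) (prod-^ λJ (suc d)) ⟩
              prod λR ^ suc d * prod λJ ^ suc d  ≈⟨ *-comm _ _ ⟩
              prod λJ ^ suc d * prod λR ^ suc d  ≈⟨ ^-distrib-* (prod λJ) (prod λR) (suc d) ⟨
              (prod λJ * prod λR) ^ suc d                            ∎
            R-shift : ∀ j v → λR j ^ suc (v ℕ.* M ℕ.+ s) ≈ λR j ^ suc s
            R-shift j v = *-congˡ (^-period (λR j) M v s (R^M≈1 j))
            R-eq : ∀ j → λR j ^ suc d ≈ λR j ^ suc d′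
            R-eq j = +-cancelˡ (λR j ^ suc c) _ _ (begin
              λR j ^ suc c + λR j ^ suc d  ≈⟨ solR _ _ _ _ (hit-Q u v d h) j ⟨
              λR j ^ suc (u ℕ.* M ℕ.+ r) + λR j ^ suc (v ℕ.* M ℕ.+ s)  ≈⟨ +-congˡ (trans (R-shift j v) (sym (R-shift j v′))) ⟩
              λR j ^ suc (u ℕ.* M ℕ.+ r) + λR j ^ suc (v′ ℕ.* M ℕ.+ s)  ≈⟨ solR _ _ _ _ (hit-Q u v′ d′ h′) j ⟩
              λR j ^ suc c + λR j ^ suc d′                                     ∎)

        -- A vertex u supplies the row of the λⱼ^x₁, a common neighbour v the point with coordinates
        -- λⱼ^x₂ - λⱼ^x₃. As x₃ belongs to the class, the point does not depend on u. Absence of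
        -- conflicts is the distinctness that `norm-graph` asks of the rows.
        free : ∀ (us : Fin k → ℕ) → conflicts conf us ≡ 0 → ∑ N (λ v → ∏ᶠ (λ i → g (us i) v)) ℕ.≤ k ℕ.^ k
        free us ≡0 = ℕₚ.≮⇒≥ λ k^k<∑ → absurd (support N (λ v → ∏ᶠ (λ i → g (us i) v)) (λ v → ∏ᶠ≤1 _ (λ i → g≤1 (us i) v)) k^k<∑)
          where
            absurd : ¬ (∃ λ (e : Fin (suc (k ℕ.^ k)) → ℕ) →
              (∀ n → e n ℕ.< N × ∏ᶠ (λ i → g (us i) (e n)) ≢ 0) × (∀ m n → m ≢ n → e m ≢ e n))
            absurd (e , hits , inj) = norm-graph m α (conflicts-≢ us ≡0) x x-distinct constant
              where
                α : Fin k → Fin k → Carrier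
                α i j = λJ j ^ suc (us i ℕ.* M ℕ.+ r)
                x : Fin (suc (k ℕ.^ k)) → Fin k → Carrier
                x n j = λJ j ^ suc (e n ℕ.* M ℕ.+ s) - λJ j ^ suc c
                x-distinct : ∀ n n′ → n ≢ n′ → ∃ λ j → ¬ (x n j ≈ x n′ j)
                x-distinct n n′ n≢n′ = Finₚ.¬∀⟶∃¬ k _ (λ j → x n j ≟ x n′ j) λ eq →
                  inj n n′ n≢n′ (residue-unique (proj₁ (hits n)) (proj₁ (hits n′)) λ j → +-cancelʳ _ _ _ (eq j))
                exponent : ∀ i n → ∃ λ d → d ℕ.< τ × hit (us i) (e n) d ≢ 0
                exponent i n = ∑-nonzero τ _ (∏ᶠ≢0 (λ i → g (us i) (e n)) (proj₂ (hits n)) i)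
                value : ∀ i n → prod (λ j → x n j + α i j) ≈ prod (λ j → λJ j ^ suc (proj₁ (exponent i n)))
                value i n = prod-cong {k} {λ j → x n j + α i j} {λ j → λJ j ^ suc (proj₁ (exponent i n))} λ j → begin
                  b j - c′ j + α i j      ≈⟨ +-comm _ _ ⟩
                  α i j + (b j - c′ j)    ≈⟨ +-assoc _ _ _ ⟨
                  α i j + b j - c′ j      ≈⟨ +-congʳ (solJ _ _ _ _ (hit-Q (us i) (e n) _ (proj₂ (proj₂ (exponent i n)))) j) ⟩
                  c′ j + d j - c′ j       ≈⟨ xyx⁻¹≈y (c′ j) (d j) ⟩
                  d j                     ∎
                  where
                    open ≈-Reasoning
                    b c′ d : Fin k → Carrier
                    b j = λJ j ^ suc (e n ℕ.* M ℕ.+ s)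
                    c′ j = λJ j ^ suc c
                    d j = λJ j ^ suc (proj₁ (exponent i n))
                constant : ∀ i n n′ → prod (λ j → x n j + α i j) ≈ prod (λ j → x n′ j + α i j)
                constant i n n′ = trans (value i n) (trans
                  (norm-constant (us i) (e n) (e n′) _ _ (proj₂ (proj₂ (exponent i n))) (proj₂ (proj₂ (exponent i n′)))) (sym (value i n′)))

        class-bound : ∑ N (λ u → ∑ N (g u)) ℕ.^ k ℕ.* μ ℕ.≤ (k ℕ.^ k ℕ.+ k ℕ.* k ℕ.* (k ℕ.* 2)) ℕ.* N ℕ.^ (2 ℕ.* k)
        class-bound = kővári-sós-turán m N μ (k ℕ.^ k) (k ℕ.* 2) g conf μ≤N g≤1 free conf-bound

      energy-classes : energy ≡ ∑ τ (λ c → ∑ M λ r → ∑ M λ s → ∑ t λ p → ∑ N λ u → ∑ N (Class.g c r s p u))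
      energy-classes = begin
        ∑ τ (λ a → ∑ τ λ b → ∑ τ λ c → ∑ τ λ d → Q (suc a) (suc b) (suc c) (suc d))
          ≡⟨ ∑-cong τ (λ a _ → Counting.∑-comm τ τ _) ⟩
        ∑ τ (λ a → ∑ τ λ c → ∑ τ λ b → ∑ τ λ d → Q (suc a) (suc b) (suc c) (suc d))
          ≡⟨ Counting.∑-comm τ τ _ ⟩
        ∑ τ (λ c → ∑ τ λ a → ∑ τ λ b → ∑ τ λ d → Q (suc a) (suc b) (suc c) (suc d))
          ≡⟨ ∑-cong τ (λ c _ → split c) ⟩
        ∑ τ (λ c → ∑ M λ r → ∑ M λ s → ∑ t λ p → ∑ N λ u → ∑ N (Class.g c r s p u)) ∎
        where
          open ≡.≡-Reasoning
          G : ℕ → ℕ → ℕ → ℕ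
          G c a b = ∑ τ λ d → Q (suc a) (suc b) (suc c) (suc d)
          split : ∀ c → ∑ τ (λ a → ∑ τ (G c a)) ≡ ∑ M (λ r → ∑ M λ s → ∑ t λ p → ∑ N λ u → ∑ N (Class.g c r s p u))
          split c = begin
            ∑ τ (λ a → ∑ τ (G c a))
              ≡⟨ ≡.cong (λ n → ∑ n (λ a → ∑ n (G c a))) τ≡N*M ⟩
            ∑ (N ℕ.* M) (λ a → ∑ (N ℕ.* M) (G c a))
              ≡⟨ ∑∑-residues N M (G c) ⟩
            ∑ M (λ r → ∑ M λ s → ∑ N λ u → ∑ N λ v → G c (u ℕ.* M ℕ.+ r) (v ℕ.* M ℕ.+ s))
              ≡⟨ ∑-cong M (λ r _ → ∑-cong M λ s _ → begin
                   ∑ N (λ u → ∑ N λ v → G c (u ℕ.* M ℕ.+ r) (v ℕ.* M ℕ.+ s))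
                     ≡⟨ ∑-cong N (λ u _ → ∑-cong N λ v _ → ∑-classes τ t (ℕ._% t) (λ d → DivMod.m%n<n d t) _) ⟩
                   ∑ N (λ u → ∑ N λ v → ∑ t λ p → Class.g c r s p u v)
                     ≡⟨ ∑-cong N (λ u _ → Counting.∑-comm N t _) ⟩
                   ∑ N (λ u → ∑ t λ p → ∑ N λ v → Class.g c r s p u v)
                     ≡⟨ Counting.∑-comm N t _ ⟩
                   ∑ t (λ p → ∑ N λ u → ∑ N λ v → Class.g c r s p u v) ∎) ⟩
            ∑ M (λ r → ∑ M λ s → ∑ t λ p → ∑ N λ u → ∑ N (Class.g c r s p u)) ∎

      -- There are τ M^2 t classes, each with O(N^2 μ^(-1/k)) solutions, and N M = τ.
      energy-bound : energy ℕ.^ k ℕ.* μ ℕ.≤ (k ℕ.^ k ℕ.+ k ℕ.* k ℕ.* (k ℕ.* 2)) ℕ.* (t ℕ.* τ ℕ.^ 3) ℕ.^ k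
      energy-bound = begin
        energy ℕ.^ k ℕ.* μ
          ≡⟨ ≡.cong (λ e → e ℕ.^ k ℕ.* μ) energy-classes ⟩
        ∑ τ (λ c → ∑ M λ r → ∑ M λ s → ∑ t λ p → ∑ N λ u → ∑ N (Class.g c r s p u)) ℕ.^ k ℕ.* μ
          ≤⟨ ∑-power-bound m μ _ τ _ (λ c _ → ∑-power-bound m μ _ M _ λ r _ → ∑-power-bound m μ _ M _ λ s _ →
               ∑-power-bound m μ _ t _ λ p _ → Class.class-bound c r s p) ⟩
        τ ℕ.^ k ℕ.* (M ℕ.^ k ℕ.* (M ℕ.^ k ℕ.* (t ℕ.^ k ℕ.* (C ℕ.* N ℕ.^ (2 ℕ.* k)))))
          ≡⟨ ≡.cong (λ x → τ ℕ.^ k ℕ.* (M ℕ.^ k ℕ.* (M ℕ.^ k ℕ.* (t ℕ.^ k ℕ.* (C ℕ.* x)))))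
               (≡.trans (≡.sym (ℕₚ.^-*-assoc N 2 k)) (≡.trans (≡.cong (λ x → (N ℕ.* x) ℕ.^ k) (ℕₚ.*-identityʳ N)) (^-distribʳ-* k N N))) ⟩
        τ ℕ.^ k ℕ.* (M ℕ.^ k ℕ.* (M ℕ.^ k ℕ.* (t ℕ.^ k ℕ.* (C ℕ.* (N ℕ.^ k ℕ.* N ℕ.^ k)))))
          ≡⟨ lemma (τ ℕ.^ k) (M ℕ.^ k) (t ℕ.^ k) C (N ℕ.^ k) ⟩
        C ℕ.* (t ℕ.^ k ℕ.* (τ ℕ.^ k ℕ.* ((N ℕ.^ k ℕ.* M ℕ.^ k) ℕ.* (N ℕ.^ k ℕ.* M ℕ.^ k))))
          ≡⟨ ≡.cong (λ x → C ℕ.* (t ℕ.^ k ℕ.* (τ ℕ.^ k ℕ.* (x ℕ.* x)))) (≡.trans (≡.sym (^-distribʳ-* k N M)) (≡.cong (ℕ._^ k) (≡.sym τ≡N*M))) ⟩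
        C ℕ.* (t ℕ.^ k ℕ.* (τ ℕ.^ k ℕ.* (τ ℕ.^ k ℕ.* τ ℕ.^ k)))
          ≡⟨ ≡.cong (C ℕ.*_) (≡.sym (≡.trans (^-distribʳ-* k t (τ ℕ.^ 3)) (≡.cong (t ℕ.^ k ℕ.*_)
               (≡.trans (^-distribʳ-* k τ (τ ℕ.^ 2)) (≡.cong (τ ℕ.^ k ℕ.*_) (≡.trans (≡.cong (λ x → (τ ℕ.* x) ℕ.^ k) (ℕₚ.*-identityʳ τ)) (^-distribʳ-* k τ τ))))))) ⟩
        C ℕ.* (t ℕ.* τ ℕ.^ 3) ℕ.^ k ∎
        where
          open ℕₚ.≤-Reasoning
          C : ℕ
          C = k ℕ.^ k ℕ.+ k ℕ.* k ℕ.* (k ℕ.* 2)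
          lemma : ∀ T M t C N → T ℕ.* (M ℕ.* (M ℕ.* (t ℕ.* (C ℕ.* (N ℕ.* N))))) ≡ C ℕ.* (t ℕ.* (T ℕ.* ((N ℕ.* M) ℕ.* (N ℕ.* M))))
          lemma = solve-∀

-- Arithmetic of the exponents.

module Exponents where
  open import Data.Nat
  open ℕₚ
  open ≤-Reasoning
  open Counting using (^-distribʳ-*)

  ^-cancel-≤ : ∀ n .{{_ : NonZero n}} {a b} → a ^ n ≤ b ^ n → a ≤ b
  ^-cancel-≤ n a^n≤b^n = ≮⇒≥ λ b<a → <⇒≱ (^-monoˡ-< n b<a) a^n≤b^n

  m≤m^n : ∀ m n .{{_ : NonZero n}} → m ≤ m ^ n
  m≤m^n zero    (suc n) = z≤n
  m≤m^n (suc m) (suc n) = ≤-trans (≤-reflexive (≡.sym (*-identityʳ (suc m)))) (*-monoʳ-≤ (suc m) (m^n>0 (suc m) n))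

  module _ (E X : ℕ) where

    raise : ∀ C μ m n → E ^ m * μ ≤ C * X ^ m → E ^ (m * n) * μ ^ n ≤ C ^ n * X ^ (m * n)
    raise C μ m n bound = begin
      E ^ (m * n) * μ ^ n      ≡⟨ ≡.cong (_* μ ^ n) (^-*-assoc E m n) ⟨
      (E ^ m) ^ n * μ ^ n      ≡⟨ ^-distribʳ-* n (E ^ m) μ ⟨
      (E ^ m * μ) ^ n  ≤⟨ ^-monoˡ-≤ n bound ⟩
      (C * X ^ m) ^ n  ≡⟨ ^-distribʳ-* n C (X ^ m) ⟩
      C ^ n * (X ^ m) ^ n      ≡⟨ ≡.cong (C ^ n *_) (^-*-assoc X m n) ⟩
      C ^ n * X ^ (m * n)      ∎

    -- The constant keeps its size, since C ≤ C ^ n; this way it stays an integer.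
    extract-root : ∀ C N Y m n .{{_ : NonZero n}} → E ^ (m * n) * N ^ n ≤ C * (X ^ (m * n) * Y ^ n) →
      E ^ m * N ≤ C * (X ^ m * Y)
    extract-root C N Y m n bound = ^-cancel-≤ n (begin
      (E ^ m * N) ^ n  ≡⟨ ^-distribʳ-* n (E ^ m) N ⟩
      (E ^ m) ^ n * N ^ n  ≡⟨ ≡.cong (_* N ^ n) (^-*-assoc E m n) ⟩
      E ^ (m * n) * N ^ n  ≤⟨ bound ⟩
      C * (X ^ (m * n) * Y ^ n)  ≤⟨ *-monoˡ-≤ _ (m≤m^n C n) ⟩
      C ^ n * (X ^ (m * n) * Y ^ n)     ≡⟨ ≡.cong (λ x → C ^ n * (x * Y ^ n)) (^-*-assoc X m n) ⟨
      C ^ n * ((X ^ m) ^ n * Y ^ n)     ≡⟨ ≡.cong (C ^ n *_) (^-distribʳ-* n (X ^ m) Y) ⟨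
      C ^ n * (X ^ m * Y) ^ n  ≡⟨ ^-distribʳ-* n C (X ^ m * Y) ⟨
      (C * (X ^ m * Y)) ^ n             ∎)

    -- Used to bring bounds with different exponents of E to a common one, at the cost of some
    -- strength.
    multiply-trivial : ∀ C N Y m n → E ≤ X → E ^ m * N ≤ C * (X ^ m * Y) → E ^ (m + n) * N ≤ C * (X ^ (m + n) * Y)
    multiply-trivial C N Y m n E≤X bound = begin
      E ^ (m + n) * N  ≡⟨ ≡.cong (_* N) (^-distribˡ-+-* E m n) ⟩
      E ^ m * E ^ n * N  ≡⟨ lemma₁ (E ^ m) (E ^ n) N ⟩
      E ^ n * (E ^ m * N)        ≤⟨ *-mono-≤ (^-monoˡ-≤ n E≤X) bound ⟩
      X ^ n * (C * (X ^ m * Y))  ≡⟨ lemma₂ (X ^ m) (X ^ n) C Y ⟩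
      C * (X ^ m * X ^ n * Y)    ≡⟨ ≡.cong (λ x → C * (x * Y)) (^-distribˡ-+-* X m n) ⟨
      C * (X ^ (m + n) * Y)      ∎
      where
        lemma₁ : ∀ a b N → a * b * N ≡ b * (a * N)
        lemma₁ = solve-∀
        lemma₂ : ∀ a b C Y → b * (C * (a * Y)) ≡ C * (a * b * Y)
        lemma₂ = solve-∀

    large-orders₁ : ∀ C N o k → N ≤ o ^ k → E ^ k * o ≤ C * X ^ k → E ^ (k * k) * N ≤ C ^ k * X ^ (k * k)
    large-orders₁ C N o k N≤o^k bound = ≤-trans (*-monoʳ-≤ (E ^ (k * k)) N≤o^k) (raise C o k k bound)

    -- From o^k ≤ N follows N′^k ≥ N^(k-1). The k-th power of the bound for k - 1 eigenvalues,
    -- followed by a (k-1)-th root, therefore bounds E^((k-1)k) N, and the trivial bound raises the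
    -- exponent to k^2.
    small-order₁ : ∀ C N N′ o m → let k′ = suc m ; k = suc k′ in E ≤ X → 1 ≤ N → N ≡ N′ * o → o ^ k ≤ N →
      E ^ (k′ * k′) * N′ ≤ C * X ^ (k′ * k′) → E ^ (k * k) * N ≤ C ^ k * X ^ (k * k)
    small-order₁ C N N′ o m E≤X 1≤N N≡N′o o^k≤N bound = begin
      E ^ (k * k) * N  ≡⟨ ≡.cong (λ e → E ^ e * N) (+-comm k (k′ * k)) ⟩
      E ^ (k′ * k + k) * N  ≤⟨ multiply-trivial (C ^ k) N 1 (k′ * k) k E≤X (extract-root (C ^ k) N 1 (k′ * k) k′ rooted) ⟩
      C ^ k * (X ^ (k′ * k + k) * 1) ≡⟨ ≡.cong (C ^ k *_) (*-identityʳ _) ⟩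
      C ^ k * X ^ (k′ * k + k)       ≡⟨ ≡.cong (λ e → C ^ k * X ^ e) (+-comm (k′ * k) k) ⟩
      C ^ k * X ^ (k * k)            ∎
      where
        k k′ : ℕ
        k = suc (suc m)
        k′ = suc m
        N-power : N ^ k′ ≤ N′ ^ k
        N-power = *-cancelˡ-≤ N {{>-nonZero 1≤N}} (begin
          N * N ^ k′  ≡⟨ ≡.cong (_^ k) N≡N′o ⟩
          (N′ * o) ^ k  ≡⟨ ^-distribʳ-* k N′ o ⟩
          N′ ^ k * o ^ k       ≤⟨ *-monoʳ-≤ (N′ ^ k) o^k≤N ⟩
          N′ ^ k * N  ≡⟨ *-comm (N′ ^ k) N ⟩
          N * N′ ^ k           ∎)
        exponent : ∀ k k′ → k′ * k * k′ ≡ k′ * k′ * k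
        exponent = solve-∀
        rooted : E ^ (k′ * k * k′) * N ^ k′ ≤ C ^ k * (X ^ (k′ * k * k′) * 1 ^ k′)
        rooted = begin
          E ^ (k′ * k * k′) * N ^ k′  ≤⟨ *-monoʳ-≤ (E ^ (k′ * k * k′)) N-power ⟩
          E ^ (k′ * k * k′) * N′ ^ k  ≡⟨ ≡.cong (λ e → E ^ e * N′ ^ k) (exponent k k′) ⟩
          E ^ (k′ * k′ * k) * N′ ^ k  ≤⟨ raise C N′ (k′ * k′) k bound ⟩
          C ^ k * X ^ (k′ * k′ * k)  ≡⟨ ≡.cong (λ e → C ^ k * X ^ e) (exponent k k′) ⟨
          C ^ k * X ^ (k′ * k * k′)  ≡⟨ ≡.cong (C ^ k *_) (≡.trans (≡.cong (X ^ (k′ * k * k′) *_) (^-zeroˡ k′)) (*-identityʳ _)) ⟨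
          C ^ k * (X ^ (k′ * k * k′) * 1 ^ k′)    ∎

    large-orders₂ : ∀ C N o T k k′ → N ≤ o ^ k′ * T → E ^ k * o ≤ C * X ^ k → E ^ (k * k′) * N ≤ C ^ k′ * (X ^ (k * k′) * T)
    large-orders₂ C N o T k k′ N≤ bound = begin
      E ^ (k * k′) * N  ≤⟨ *-monoʳ-≤ (E ^ (k * k′)) N≤ ⟩
      E ^ (k * k′) * (o ^ k′ * T)    ≡⟨ *-assoc (E ^ (k * k′)) (o ^ k′) T ⟨
      E ^ (k * k′) * o ^ k′ * T      ≤⟨ *-monoˡ-≤ T (raise C o k k′ bound) ⟩
      C ^ k′ * X ^ (k * k′) * T      ≡⟨ *-assoc (C ^ k′) (X ^ (k * k′)) T ⟩
      C ^ k′ * (X ^ (k * k′) * T)    ∎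

    -- The threshold gives N′^(k-1) ≥ N^(k-2) t^k. The (k-1)-th power of the bound for k - 1
    -- eigenvalues has t^((k-1)^2) on the right; as (k-1)^2 ≤ k (k-2) + k, the factor t^k cancels
    -- and leaves (t^k)^(k-2), ready for the (k-2)-th root.
    small-order₂ : ∀ C N N′ o t m → let k″ = suc m ; k′ = suc k″ ; k = suc k′ in
      E ≤ X → 1 ≤ t → 1 ≤ o → N ≡ N′ * o → o ^ k′ * t ^ k ≤ N →
      E ^ (k′ * k″) * N′ ≤ C * (X ^ (k′ * k″) * t ^ k′) → E ^ (k * k′) * N ≤ C ^ k′ * (X ^ (k * k′) * t ^ k)
    small-order₂ C N N′ o t m E≤X 1≤t 1≤o N≡N′o small bound = begin
      E ^ (k * k′) * N  ≡⟨ ≡.cong (λ e → E ^ e * N) (+-comm k′ (k′ * k′)) ⟩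
      E ^ (k′ * k′ + k′) * N  ≤⟨ multiply-trivial (C ^ k′) N (t ^ k) (k′ * k′) k′ E≤X
                                                  (extract-root (C ^ k′) N (t ^ k) (k′ * k′) k″ rooted) ⟩
      C ^ k′ * (X ^ (k′ * k′ + k′) * t ^ k)  ≡⟨ ≡.cong (λ e → C ^ k′ * (X ^ e * t ^ k)) (+-comm (k′ * k′) k′) ⟩
      C ^ k′ * (X ^ (k * k′) * t ^ k)        ∎
      where
        k k′ k″ : ℕ
        k = suc (suc (suc m))
        k′ = suc (suc m)
        k″ = suc m
        instance
          t-nonZero : NonZero t
          t-nonZero = >-nonZero 1≤t
          o-nonZero : NonZero o
          o-nonZero = >-nonZero 1≤o
        N-power : N ^ k″ * t ^ k ≤ N′ ^ k′
        N-power = *-cancelˡ-≤ (o ^ k′) {{m^n≢0 o k′}} (begin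
          o ^ k′ * (N ^ k″ * t ^ k)    ≡⟨ lemma (o ^ k′) (N ^ k″) (t ^ k) ⟩
          N ^ k″ * (o ^ k′ * t ^ k)    ≤⟨ *-monoʳ-≤ (N ^ k″) small ⟩
          N ^ k″ * N  ≡⟨ *-comm (N ^ k″) N ⟩
          N ^ k′  ≡⟨ ≡.cong (_^ k′) N≡N′o ⟩
          (N′ * o) ^ k′  ≡⟨ ^-distribʳ-* k′ N′ o ⟩
          N′ ^ k′ * o ^ k′  ≡⟨ *-comm (N′ ^ k′) (o ^ k′) ⟩
          o ^ k′ * N′ ^ k′             ∎)
          where
            lemma : ∀ a b c → a * (b * c) ≡ b * (a * c)
            lemma = solve-∀
        k′k′≤k″k+k : k′ * k′ ≤ k * k″ + k
        k′k′≤k″k+k = ≤-trans (*-monoʳ-≤ k′ (n≤1+n k′)) (≤-reflexive (lemma k″))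
          where
            lemma : ∀ x → (1 + x) * (2 + x) ≡ (2 + x) * x + (2 + x)
            lemma = solve-∀
        exponent : ∀ k′ k″ → k′ * k′ * k″ ≡ k′ * k″ * k′
        exponent = solve-∀
        rooted : E ^ (k′ * k′ * k″) * N ^ k″ ≤ C ^ k′ * (X ^ (k′ * k′ * k″) * (t ^ k) ^ k″)
        rooted = *-cancelʳ-≤ _ _ (t ^ k) {{m^n≢0 t k}} (begin
          E ^ (k′ * k′ * k″) * N ^ k″ * t ^ k  ≡⟨ *-assoc (E ^ (k′ * k′ * k″)) _ _ ⟩
          E ^ (k′ * k′ * k″) * (N ^ k″ * t ^ k)  ≤⟨ *-monoʳ-≤ (E ^ (k′ * k′ * k″)) N-power ⟩
          E ^ (k′ * k′ * k″) * N′ ^ k′  ≡⟨ ≡.cong (λ e → E ^ e * N′ ^ k′) (exponent k′ k″) ⟩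
          E ^ (k′ * k″ * k′) * N′ ^ k′  ≡⟨ ≡.cong (_* N′ ^ k′) (^-*-assoc E (k′ * k″) k′) ⟨
          (E ^ (k′ * k″)) ^ k′ * N′ ^ k′  ≡⟨ ^-distribʳ-* k′ (E ^ (k′ * k″)) N′ ⟨
          (E ^ (k′ * k″) * N′) ^ k′  ≤⟨ ^-monoˡ-≤ k′ bound ⟩
          (C * (X ^ (k′ * k″) * t ^ k′)) ^ k′  ≡⟨ ^-distribʳ-* k′ C _ ⟩
          C ^ k′ * (X ^ (k′ * k″) * t ^ k′) ^ k′  ≡⟨ ≡.cong (C ^ k′ *_) (^-distribʳ-* k′ (X ^ (k′ * k″)) (t ^ k′)) ⟩
          C ^ k′ * ((X ^ (k′ * k″)) ^ k′ * (t ^ k′) ^ k′)  ≡⟨ ≡.cong₂ (λ x y → C ^ k′ * (x * y)) (^-*-assoc X (k′ * k″) k′) (^-*-assoc t k′ k′) ⟩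
          C ^ k′ * (X ^ (k′ * k″ * k′) * t ^ (k′ * k′))  ≤⟨ *-monoʳ-≤ (C ^ k′) (*-monoʳ-≤ (X ^ (k′ * k″ * k′)) (^-monoʳ-≤ t k′k′≤k″k+k)) ⟩
          C ^ k′ * (X ^ (k′ * k″ * k′) * t ^ (k * k″ + k))  ≡⟨ ≡.cong₂ (λ e x → C ^ k′ * (X ^ e * x)) (exponent k′ k″)
                                                                         (≡.sym (≡.trans (^-distribˡ-+-* t (k * k″) k) (≡.cong (_* t ^ k) (≡.sym (^-*-assoc t k k″))))) ⟨
          C ^ k′ * (X ^ (k′ * k′ * k″) * ((t ^ k) ^ k″ * t ^ k))    ≡⟨ lemma (C ^ k′) (X ^ (k′ * k′ * k″)) ((t ^ k) ^ k″) (t ^ k) ⟩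
          C ^ k′ * (X ^ (k′ * k′ * k″) * (t ^ k) ^ k″) * t ^ k      ∎)
          where
            lemma : ∀ a b c d → a * (b * (c * d)) ≡ a * (b * c) * d
            lemma = solve-∀

-- Least witnesses and minima.

module Search where
  open import Data.Nat
  open ℕₚ

  Least : (ℕ → Set) → ℕ → Set
  Least P m = 1 ≤ m × P m × (∀ x → 1 ≤ x → x < m → ¬ P x)

  search : ∀ {P : ℕ → Set} → Decidable P → ∀ n → ∃ (Least P) ⊎ (∀ x → 1 ≤ x → x ≤ n → ¬ P x)
  search P? zero = inj₂ λ { (suc x) _ () }
  search {P} P? (suc n) with search P? n
  ... | inj₁ found = inj₁ found
  ... | inj₂ none with P? (suc n)
  ...   | yes Pn = inj₁ (suc n , s≤s z≤n , Pn , λ { x 1≤x (s≤s x≤n) → none x 1≤x x≤n })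
  ...   | no ¬Pn = inj₂ none′
    where
      none′ : ∀ x → 1 ≤ x → x ≤ suc n → ¬ P x
      none′ x 1≤x x≤1+n with m≤n⇒m<n∨m≡n x≤1+n
      ... | inj₁ (s≤s x≤n) = none x 1≤x x≤n
      ... | inj₂ ≡.refl    = ¬Pn

  least : ∀ {P : ℕ → Set} → Decidable P → ∀ n → 1 ≤ n → P n → ∃ (Least P)
  least P? n 1≤n Pn with search P? n
  ... | inj₁ found = found
  ... | inj₂ none  = contradiction Pn (none n 1≤n ≤-refl)

  minimum : ∀ {n} (f : Fin (suc n) → ℕ) → ∃ λ i → ∀ j → f i ≤ f j
  minimum {zero}  f = zero , λ { zero → ≤-refl }
  minimum {suc n} f with minimum (f ∘ suc)
  ... | i , fi≤f with ≤-total (f zero) (f (suc i))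
  ...   | inj₁ f0≤fi = zero , λ { zero → ≤-refl ; (suc j) → ≤-trans f0≤fi (fi≤f j) }
  ...   | inj₂ fi≤f0 = suc i , λ { zero → fi≤f0 ; (suc j) → fi≤f j }

-- B + k^2 C of the double count, with B = k^k from the norm graph and C = 2 k from the conflicts.
kst-constant : ℕ → ℕ
kst-constant k = k ℕ.^ k ℕ.+ k ℕ.* k ℕ.* (k ℕ.* 2)

-- The summands are the constants of the two branches, all orders large and one eigenvalue
-- discarded; the sum serves both. The argument is one less than the number of eigenvalues.
constant₁ : ℕ → ℕ
constant₁ zero    = kst-constant 1 ℕ.^ 1
constant₁ (suc m) = kst-constant (2 ℕ.+ m) ℕ.^ (2 ℕ.+ m) ℕ.+ constant₁ m ℕ.^ (2 ℕ.+ m)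

-- As above, with the argument two less than the number of eigenvalues, since this recursion stops
-- at two.
constant₂ : ℕ → ℕ
constant₂ zero    = kst-constant 2 ℕ.^ 1
constant₂ (suc m) = kst-constant (3 ℕ.+ m) ℕ.^ (2 ℕ.+ m) ℕ.+ constant₂ m ℕ.^ (2 ℕ.+ m)

-- Discarding eigenvalues of small order.

module Reduction {q : ℕ} (K : FiniteField q) (Q : ℕ → ℕ → ℕ → ℕ → ℕ) (Q≤1 : ∀ a b c d → Q a b c d ℕ.≤ 1)
                 (τ t : ℕ) (1≤τ : 1 ℕ.≤ τ) (1≤t : 1 ℕ.≤ t) where
  open Powers K
  open EnergyBound K Q Q≤1 τ t 1≤τ 1≤t
  open Exponents
  open Search

  X : ℕ
  X = t ℕ.* τ ℕ.^ 3

  module _ {m l} {λJ : Fin (suc m) → Carrier} {λR : Fin l → Carrier} {M N} (S : Spectrum λJ λR M N) where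
    open Spectrum S

    order-of : ∀ j → ∃ (Least (λ x → λJ j ^ (x ℕ.* M) ≈ 1#))
    order-of j = least (λ x → λJ j ^ (x ℕ.* M) ≟ 1#) N (1≤N S) (trans (^-congʳ (λJ j) (≡.sym τ≡N*M)) (J^τ≈1 j))

    ord : Fin (suc m) → ℕ
    ord j = proj₁ (order-of j)

    1≤ord : ∀ j → 1 ℕ.≤ ord j
    1≤ord j = proj₁ (proj₂ (order-of j))

    ord-period : ∀ j → λJ j ^ (ord j ℕ.* M) ≈ 1#
    ord-period j = proj₁ (proj₂ (proj₂ (order-of j)))

    ord-∣ : ∀ j x → λJ j ^ (x ℕ.* M) ≈ 1# → ord j ∣ x
    ord-∣ j x λ^xM≈1 with x ℕ.% ord j in eq
      where instance _ = ℕ.>-nonZero (1≤ord j)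
    ... | zero  = ∣.m%n≡0⇒n∣m x (ord j) {{ℕ.>-nonZero (1≤ord j)}} eq
    ... | suc r = contradiction λ^rM≈1 (proj₂ (proj₂ (proj₂ (order-of j))) (suc r) (ℕ.s≤s ℕ.z≤n)
                    (≡.subst (ℕ._< ord j) eq (DivMod.m%n<n x (ord j))))
      where
        instance _ = ℕ.>-nonZero (1≤ord j)
        λ^rM≈1 : λJ j ^ (suc r ℕ.* M) ≈ 1#
        λ^rM≈1 = begin
          λJ j ^ (suc r ℕ.* M)
            ≈⟨ ^-period (λJ j) (ord j ℕ.* M) (x ℕ./ ord j) (suc r ℕ.* M) (ord-period j) ⟨
          λJ j ^ (x ℕ./ ord j ℕ.* (ord j ℕ.* M) ℕ.+ suc r ℕ.* M)
            ≈⟨ ^-congʳ (λJ j) (≡.trans (lemma (x ℕ./ ord j) (ord j) M (suc r)) (≡.cong (ℕ._* M)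
                 (≡.trans (≡.cong (ℕ._+ x ℕ./ ord j ℕ.* ord j) (≡.sym eq)) (≡.sym (DivMod.m≡m%n+[m/n]*n x (ord j)))))) ⟩
          λJ j ^ (x ℕ.* M)
            ≈⟨ λ^xM≈1 ⟩
          1# ∎
          where
            open ≈-Reasoning
            lemma : ∀ q m M r → q ℕ.* (m ℕ.* M) ℕ.+ r ℕ.* M ≡ (r ℕ.+ q ℕ.* m) ℕ.* M
            lemma = solve-∀

    energy-bound-ord : ∀ j → (∀ i → ord j ℕ.≤ ord i) → energy ℕ.^ suc m ℕ.* ord j ℕ.≤ kst-constant (suc m) ℕ.* X ℕ.^ suc m
    energy-bound-ord j minimal = energy-bound S (ord j) (1≤ord j) λ i x 1≤x x<ord →
      proj₂ (proj₂ (proj₂ (order-of i))) x 1≤x (ℕₚ.<-≤-trans x<ord (minimal i))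

    -- At the exponent x M the discarded eigenvalues are 1 as well, so τ = N M divides x M: N acts
    -- as the joint order of the λJ j ^ M.
    multiple-of-N : ∀ x → (∀ j → λJ j ^ (x ℕ.* M) ≈ 1#) → N ∣ x
    multiple-of-N x eq = ∣.*-cancelʳ-∣ M {{ℕ.>-nonZero (1≤M S)}} (≡.subst (_∣ x ℕ.* M) τ≡N*M
      (order (x ℕ.* M) eq (λ j → ^-1-multiple (λR j) M x (R^M≈1 j))))

    -- With o the order of λJ j ^ M, the modulus M grows to o M and N shrinks to N / o: an exponent
    -- that is a period of all discarded eigenvalues has the form y M, and o divides y.
    remove : ∀ j → ∃ λ N′ → N ≡ N′ ℕ.* ord j × Spectrum (removeAt λJ j) (λJ j Vector.∷ λR) (ord j ℕ.* M) N′
    remove j with ord-∣ j N (trans (^-congʳ (λJ j) (≡.sym τ≡N*M)) (J^τ≈1 j))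
    ... | divides N′ N≡N′m = N′ , N≡N′m , record
      { τ≡N*M   = ≡.trans τ≡N*M (≡.trans (≡.cong (ℕ._* M) N≡N′m) (ℕₚ.*-assoc N′ (ord j) M))
      ; solJ    = λ a b c d Q≢0 i → solJ a b c d Q≢0 (punchIn j i)
      ; solR    = λ { a b c d Q≢0 zero → solJ a b c d Q≢0 j ; a b c d Q≢0 (suc i) → solR a b c d Q≢0 i }
      ; J^τ≈1   = λ i → J^τ≈1 (punchIn j i)
      ; R^M≈1   = λ { zero → ord-period j ; (suc i) → ^-1-multiple (λR i) M (ord j) (R^M≈1 i) }
      ; orderR  = orderR′
      ; order   = λ x eqJ eqR → order x (all-J x eqJ (eqR zero)) (eqR ∘ suc)
      ; det^t≈1 = trans (^-congˡ t (trans (sym (*-assoc _ _ _)) (*-congʳ (trans (*-comm _ _) (sym (prod-remove {i = j} λJ)))))) det^t≈1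
      }
      where
        orderR′ : ∀ x → (∀ i → (λJ j Vector.∷ λR) i ^ x ≈ 1#) → ord j ℕ.* M ∣ x
        orderR′ x eq with orderR x (eq ∘ suc)
        ... | divides y ≡.refl = ∣.*-monoˡ-∣ M (ord-∣ j y (eq zero))
        all-J : ∀ x → (∀ i → λJ (punchIn j i) ^ x ≈ 1#) → λJ j ^ x ≈ 1# → ∀ i → λJ i ^ x ≈ 1#
        all-J x eq eqj i with j Fin.≟ i
        ... | yes ≡.refl = eqj
        ... | no j≢i = ≡.subst (λ i → λJ i ^ x ≈ 1#) (Finₚ.punchIn-punchOut j≢i) (eq (Fin.punchOut j≢i))

  open ℕₚ.≤-Reasoning

  bound₁ : ∀ m {l} {λJ : Fin (suc m) → Carrier} {λR : Fin l → Carrier} {M N} → Spectrum λJ λR M N →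
    energy ℕ.^ (suc m ℕ.* suc m) ℕ.* N ℕ.≤ constant₁ m ℕ.* X ℕ.^ (suc m ℕ.* suc m)
  bound₁ m {N = N} S with Finₚ.all? (λ j → N ℕ.≤? ord S j ℕ.^ suc m)
  bound₁ m {N = N} S | yes N≤ord^k with minimum (ord S)
  ... | j , minimal = begin
    energy ℕ.^ (k ℕ.* k) ℕ.* N  ≤⟨ large-orders₁ energy X (kst-constant k) N (ord S j) k (N≤ord^k j) (energy-bound-ord S j minimal) ⟩
    kst-constant k ℕ.^ k ℕ.* X ℕ.^ (k ℕ.* k)       ≤⟨ ℕₚ.*-monoˡ-≤ (X ℕ.^ (k ℕ.* k)) (constant m) ⟩
    constant₁ m ℕ.* X ℕ.^ (k ℕ.* k)                ∎
    where
      k : ℕ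
      k = suc m
      constant : ∀ m → kst-constant (suc m) ℕ.^ suc m ℕ.≤ constant₁ m
      constant zero    = ℕₚ.≤-refl
      constant (suc m) = ℕₚ.m≤m+n _ _
  -- A single eigenvalue in play carries the whole joint order, so its order is at least N and the
  -- branch is void.
  bound₁ zero {N = N} S | no small = contradiction N≤ord small
    where
      N≤ord : ∀ j → N ℕ.≤ ord S j ℕ.^ 1
      N≤ord zero = ℕₚ.≤-trans
        (∣.∣⇒≤ {{ℕ.>-nonZero (1≤ord S zero)}} (multiple-of-N S (ord S zero) λ { zero → ord-period S zero }))
        (ℕₚ.≤-reflexive (≡.sym (ℕₚ.*-identityʳ (ord S zero))))
  bound₁ (suc m) {N = N} S | no small
    with Finₚ.¬∀⟶∃¬ (suc (suc m)) _ (λ j → N ℕ.≤? ord S j ℕ.^ suc (suc m)) small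
  ... | j , N≰ord^k with remove S j
  ...   | N′ , N≡N′ord , S′ = begin
    energy ℕ.^ (k ℕ.* k) ℕ.* N  ≤⟨ small-order₁ energy X (constant₁ m) N N′ (ord S j) m (energy-trivial S) (1≤N S) N≡N′ord
                                                     (ℕₚ.<⇒≤ (ℕₚ.≰⇒> N≰ord^k)) (bound₁ m S′) ⟩
    constant₁ m ℕ.^ k ℕ.* X ℕ.^ (k ℕ.* k)       ≤⟨ ℕₚ.*-monoˡ-≤ (X ℕ.^ (k ℕ.* k)) (ℕₚ.m≤n+m _ (kst-constant k ℕ.^ k)) ⟩
    constant₁ (suc m) ℕ.* X ℕ.^ (k ℕ.* k)       ∎
    where
      k : ℕ
      k = suc (suc m)

  -- At the exponent ord * t * M the chosen eigenvalue, all discarded ones and the determinant are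
  -- 1. The other eigenvalue is then 1 too, so N divides ord * t.
  N≤ord*t : ∀ {l} {λJ : Fin 2 → Carrier} {λR : Fin l → Carrier} {M N} (S : Spectrum λJ λR M N) → ∀ j → N ℕ.≤ ord S j ℕ.* t
  N≤ord*t {λJ = λJ} {λR} {M} S j = ∣.∣⇒≤ {{ℕₚ.m*n≢0 (ord S j) t {{ℕ.>-nonZero (1≤ord S j)}} {{ℕ.>-nonZero 1≤t}}}}
    (multiple-of-N S (ord S j ℕ.* t) both)
    where
      open Spectrum S
      y : ℕ
      y = ord S j ℕ.* t ℕ.* M
      λj^y≈1 : λJ j ^ y ≈ 1#
      λj^y≈1 = trans (^-congʳ (λJ j) (lemma (ord S j) t M)) (^-1-multiple (λJ j) (ord S j ℕ.* M) t (ord-period S j))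
        where
          lemma : ∀ o t M → o ℕ.* t ℕ.* M ≡ t ℕ.* (o ℕ.* M)
          lemma = solve-∀
      other : λJ (punchIn j zero) ^ y ≈ 1#
      other = R.begin
        λJ (punchIn j zero) ^ y
          R.≈⟨ *-identityˡ _ ⟨
        1# * λJ (punchIn j zero) ^ y
          R.≈⟨ *-cong λj^y≈1 (*-identityʳ _) ⟨
        λJ j ^ y * (λJ (punchIn j zero) ^ y * 1#)
          R.≈⟨ prod-remove {i = j} (λ i → λJ i ^ y) ⟨
        prod (λ i → λJ i ^ y)
          R.≈⟨ prod-^ λJ y ⟩
        prod λJ ^ y
          R.≈⟨ *-identityʳ _ ⟨
        prod λJ ^ y * 1#
          R.≈⟨ *-congˡ (trans (sym (prod-^ λR y)) (prod-one λ i → ^-1-multiple (λR i) M (ord S j ℕ.* t) (R^M≈1 i))) ⟨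
        prod λJ ^ y * prod λR ^ y
          R.≈⟨ ^-distrib-* (prod λJ) (prod λR) y ⟨
        (prod λJ * prod λR) ^ y
          R.≈⟨ ^-congʳ _ (lemma (ord S j) t M) ⟩
        (prod λJ * prod λR) ^ (ord S j ℕ.* M ℕ.* t)
          R.≈⟨ ^-1-multiple _ t (ord S j ℕ.* M) det^t≈1 ⟩
        1# R.∎
        where
          module R = ≈-Reasoning
          lemma : ∀ o t M → o ℕ.* t ℕ.* M ≡ o ℕ.* M ℕ.* t
          lemma = solve-∀
          prod-one : ∀ {n} {f : Fin n → Carrier} → (∀ i → f i ≈ 1#) → prod f ≈ 1#
          prod-one {zero}  f≈1 = refl
          prod-one {suc n} f≈1 = trans (*-cong (f≈1 zero) (prod-one (f≈1 ∘ suc))) (*-identityˡ 1#)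
      both : ∀ i → λJ i ^ y ≈ 1#
      both i with j Fin.≟ i
      ... | yes ≡.refl = λj^y≈1
      ... | no j≢i = ≡.subst (λ i → λJ i ^ y ≈ 1#) (Finₚ.punchIn-punchOut j≢i) (at (Fin.punchOut j≢i))
        where
          at : ∀ h → λJ (punchIn j h) ^ y ≈ 1#
          at zero = other

  bound₂ : ∀ m {l} {λJ : Fin (suc (suc m)) → Carrier} {λR : Fin l → Carrier} {M N} → Spectrum λJ λR M N →
    energy ℕ.^ (suc (suc m) ℕ.* suc m) ℕ.* N ℕ.≤ constant₂ m ℕ.* (X ℕ.^ (suc (suc m) ℕ.* suc m) ℕ.* t ℕ.^ suc (suc m))
  bound₂ m {N = N} S with Finₚ.all? (λ j → N ℕ.≤? ord S j ℕ.^ suc m ℕ.* t ℕ.^ suc (suc m))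
  bound₂ m {N = N} S | yes N≤ with minimum (ord S)
  ... | j , minimal = begin
    energy ℕ.^ (k ℕ.* k′) ℕ.* N  ≤⟨ large-orders₂ energy X (kst-constant k) N (ord S j) (t ℕ.^ k) k k′ (N≤ j) (energy-bound-ord S j minimal) ⟩
    kst-constant k ℕ.^ k′ ℕ.* (X ℕ.^ (k ℕ.* k′) ℕ.* t ℕ.^ k)       ≤⟨ ℕₚ.*-monoˡ-≤ (X ℕ.^ (k ℕ.* k′) ℕ.* t ℕ.^ k) (constant m) ⟩
    constant₂ m ℕ.* (X ℕ.^ (k ℕ.* k′) ℕ.* t ℕ.^ k)                 ∎
    where
      k k′ : ℕ
      k = suc (suc m)
      k′ = suc m
      constant : ∀ m → kst-constant (suc (suc m)) ℕ.^ suc m ℕ.≤ constant₂ m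
      constant zero    = ℕₚ.≤-refl
      constant (suc m) = ℕₚ.m≤m+n _ _
  -- With two eigenvalues the threshold is ord * t ^ 2, which `N≤ord*t` always reaches.
  bound₂ zero {N = N} S | no small = contradiction
    (λ j → ℕₚ.≤-trans (N≤ord*t S j) (ℕₚ.*-mono-≤ (ℕₚ.≤-reflexive (≡.sym (ℕₚ.*-identityʳ (ord S j)))) (m≤m^n t 2))) small
  bound₂ (suc m) {N = N} S | no small
    with Finₚ.¬∀⟶∃¬ (suc (suc (suc m))) _ (λ j → N ℕ.≤? ord S j ℕ.^ suc (suc m) ℕ.* t ℕ.^ suc (suc (suc m))) small
  ... | j , N≰ with remove S j
  ...   | N′ , N≡N′ord , S′ = begin
    energy ℕ.^ (k ℕ.* k′) ℕ.* N  ≤⟨ small-order₂ energy X (constant₂ m) N N′ (ord S j) t m (energy-trivial S) 1≤t (1≤ord S j) N≡N′ord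
                                                                   (ℕₚ.<⇒≤ (ℕₚ.≰⇒> N≰)) (bound₂ m S′) ⟩
    constant₂ m ℕ.^ k′ ℕ.* (X ℕ.^ (k ℕ.* k′) ℕ.* t ℕ.^ k)     ≤⟨ ℕₚ.*-monoˡ-≤ (X ℕ.^ (k ℕ.* k′) ℕ.* t ℕ.^ k) (ℕₚ.m≤n+m _ (kst-constant k ℕ.^ k′)) ⟩
    constant₂ (suc m) ℕ.* (X ℕ.^ (k ℕ.* k′) ℕ.* t ℕ.^ k)      ∎
    where
      k k′ : ℕ
      k = suc (suc (suc m))
      k′ = suc (suc m)

-- The determinant is multilinear and alternating.

module Determinant (R : CommutativeRing 0ℓ 0ℓ) where
  open CommutativeRing R hiding (zero)
  open RawMat rawRing using (sumF; sign; det; _·_; I; diag; _≈M_)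
  open Algebra.Properties.Ring (CommutativeRing.ring R)
  open Relation.Binary.Reasoning.Setoid setoid
  open Algebra.Solver.Ring.NaturalCoefficients.Default commutativeSemiring using (solve; _:+_; _:*_; _:=_)

  sumF-cong : ∀ {n} {f g : Fin n → Carrier} → (∀ i → f i ≈ g i) → sumF f ≈ sumF g
  sumF-cong {zero}  f≈g = refl
  sumF-cong {suc n} f≈g = +-cong (f≈g zero) (sumF-cong (f≈g ∘ suc))

  sumF-zero : ∀ {n} {f : Fin n → Carrier} → (∀ i → f i ≈ 0#) → sumF f ≈ 0#
  sumF-zero {zero}  f≈0 = refl
  sumF-zero {suc n} f≈0 = trans (+-cong (f≈0 zero) (sumF-zero (f≈0 ∘ suc))) (+-identityˡ 0#)

  sumF-+ : ∀ {n} (f g : Fin n → Carrier) → sumF (λ i → f i + g i) ≈ sumF f + sumF g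
  sumF-+ {zero}  f g = sym (+-identityˡ 0#)
  sumF-+ {suc n} f g = trans (+-congˡ (sumF-+ (f ∘ suc) (g ∘ suc)))
    (solve 4 (λ a b c d → a :+ b :+ (c :+ d) := a :+ c :+ (b :+ d)) refl (f zero) (g zero) (sumF (f ∘ suc)) (sumF (g ∘ suc)))

  sumF-*ˡ : ∀ {n} c (f : Fin n → Carrier) → sumF (λ i → c * f i) ≈ c * sumF f
  sumF-*ˡ {zero}  c f = sym (zeroʳ c)
  sumF-*ˡ {suc n} c f = trans (+-congˡ (sumF-*ˡ c (f ∘ suc))) (sym (distribˡ c _ _))

  sumF-*ʳ : ∀ {n} c (f : Fin n → Carrier) → sumF (λ i → f i * c) ≈ sumF f * c
  sumF-*ʳ c f = trans (sumF-cong λ i → *-comm (f i) c) (trans (sumF-*ˡ c f) (*-comm c _))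

  sumF-linear : ∀ {n} a (f : Fin n → Carrier) b g → sumF (λ i → a * f i + b * g i) ≈ a * sumF f + b * sumF g
  sumF-linear a f b g = trans (sumF-+ (λ i → a * f i) (λ i → b * g i)) (+-cong (sumF-*ˡ a f) (sumF-*ˡ b g))

  sumF-comm : ∀ {m n} (f : Fin m → Fin n → Carrier) → sumF (λ i → sumF (f i)) ≈ sumF (λ j → sumF (λ i → f i j))
  sumF-comm {zero}  {n} f = sym (sumF-zero {n} λ j → refl)
  sumF-comm {suc m} f = trans (+-congˡ (sumF-comm (f ∘ suc))) (sym (sumF-+ (f zero) (λ j → sumF (λ i → f (suc i) j))))

  sumF-single : ∀ {n} (f : Fin n → Carrier) i → (∀ j → i ≢ j → f j ≈ 0#) → sumF f ≈ f i
  sumF-single {suc n} f zero    f≈0 = trans (+-congˡ (sumF-zero λ j → f≈0 (suc j) λ ())) (+-identityʳ _)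
  sumF-single {suc n} f (suc i) f≈0 = trans
    (+-cong (f≈0 zero λ ()) (sumF-single (f ∘ suc) i λ j i≢j → f≈0 (suc j) (i≢j ∘ Finₚ.suc-injective))) (+-identityˡ _)

  sign-cong : ∀ k {x y} → x ≈ y → sign k x ≈ sign k y
  sign-cong zero          x≈y = x≈y
  sign-cong (suc zero)    x≈y = -‿cong x≈y
  sign-cong (suc (suc k)) x≈y = sign-cong k x≈y

  sign-suc : ∀ k x → sign (suc k) x ≈ - sign k x
  sign-suc zero          x = refl
  sign-suc (suc zero)    x = sym (-‿involutive x)
  sign-suc (suc (suc k)) x = sign-suc k x

  sign-* : ∀ k c x → sign k (c * x) ≈ c * sign k x
  sign-* zero          c x = refl
  sign-* (suc zero)    c x = -‿distribʳ-* c x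
  sign-* (suc (suc k)) c x = sign-* k c x

  sign-+ : ∀ k x y → sign k (x + y) ≈ sign k x + sign k y
  sign-+ zero          x y = refl
  sign-+ (suc zero)    x y = sym (-‿+-comm x y)
  sign-+ (suc (suc k)) x y = sign-+ k x y

  sign-zero : ∀ k {x} → x ≈ 0# → sign k x ≈ 0#
  sign-zero zero          x≈0 = x≈0
  sign-zero (suc zero)    x≈0 = trans (-‿cong x≈0) -0#≈0#
  sign-zero (suc (suc k)) x≈0 = sign-zero k x≈0

  sign-neg : ∀ k x → sign k (- x) ≈ - sign k x
  sign-neg zero          x = refl
  sign-neg (suc zero)    x = refl
  sign-neg (suc (suc k)) x = sign-neg k x

  sign-suc-suc : ∀ a b x → sign (suc a) (sign (suc b) x) ≈ sign a (sign b x)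
  sign-suc-suc a b x = begin
    sign (suc a) (sign (suc b) x)  ≈⟨ sign-suc a _ ⟩
    - sign a (sign (suc b) x)      ≈⟨ -‿cong (sign-cong a (sign-suc b x)) ⟩
    - sign a (- sign b x)  ≈⟨ -‿cong (sign-neg a _) ⟩
    - - sign a (sign b x)  ≈⟨ -‿involutive _ ⟩
    sign a (sign b x)              ∎

  Row : ℕ → Set
  Row n = Fin n → Carrier

  set : ∀ {m} {A : Set} → (Fin m → A) → Fin m → A → Fin m → A
  set M i r = updateAt M i (const r)

  set-map : ∀ {m} {A B : Set} (h : A → B) (M : Fin m → A) i r k → h (set M i r k) ≡ set (h ∘ M) i (h r) k
  set-map {suc m} h M zero    r zero    = ≡.refl
  set-map {suc m} h M zero    r (suc k) = ≡.refl
  set-map {suc m} h M (suc i) r zero    = ≡.refl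
  set-map {suc m} h M (suc i) r (suc k) = set-map h (M ∘ suc) i r k

  set-cong : ∀ {m n} {M N : Fin m → Row n} i {r s} → (∀ k j → M k j ≈ N k j) → (∀ j → r j ≈ s j) →
    ∀ k j → set M i r k j ≈ set N i s k j
  set-cong {suc m} zero    M≈N r≈s zero    = r≈s
  set-cong {suc m} zero    M≈N r≈s (suc k) = M≈N (suc k)
  set-cong {suc m} (suc i) M≈N r≈s zero    = M≈N zero
  set-cong {suc m} (suc i) M≈N r≈s (suc k) = set-cong i (M≈N ∘ suc) r≈s k

  Linear : ∀ {m n} → ((Fin m → Row n) → Carrier) → Set
  Linear {m} f = ∀ M (i : Fin m) a r b s →
    f (set M i (λ k → a * r k + b * s k)) ≈ a * f (set M i r) + b * f (set M i s)

  Congruent : ∀ {m n} → ((Fin m → Row n) → Carrier) → Set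
  Congruent f = ∀ {M N} → (∀ i j → M i j ≈ N i j) → f M ≈ f N

  AlternatingAt : ∀ {m n} → ((Fin m → Row n) → Carrier) → Fin m → Fin m → Set
  AlternatingAt f i j = ∀ M → (∀ k → M i k ≈ M j k) → f M ≈ 0#

  record AlternatingMultilinear {m n} (f : (Fin m → Row n) → Carrier) : Set where
    field
      congruent   : Congruent f
      linear      : Linear f
      alternating : ∀ i j → i ≢ j → AlternatingAt f i j

  -- Alternation is asked at the pair (i, j) alone, so that row operations are available while full
  -- alternation of `det` is still being proved.
  add-multiple : ∀ {m n} {f : (Fin m → Row n) → Carrier} → Congruent f → Linear f → ∀ i j → i ≢ j → AlternatingAt f i j →
    ∀ M b → f (set M i (λ k → 1# * M i k + b * M j k)) ≈ f M
  add-multiple {f = f} congruent linear i j i≢j alt M b = begin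
    f (set M i (λ k → 1# * M i k + b * M j k))  ≈⟨ linear M i 1# (M i) b (M j) ⟩
    1# * f (set M i (M i)) + b * f (set M i (M j))     ≈⟨ +-cong
      (trans (*-identityˡ _) (congruent λ i′ k → reflexive (≡.cong (λ r → r k) (Vectorₚ.updateAt-id-local i M ≡.refl i′))))
      (trans (*-congˡ (alt (set M i (M j)) λ k → reflexive (≡.trans (≡.cong (λ r → r k) (Vectorₚ.updateAt-updates i M))
        (≡.cong (λ r → r k) (≡.sym (Vectorₚ.updateAt-minimal j i M (i≢j ∘ ≡.sym))))))) (zeroʳ b)) ⟩
    f M + 0#  ≈⟨ +-identityʳ _ ⟩
    f M                                                ∎

  minor : ∀ {m n} → (Fin (suc m) → Row (suc n)) → Fin (suc n) → Fin m → Row n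
  minor M j i k = M (suc i) (punchIn j k)

  det-congruent : ∀ {n} → Congruent (det {n})
  det-congruent {zero}  M≈N = refl
  det-congruent {suc n} M≈N = sumF-cong λ j → sign-cong (toℕ j)
    (*-cong (M≈N zero j) (det-congruent λ i k → M≈N (suc i) (punchIn j k)))

  det-linear : ∀ {n} → Linear (det {n})
  det-linear {suc n} M zero a r b s = trans
    (sumF-cong λ j → begin
      sign (toℕ j) ((a * r j + b * s j) * D j)
        ≈⟨ sign-cong (toℕ j) (solve 5 (λ a r b s d → (a :* r :+ b :* s) :* d := a :* (r :* d) :+ b :* (s :* d)) refl a (r j) b (s j) (D j)) ⟩
      sign (toℕ j) (a * (r j * D j) + b * (s j * D j))
        ≈⟨ sign-+ (toℕ j) _ _ ⟩
      sign (toℕ j) (a * (r j * D j)) + sign (toℕ j) (b * (s j * D j))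
        ≈⟨ +-cong (sign-* (toℕ j) a _) (sign-* (toℕ j) b _) ⟩
      a * sign (toℕ j) (r j * D j) + b * sign (toℕ j) (s j * D j) ∎)
    (sumF-linear a (λ j → sign (toℕ j) (r j * D j)) b (λ j → sign (toℕ j) (s j * D j)))
    where
      D : Fin (suc n) → Carrier
      D j = det (minor M j)
  det-linear {suc n} M (suc i) a r b s = trans
    (sumF-cong λ j → begin
      sign (toℕ j) (M zero j * det (minor (set M (suc i) (λ k → a * r k + b * s k)) j))
        ≈⟨ sign-cong (toℕ j) (*-congˡ (begin
             det (minor (set M (suc i) (λ k → a * r k + b * s k)) j)
               ≈⟨ det-congruent (minor-set j (λ k → a * r k + b * s k)) ⟩
             det (set (minor M j) i (λ k → a * r (punchIn j k) + b * s (punchIn j k)))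
               ≈⟨ det-linear (minor M j) i a (r ∘ punchIn j) b (s ∘ punchIn j) ⟩
             a * det (set (minor M j) i (r ∘ punchIn j)) + b * det (set (minor M j) i (s ∘ punchIn j))
               ≈⟨ +-cong (*-congˡ (det-congruent (minor-set j r))) (*-congˡ (det-congruent (minor-set j s))) ⟨
             a * D r j + b * D s j ∎)) ⟩
      sign (toℕ j) (M zero j * (a * D r j + b * D s j))
        ≈⟨ sign-cong (toℕ j) (solve 5 (λ a x b d e → x :* (a :* d :+ b :* e) := a :* (x :* d) :+ b :* (x :* e)) refl a (M zero j) b (D r j) (D s j)) ⟩
      sign (toℕ j) (a * (M zero j * D r j) + b * (M zero j * D s j))
        ≈⟨ sign-+ (toℕ j) _ _ ⟩
      sign (toℕ j) (a * (M zero j * D r j)) + sign (toℕ j) (b * (M zero j * D s j))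
        ≈⟨ +-cong (sign-* (toℕ j) a _) (sign-* (toℕ j) b _) ⟩
      a * sign (toℕ j) (M zero j * D r j) + b * sign (toℕ j) (M zero j * D s j) ∎)
    (sumF-linear a (λ j → sign (toℕ j) (M zero j * D r j)) b (λ j → sign (toℕ j) (M zero j * D s j)))
    where
      D : Row (suc n) → Fin (suc n) → Carrier
      D r j = det (minor (set M (suc i) r) j)
      minor-set : ∀ j r i′ k → minor (set M (suc i) r) j i′ k ≈ set (minor M j) i (r ∘ punchIn j) i′ k
      minor-set j r i′ k = reflexive (≡.cong (λ x → x k) (set-map (_∘ punchIn j) (M ∘ suc) i r i′))

  -- `T j k` is the entry at the ordered pair of distinct columns (j, punchIn j k). Peeling off
  -- column 0 matches the pair (0, k + 1), stored at `T zero k`, with its reversal, stored at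
  -- `T (suc k) zero`.
  Antisymmetric : ∀ n → (Fin (suc n) → Fin n → Carrier) → Set
  Antisymmetric zero    T = ⊤
  Antisymmetric (suc n) T = (∀ k → T zero k + T (suc k) zero ≈ 0#) × Antisymmetric n (λ j k → T (suc j) (suc k))

  sumF-antisymmetric : ∀ n T → Antisymmetric n T → sumF (λ j → sumF (T j)) ≈ 0#
  sumF-antisymmetric zero    T _ = +-identityˡ 0#
  sumF-antisymmetric (suc n) T (first , rest) = begin
    sumF (T zero) + sumF (λ j → T (suc j) zero + sumF (λ k → T (suc j) (suc k)))
      ≈⟨ +-congˡ (sumF-+ (λ j → T (suc j) zero) (λ j → sumF (λ k → T (suc j) (suc k)))) ⟩
    sumF (T zero) + (sumF (λ j → T (suc j) zero) + sumF (λ j → sumF (λ k → T (suc j) (suc k))))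
      ≈⟨ +-assoc _ _ _ ⟨
    sumF (T zero) + sumF (λ j → T (suc j) zero) + sumF (λ j → sumF (λ k → T (suc j) (suc k)))
      ≈⟨ +-cong (trans (sym (sumF-+ (T zero) (λ j → T (suc j) zero))) (sumF-zero first)) (sumF-antisymmetric n _ rest) ⟩
    0# + 0#
      ≈⟨ +-identityˡ 0# ⟩
    0# ∎

  -- The terms of a Laplace expansion along two rows. Exchanging the two chosen columns keeps the
  -- complementary minor `H` and the symmetric product `W`, but shifts one of the positions by one,
  -- which flips the sign. `H` takes the embedding of the remaining columns, so that the recursion
  -- can prepend column 0 to it by `lift`.
  laplace-antisymmetric : ∀ p (W : Fin (2 ℕ.+ p) → Fin (2 ℕ.+ p) → Carrier) → (∀ j k → W j k ≈ W k j) →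
    (H : (Fin p → Fin (2 ℕ.+ p)) → Carrier) → (∀ {φ ψ} → (∀ c → φ c ≡ ψ c) → H φ ≈ H ψ) →
    Antisymmetric (suc p) (λ j k → sign (toℕ j) (sign (toℕ k) (W j (punchIn j k) * H (punchIn j ∘ punchIn k))))
  laplace-antisymmetric p W W-sym H H-cong = first , rest p W W-sym H H-cong
    where
      first : ∀ k → sign (toℕ k) (W zero (suc k) * H (suc ∘ punchIn k)) +
                    sign (suc (toℕ k)) (W (suc k) zero * H (punchIn (suc k) ∘ suc)) ≈ 0#
      first k = trans (+-congˡ (trans (sign-suc (toℕ k) _)
        (-‿cong (sign-cong (toℕ k) (*-cong (W-sym (suc k) zero) (H-cong λ c → ≡.refl)))))) (-‿inverseʳ _)
      rest : ∀ p (W : Fin (2 ℕ.+ p) → Fin (2 ℕ.+ p) → Carrier) → (∀ j k → W j k ≈ W k j) →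
        (H : (Fin p → Fin (2 ℕ.+ p)) → Carrier) → (∀ {φ ψ} → (∀ c → φ c ≡ ψ c) → H φ ≈ H ψ) →
        Antisymmetric p (λ j k → sign (suc (toℕ j)) (sign (suc (toℕ k))
          (W (suc j) (suc (punchIn j k)) * H (punchIn (suc j) ∘ punchIn (suc k)))))
      rest zero    W W-sym H H-cong = tt
      rest (suc p) W W-sym H H-cong = respects (suc p) (λ j k → begin
          sign (toℕ j) (sign (toℕ k) (W (suc j) (suc (punchIn j k)) * H (lift (punchIn j ∘ punchIn k))))
            ≈⟨ sign-cong (toℕ j) (sign-cong (toℕ k) (*-congˡ (H-cong (lift-punchIn j k)))) ⟩
          sign (toℕ j) (sign (toℕ k) (V j k))
            ≈⟨ sign-suc-suc (toℕ j) (toℕ k) (V j k) ⟨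
          sign (suc (toℕ j)) (sign (suc (toℕ k)) (V j k)) ∎)
        (laplace-antisymmetric p (λ j k → W (suc j) (suc k)) (λ j k → W-sym (suc j) (suc k)) (H ∘ lift) (λ φ≗ψ → H-cong (lift-cong φ≗ψ)))
        where
          V : Fin (2 ℕ.+ p) → Fin (suc p) → Carrier
          V j k = W (suc j) (suc (punchIn j k)) * H (punchIn (suc j) ∘ punchIn (suc k))
          lift : (Fin p → Fin (2 ℕ.+ p)) → Fin (suc p) → Fin (3 ℕ.+ p)
          lift φ zero    = zero
          lift φ (suc c) = suc (φ c)
          lift-cong : ∀ {φ ψ} → (∀ c → φ c ≡ ψ c) → ∀ c → lift φ c ≡ lift ψ c
          lift-cong φ≗ψ zero    = ≡.refl
          lift-cong φ≗ψ (suc c) = ≡.cong suc (φ≗ψ c)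
          lift-punchIn : ∀ j k c → lift (punchIn j ∘ punchIn k) c ≡ punchIn (suc j) (punchIn (suc k) c)
          lift-punchIn j k zero    = ≡.refl
          lift-punchIn j k (suc c) = ≡.refl
          respects : ∀ n {S T : Fin (suc n) → Fin n → Carrier} → (∀ j k → S j k ≈ T j k) → Antisymmetric n S → Antisymmetric n T
          respects zero    S≈T _ = tt
          respects (suc n) S≈T (first , rest) =
            (λ k → trans (+-cong (sym (S≈T zero k)) (sym (S≈T (suc k) zero))) (first k)) , respects n (λ j k → S≈T (suc j) (suc k)) rest

  sign-sumF : ∀ k {n} (f : Fin n → Carrier) → sign k (sumF f) ≈ sumF (λ i → sign k (f i))
  sign-sumF k {zero}  f = sign-zero k refl
  sign-sumF k {suc n} f = trans (sign-+ k _ _) (+-congˡ (sign-sumF k (f ∘ suc)))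

  det-alternating₀₁ : ∀ {n} → AlternatingAt (det {suc (suc n)}) zero (suc zero)
  det-alternating₀₁ {n} M M₀≈M₁ = begin
    sumF (λ j → sign (toℕ j) (M zero j * sumF (λ k → sign (toℕ k) (M (suc zero) (punchIn j k) * D j k))))
      ≈⟨ sumF-cong (λ j → begin
           sign (toℕ j) (M zero j * sumF (λ k → sign (toℕ k) (M (suc zero) (punchIn j k) * D j k)))
             ≈⟨ sign-cong (toℕ j) (sumF-*ˡ (M zero j) (λ k → sign (toℕ k) (M (suc zero) (punchIn j k) * D j k))) ⟨
           sign (toℕ j) (sumF (λ k → M zero j * sign (toℕ k) (M (suc zero) (punchIn j k) * D j k)))
             ≈⟨ sign-sumF (toℕ j) (λ k → M zero j * sign (toℕ k) (M (suc zero) (punchIn j k) * D j k)) ⟩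
           sumF (λ k → sign (toℕ j) (M zero j * sign (toℕ k) (M (suc zero) (punchIn j k) * D j k)))
             ≈⟨ sumF-cong (λ k → sign-cong (toℕ j) (begin
                  M zero j * sign (toℕ k) (M (suc zero) (punchIn j k) * D j k)  ≈⟨ sign-* (toℕ k) (M zero j) _ ⟨
                  sign (toℕ k) (M zero j * (M (suc zero) (punchIn j k) * D j k)) ≈⟨ sign-cong (toℕ k) (*-assoc _ _ _) ⟨
                  sign (toℕ k) (M zero j * M (suc zero) (punchIn j k) * D j k)   ≈⟨ sign-cong (toℕ k) (*-congʳ (*-congˡ (sym (M₀≈M₁ (punchIn j k))))) ⟩
                  sign (toℕ k) (W j (punchIn j k) * D j k)                       ∎)) ⟩
           sumF (λ k → sign (toℕ j) (sign (toℕ k) (W j (punchIn j k) * D j k))) ∎) ⟩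
    sumF (λ j → sumF (λ k → sign (toℕ j) (sign (toℕ k) (W j (punchIn j k) * D j k))))
      ≈⟨ sumF-antisymmetric (suc n) (λ j k → sign (toℕ j) (sign (toℕ k) (W j (punchIn j k) * D j k)))
           (laplace-antisymmetric n W (λ j k → *-comm _ _) (λ φ → det (λ i c → M (suc (suc i)) (φ c)))
             (λ φ≗ψ → det-congruent λ i c → reflexive (≡.cong (M (suc (suc i))) (φ≗ψ c)))) ⟩
    0# ∎
    where
      W : Fin (suc (suc n)) → Fin (suc (suc n)) → Carrier
      W j k = M zero j * M zero k
      D : Fin (suc (suc n)) → Fin (suc n) → Carrier
      D j k = det (λ i c → M (suc (suc i)) (punchIn j (punchIn k c)))

  module _ {n} (minors-alternate : ∀ i j → i ≢ j → AlternatingAt (det {n}) i j) where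

    alternating-below : ∀ i j → i ≢ j → AlternatingAt (det {suc n}) (suc i) (suc j)
    alternating-below i j i≢j M Mᵢ≈Mⱼ = sumF-zero λ k → sign-zero (toℕ k) (trans
      (*-congˡ {M zero k} (minors-alternate i j i≢j (minor M k) (Mᵢ≈Mⱼ ∘ punchIn k))) (zeroʳ _))

  -- Rows 0 and i ≥ 2 are reduced to rows 0 and 1 by exchanging rows 1 and i up to sign,
  -- with three row operations that do not involve row 0.
  alternating-top : ∀ {n} → (∀ i j → i ≢ j → AlternatingAt (det {n}) i j) → ∀ i → AlternatingAt (det {suc n}) zero (suc i)
  alternating-top {suc n} minors-alternate zero    M M₀≈Mᵢ = det-alternating₀₁ M M₀≈Mᵢ
  alternating-top {suc n} minors-alternate (suc i) M M₀≈Mᵢ = begin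
    det M   ≈⟨ operation (suc zero) (suc (suc i)) (λ ()) (alternating-below minors-alternate zero (suc i) (λ ())) M 1# ⟨
    det M₁  ≈⟨ operation (suc (suc i)) (suc zero) (λ ()) (alternating-below minors-alternate (suc i) zero (λ ())) M₁ (- 1#) ⟨
    det M₂  ≈⟨ operation (suc zero) (suc (suc i)) (λ ()) (alternating-below minors-alternate zero (suc i) (λ ())) M₂ 1# ⟨
    det M₃  ≈⟨ det-alternating₀₁ M₃ rows ⟩
    0#      ∎
    where
      operation : ∀ i j → i ≢ j → AlternatingAt (det {suc (suc n)}) i j → ∀ M b → det (set M i (λ k → 1# * M i k + b * M j k)) ≈ det M
      operation = add-multiple det-congruent det-linear
      M₁ M₂ M₃ : Fin (suc (suc n)) → Row (suc (suc n))
      M₁ = set M (suc zero) (λ k → 1# * M (suc zero) k + 1# * M (suc (suc i)) k)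
      M₂ = set M₁ (suc (suc i)) (λ k → 1# * M₁ (suc (suc i)) k + - 1# * M₁ (suc zero) k)
      M₃ = set M₂ (suc zero) (λ k → 1# * M₂ (suc zero) k + 1# * M₂ (suc (suc i)) k)
      rows : ∀ k → M zero k ≈ 1# * M₂ (suc zero) k + 1# * M₂ (suc (suc i)) k
      rows k = begin
        M zero k  ≈⟨ M₀≈Mᵢ k ⟩
        x  ≈⟨ +-identityˡ x ⟨
        0# + x  ≈⟨ +-congʳ (-‿inverseʳ y) ⟨
        y - y + x  ≈⟨ solve 3 (λ y n x → y :+ n :+ x := y :+ (x :+ n)) refl y (- y) x ⟩
        y + (x - y)  ≈⟨ +-cong (*-identityˡ y) (+-cong (*-identityˡ x) (-1*x≈-x y)) ⟨
        1# * y + (1# * x + - 1# * y)  ≈⟨ +-congˡ (*-identityˡ _) ⟨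
        1# * y + 1# * (1# * x + - 1# * y)  ≈⟨ +-congˡ (*-congˡ (reflexive (≡.cong (λ r → r k) (Vectorₚ.updateAt-updates (suc (suc i)) M₁)))) ⟨
        1# * M₂ (suc zero) k + 1# * M₂ (suc (suc i)) k  ∎
        where
          x y : Carrier
          x = M (suc (suc i)) k
          y = 1# * M (suc zero) k + 1# * M (suc (suc i)) k

  det-alternating : ∀ {n} i j → i ≢ j → AlternatingAt (det {n}) i j
  det-alternating {suc n} zero    zero    i≢j M _     = contradiction ≡.refl i≢j
  det-alternating {suc n} zero    (suc j) i≢j M Mᵢ≈Mⱼ = alternating-top (det-alternating {n}) j M Mᵢ≈Mⱼ
  det-alternating {suc n} (suc i) zero    i≢j M Mᵢ≈Mⱼ = alternating-top (det-alternating {n}) i M (sym ∘ Mᵢ≈Mⱼ)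
  det-alternating {suc n} (suc i) (suc j) i≢j M Mᵢ≈Mⱼ = alternating-below (det-alternating {n}) i j (i≢j ∘ ≡.cong suc) M Mᵢ≈Mⱼ

  replace-rows : ∀ {m n} (f : (Fin m → Row n) → Carrier) → Congruent f → (M N : Fin m → Row n) →
    (∀ L i → f (set L i (M i)) ≈ f (set L i (N i))) → f M ≈ f N
  replace-rows {zero}  f cong M N replace = cong λ ()
  replace-rows {suc m} f cong M N replace = begin
    f M  ≈⟨ cong (λ { zero k → refl ; (suc i) k → refl }) ⟩
    f (set M zero (M zero))  ≈⟨ replace M zero ⟩
    f (set M zero (N zero))  ≈⟨ cong (λ { zero k → refl ; (suc i) k → refl }) ⟩
    f (N zero Vector.∷ (M ∘ suc))     ≈⟨ replace-rows (λ L → f (N zero Vector.∷ L)) (λ L≈L′ → cong λ { zero k → refl ; (suc i) → L≈L′ i })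
                                           (M ∘ suc) (N ∘ suc) (λ L i → begin
      f (N zero Vector.∷ set L i (M (suc i)))       ≈⟨ cong (λ { zero k → refl ; (suc i′) k → refl }) ⟩
      f (set (N zero Vector.∷ L) (suc i) (M (suc i))) ≈⟨ replace (N zero Vector.∷ L) (suc i) ⟩
      f (set (N zero Vector.∷ L) (suc i) (N (suc i))) ≈⟨ cong (λ { zero k → refl ; (suc i′) k → refl }) ⟩
      f (N zero Vector.∷ set L i (N (suc i)))       ∎) ⟩
    f (N zero Vector.∷ (N ∘ suc))     ≈⟨ cong (λ { zero k → refl ; (suc i) k → refl }) ⟩
    f N                               ∎

  I-suc : ∀ {n} (i k : Fin n) → I (suc i) (suc k) ≈ I i k
  I-suc i k with i Fin.≟ k
  ... | yes _ = refl
  ... | no  _ = refl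

  I-diagonal : ∀ {n} (i : Fin n) → I i i ≈ 1#
  I-diagonal i with i Fin.≟ i
  ... | yes _  = refl
  ... | no i≢i = contradiction ≡.refl i≢i

  I-off-diagonal : ∀ {n} {i k : Fin n} → i ≢ k → I i k ≈ 0#
  I-off-diagonal {i = i} {k} i≢k with i Fin.≟ k
  ... | yes i≡k = contradiction i≡k i≢k
  ... | no  _   = refl

  -- Uniqueness of alternating multilinear forms and multiplicativity of the determinant.

  insert : ∀ {n} → Fin (suc n) → Row n → Row (suc n)
  insert j r = insertAt r j 0#

  insert-cong : ∀ {n} j {r s : Row n} → (∀ k → r k ≈ s k) → ∀ k → insert j r k ≈ insert j s k
  insert-cong         zero    r≈s zero    = refl
  insert-cong         zero    r≈s (suc k) = r≈s k
  insert-cong {suc n} (suc j) r≈s zero    = r≈s zero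
  insert-cong {suc n} (suc j) r≈s (suc k) = insert-cong j (r≈s ∘ suc) k

  insert-linear : ∀ {n} j a (r : Row n) b s k → insert j (λ k → a * r k + b * s k) k ≈ a * insert j r k + b * insert j s k
  insert-linear         zero    a r b s zero    = sym (trans (+-cong (zeroʳ a) (zeroʳ b)) (+-identityˡ 0#))
  insert-linear         zero    a r b s (suc k) = refl
  insert-linear {suc n} (suc j) a r b s zero    = refl
  insert-linear {suc n} (suc j) a r b s (suc k) = insert-linear j a (r ∘ suc) b (s ∘ suc) k

  insert-zero : ∀ {n} j {r : Row n} → (∀ k → r k ≈ 0#) → ∀ k → insert j r k ≈ 0#
  insert-zero         zero    r≈0 zero    = refl
  insert-zero         zero    r≈0 (suc k) = r≈0 k
  insert-zero {suc n} (suc j) r≈0 zero    = r≈0 zero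
  insert-zero {suc n} (suc j) r≈0 (suc k) = insert-zero j (r≈0 ∘ suc) k

  insert-I : ∀ {n} j (a : Fin n) k → insert j (I a) k ≈ I (punchIn j a) k
  insert-I zero    a       zero    = refl
  insert-I zero    a       (suc k) = sym (I-suc a k)
  insert-I (suc j) zero    zero    = refl
  insert-I (suc j) zero    (suc k) = insert-zero j (λ _ → refl) k
  insert-I (suc j) (suc a) zero    = refl
  insert-I (suc j) (suc a) (suc k) = trans (insert-cong j (I-suc a) k) (trans (insert-I j a k) (sym (I-suc (punchIn j a) k)))

  insert-removed : ∀ {n} (r : Row (suc n)) j k → r k ≈ 1# * insert j (r ∘ punchIn j) k + r j * I j k
  insert-removed r j k with j Fin.≟ k
  ... | yes ≡.refl = begin
    r j  ≈⟨ *-identityʳ (r j) ⟨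
    r j * 1#  ≈⟨ +-identityˡ _ ⟨
    0# + r j * 1#  ≈⟨ +-congʳ (trans (*-identityˡ _) (reflexive (Vectorₚ.insertAt-lookup (r ∘ punchIn j) j 0#))) ⟨
    1# * insert j (r ∘ punchIn j) j + r j * 1# ∎
  ... | no j≢k = begin
    r k  ≈⟨ reflexive (≡.cong r (Finₚ.punchIn-punchOut j≢k)) ⟨
    r (punchIn j (Fin.punchOut j≢k))  ≈⟨ reflexive (Vectorₚ.insertAt-punchIn (r ∘ punchIn j) j 0# (Fin.punchOut j≢k)) ⟨
    insert j (r ∘ punchIn j) (punchIn j (Fin.punchOut j≢k)) ≈⟨ reflexive (≡.cong (insert j (r ∘ punchIn j)) (Finₚ.punchIn-punchOut j≢k)) ⟩
    insert j (r ∘ punchIn j) k  ≈⟨ trans (+-cong (*-identityˡ _) (zeroʳ (r j))) (+-identityʳ _) ⟨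
    1# * insert j (r ∘ punchIn j) k + r j * 0# ∎

  module _ {m n} {f : (Fin (suc m) → Row (suc n)) → Carrier} (alt : AlternatingMultilinear f) where
    open AlternatingMultilinear alt

    linear₀ : ∀ a r b s M → f ((λ k → a * r k + b * s k) Vector.∷ M) ≈ a * f (r Vector.∷ M) + b * f (s Vector.∷ M)
    linear₀ a r b s M = trans (congruent (head-set _)) (trans (linear (r Vector.∷ M) zero a r b s)
      (+-cong (*-congˡ (congruent (λ i k → sym (head-set r i k)))) (*-congˡ (congruent (λ i k → sym (head-set s i k))))))
      where
        head-set : ∀ x i k → (x Vector.∷ M) i k ≈ set (r Vector.∷ M) zero x i k
        head-set x zero    k = refl
        head-set x (suc i) k = refl

    ∷-cong : ∀ {r s M N} → (∀ k → r k ≈ s k) → (∀ i k → M i k ≈ N i k) → f (r Vector.∷ M) ≈ f (s Vector.∷ N)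
    ∷-cong r≈s M≈N = congruent λ { zero → r≈s ; (suc i) → M≈N i }

    combination₀ : ∀ {p} (c : Fin p → Carrier) (r : Fin p → Row (suc n)) M →
      f ((λ k → sumF (λ j → c j * r j k)) Vector.∷ M) ≈ sumF (λ j → c j * f (r j Vector.∷ M))
    combination₀ {zero} c r M = begin
      f ((λ _ → 0#) Vector.∷ M)  ≈⟨ ∷-cong (λ _ → trans (+-cong (zeroˡ 0#) (zeroˡ 0#)) (+-identityˡ 0#)) (λ _ _ → refl) ⟨
      f ((λ _ → 0# * 0# + 0# * 0#) Vector.∷ M)      ≈⟨ linear₀ 0# (λ _ → 0#) 0# (λ _ → 0#) M ⟩
      0# * f _ + 0# * f _  ≈⟨ trans (+-cong (zeroˡ _) (zeroˡ _)) (+-identityˡ 0#) ⟩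
      0#                                            ∎
    combination₀ {suc p} c r M = begin
      f ((λ k → c zero * r zero k + sumF (λ j → c (suc j) * r (suc j) k)) Vector.∷ M)
        ≈⟨ ∷-cong (λ k → +-congˡ (sym (*-identityˡ _))) (λ _ _ → refl) ⟩
      f ((λ k → c zero * r zero k + 1# * sumF (λ j → c (suc j) * r (suc j) k)) Vector.∷ M)
        ≈⟨ linear₀ (c zero) (r zero) 1# (λ k → sumF (λ j → c (suc j) * r (suc j) k)) M ⟩
      c zero * f (r zero Vector.∷ M) + 1# * f ((λ k → sumF (λ j → c (suc j) * r (suc j) k)) Vector.∷ M)
        ≈⟨ +-congˡ (trans (*-identityˡ _) (combination₀ (c ∘ suc) (r ∘ suc) M)) ⟩
      c zero * f (r zero Vector.∷ M) + sumF (λ j → c (suc j) * f (r (suc j) Vector.∷ M)) ∎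

    expand₀ : ∀ M → f M ≈ sumF (λ j → M zero j * f (I j Vector.∷ (M ∘ suc)))
    expand₀ M = begin
      f M
        ≈⟨ congruent (λ { zero k → sym (trans (sumF-single (λ j → M zero j * I j k) k
                            (λ j k≢j → trans (*-congˡ (I-off-diagonal (k≢j ∘ ≡.sym))) (zeroʳ _)))
                            (trans (*-congˡ (I-diagonal k)) (*-identityʳ _)))
                        ; (suc i) k → refl }) ⟩
      f ((λ k → sumF (λ j → M zero j * I j k)) Vector.∷ (M ∘ suc))
        ≈⟨ combination₀ (M zero) I (M ∘ suc) ⟩
      sumF (λ j → M zero j * f (I j Vector.∷ (M ∘ suc))) ∎

    -- The cofactor form: bordering by a unit row and a zero column lowers the size by one for the
    -- induction.
    bordered : Fin (suc n) → (Fin m → Row n) → Carrier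
    bordered j N = f (I j Vector.∷ (insert j ∘ N))

    bordered-set : ∀ j N i r → bordered j (set N i r) ≈ f (set (I j Vector.∷ (insert j ∘ N)) (suc i) (insert j r))
    bordered-set j N i r = congruent λ
      { zero k → refl ; (suc i′) k → reflexive (≡.cong (λ x → x k) (set-map (insert j) N i r i′)) }

    bordered-alternatingMultilinear : ∀ j → AlternatingMultilinear (bordered j)
    bordered-alternatingMultilinear j = record
      { congruent   = λ M≈N → ∷-cong (λ _ → refl) (λ i → insert-cong j (M≈N i))
      ; linear      = λ M i a r b s → begin
          bordered j (set M i (λ k → a * r k + b * s k))
            ≈⟨ bordered-set j M i _ ⟩
          f (set (I j Vector.∷ (insert j ∘ M)) (suc i) (insert j (λ k → a * r k + b * s k)))
            ≈⟨ congruent (set-cong (suc i) (λ _ _ → refl) (insert-linear j a r b s)) ⟩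
          f (set (I j Vector.∷ (insert j ∘ M)) (suc i) (λ k → a * insert j r k + b * insert j s k))
            ≈⟨ linear (I j Vector.∷ (insert j ∘ M)) (suc i) a (insert j r) b (insert j s) ⟩
          a * f (set (I j Vector.∷ (insert j ∘ M)) (suc i) (insert j r)) + b * f (set (I j Vector.∷ (insert j ∘ M)) (suc i) (insert j s))
            ≈⟨ +-cong (*-congˡ (bordered-set j M i r)) (*-congˡ (bordered-set j M i s)) ⟨
          a * bordered j (set M i r) + b * bordered j (set M i s) ∎
      ; alternating = λ i i′ i≢i′ M Mᵢ≈Mᵢ′ → alternating (suc i) (suc i′) (i≢i′ ∘ Finₚ.suc-injective) (I j Vector.∷ (insert j ∘ M))
                        (insert-cong j Mᵢ≈Mᵢ′)
      }

    -- The entries of column j in the lower rows are multiples of the unit row on top, and an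
    -- alternating form does not see them.
    bordered-minor : ∀ j M → f (I j Vector.∷ M) ≈ bordered j (λ i → M i ∘ punchIn j)
    bordered-minor j M = replace-rows (λ L → f (I j Vector.∷ L)) (∷-cong (λ _ → refl)) M (λ i → insert j (M i ∘ punchIn j)) λ L i → begin
      f (I j Vector.∷ set L i (M i))
        ≈⟨ congruent (λ { zero k → refl ; (suc i′) k → set-cong i (λ _ _ → refl) (insert-removed (M i) j) i′ k }) ⟩
      f (set (I j Vector.∷ L) (suc i) (λ k → 1# * insert j (M i ∘ punchIn j) k + M i j * I j k))
        ≈⟨ linear (I j Vector.∷ L) (suc i) 1# (insert j (M i ∘ punchIn j)) (M i j) (I j) ⟩
      1# * f (set (I j Vector.∷ L) (suc i) (insert j (M i ∘ punchIn j))) + M i j * f (set (I j Vector.∷ L) (suc i) (I j))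
        ≈⟨ +-cong (*-identityˡ _) (trans (*-congˡ (alternating zero (suc i) (λ ()) _
             (λ k → reflexive (≡.cong (λ r → r k) (≡.sym (Vectorₚ.updateAt-updates i L)))))) (zeroʳ _)) ⟩
      f (set (I j Vector.∷ L) (suc i) (insert j (M i ∘ punchIn j))) + 0#
        ≈⟨ +-identityʳ _ ⟩
      f (set (I j Vector.∷ L) (suc i) (insert j (M i ∘ punchIn j)))
        ≈⟨ congruent (λ { zero k → refl ; (suc i′) k → refl }) ⟩
      f (I j Vector.∷ set L i (insert j (M i ∘ punchIn j))) ∎

  -- Polarisation: f vanishes when both of the first two rows are r + s.
  swap₀₁ : ∀ {m n} {f : (Fin (suc (suc m)) → Row (suc n)) → Carrier} → AlternatingMultilinear f → ∀ r s M →
    f (r Vector.∷ (s Vector.∷ M)) ≈ - f (s Vector.∷ (r Vector.∷ M))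
  swap₀₁ {m} {n} {f} alt r s M = +-inverseˡ-unique _ _ (begin
    L r s + L s r
      ≈⟨ +-cong (trans (+-congʳ (diagonal r)) (+-identityˡ _)) (trans (+-congˡ (diagonal s)) (+-identityʳ _)) ⟨
    (L r r + L r s) + (L s r + L s s)
      ≈⟨ +-cong (+-cong (*-identityˡ _) (*-identityˡ _)) (+-cong (*-identityˡ _) (*-identityˡ _)) ⟨
    (1# * L r r + 1# * L r s) + (1# * L s r + 1# * L s s)
      ≈⟨ +-cong (second r) (second s) ⟨
    L r t + L s t
      ≈⟨ +-cong (*-identityˡ _) (*-identityˡ _) ⟨
    1# * L r t + 1# * L s t
      ≈⟨ linear₀ alt 1# r 1# s (t Vector.∷ M) ⟨
    L t t
      ≈⟨ diagonal t ⟩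
    0# ∎)
    where
      open AlternatingMultilinear alt
      t : Row (suc n)
      t k = 1# * r k + 1# * s k
      L : Row (suc n) → Row (suc n) → Carrier
      L x y = f (x Vector.∷ (y Vector.∷ M))
      diagonal : ∀ x → L x x ≈ 0#
      diagonal x = alternating zero (suc zero) (λ ()) _ (λ k → refl)
      second-set : ∀ x y → L x y ≈ f (set (x Vector.∷ (r Vector.∷ M)) (suc zero) y)
      second-set x y = congruent λ { zero k → refl ; (suc zero) k → refl ; (suc (suc i)) k → refl }
      second : ∀ x → L x t ≈ 1# * L x r + 1# * L x s
      second x = trans (second-set x t) (trans (linear (x Vector.∷ (r Vector.∷ M)) (suc zero) 1# r 1# s)
        (+-cong (*-congˡ (sym (second-set x r))) (*-congˡ (sym (second-set x s)))))

  -- Row j reaches the top by j transpositions. Each exchanges the first two rows, and the bordered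
  -- form then hides the row that has found its place.
  permuted-I : ∀ {n} {f : (Fin (suc n) → Row (suc n)) → Carrier} → AlternatingMultilinear f → ∀ j →
    f (I j Vector.∷ (λ i → I (punchIn j i))) ≈ sign (toℕ j) (f I)
  permuted-I alt zero = AlternatingMultilinear.congruent alt λ { zero k → refl ; (suc i) k → refl }
  permuted-I {suc n} {f} alt (suc j) = begin
    f (I (suc j) Vector.∷ (λ i → I (punchIn (suc j) i)))
      ≈⟨ congruent (λ { zero k → refl ; (suc zero) k → refl ; (suc (suc i)) k → refl }) ⟩
    f (I (suc j) Vector.∷ (I zero Vector.∷ (λ i → I (suc (punchIn j i)))))
      ≈⟨ swap₀₁ alt (I (suc j)) (I zero) (λ i → I (suc (punchIn j i))) ⟩
    - f (I zero Vector.∷ (I (suc j) Vector.∷ (λ i → I (suc (punchIn j i)))))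
      ≈⟨ -‿cong (congruent λ { zero k → refl ; (suc zero) k → sym (insert-I zero j k) ; (suc (suc i)) k → sym (insert-I zero (punchIn j i) k) }) ⟩
    - bordered alt zero (I j Vector.∷ (λ i → I (punchIn j i)))
      ≈⟨ -‿cong (permuted-I (bordered-alternatingMultilinear alt zero) j) ⟩
    - sign (toℕ j) (bordered alt zero I)
      ≈⟨ -‿cong (sign-cong (toℕ j) (congruent λ { zero k → refl ; (suc i) k → insert-I zero i k })) ⟩
    - sign (toℕ j) (f I)
      ≈⟨ sign-suc (toℕ j) (f I) ⟨
    sign (suc (toℕ j)) (f I) ∎
    where open AlternatingMultilinear alt

  -- Expanding f along row 0 meets the recursion that defines `det` term by term.
  alternating-unique : ∀ {n} {f : (Fin n → Row n) → Carrier} → AlternatingMultilinear f → ∀ M → f M ≈ det M * f I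
  alternating-unique {zero}  alt M = trans (AlternatingMultilinear.congruent alt λ ()) (sym (*-identityˡ _))
  alternating-unique {suc n} {f} alt M = begin
    f M
      ≈⟨ expand₀ alt M ⟩
    sumF (λ j → M zero j * f (I j Vector.∷ (M ∘ suc)))
      ≈⟨ sumF-cong (λ j → begin
           M zero j * f (I j Vector.∷ (M ∘ suc))
             ≈⟨ *-congˡ (bordered-minor alt j (M ∘ suc)) ⟩
           M zero j * bordered alt j (minor M j)
             ≈⟨ *-congˡ (alternating-unique (bordered-alternatingMultilinear alt j) (minor M j)) ⟩
           M zero j * (det (minor M j) * bordered alt j I)
             ≈⟨ *-congˡ (*-congˡ (trans (∷-cong alt (λ _ → refl) (λ i → insert-I j i)) (permuted-I alt j))) ⟩
           M zero j * (det (minor M j) * sign (toℕ j) (f I))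
             ≈⟨ *-assoc _ _ _ ⟨
           M zero j * det (minor M j) * sign (toℕ j) (f I)
             ≈⟨ sign-* (toℕ j) _ _ ⟨
           sign (toℕ j) (M zero j * det (minor M j) * f I)
             ≈⟨ sign-cong (toℕ j) (*-comm _ _) ⟩
           sign (toℕ j) (f I * (M zero j * det (minor M j)))
             ≈⟨ sign-* (toℕ j) _ _ ⟩
           f I * sign (toℕ j) (M zero j * det (minor M j)) ∎) ⟩
    sumF (λ j → f I * sign (toℕ j) (M zero j * det (minor M j)))
      ≈⟨ sumF-*ˡ (f I) (λ j → sign (toℕ j) (M zero j * det (minor M j))) ⟩
    f I * det M
      ≈⟨ *-comm _ _ ⟩
    det M * f I ∎

  I·M≈M : ∀ {n} (M : Mat Carrier n) → (I · M) ≈M M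
  I·M≈M M i j = trans (sumF-single (λ k → I i k * M k j) i λ k i≢k → trans (*-congʳ (I-off-diagonal i≢k)) (zeroˡ _))
    (trans (*-congʳ (I-diagonal i)) (*-identityˡ _))

  -- Each row of N · A depends linearly on the same row of N, so N ↦ det (N · A) is alternating
  -- multilinear; its value at I is det A.
  det-· : ∀ {n} (M A : Mat Carrier n) → det (M · A) ≈ det M * det A
  det-· {n} M A = trans (alternating-unique {f = λ N → det (N · A)} alt M) (*-congˡ (det-congruent (I·M≈M A)))
    where
      row : Row n → Row n
      row r j = sumF (λ k → r k * A k j)
      row-cong : ∀ {r s} → (∀ k → r k ≈ s k) → ∀ j → row r j ≈ row s j
      row-cong r≈s j = sumF-cong λ k → *-congʳ (r≈s k)
      row-linear : ∀ a r b s j → row (λ k → a * r k + b * s k) j ≈ a * row r j + b * row s j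
      row-linear a r b s j = trans
        (sumF-cong λ k → solve 5 (λ a r b s x → (a :* r :+ b :* s) :* x := a :* (r :* x) :+ b :* (s :* x)) refl a (r k) b (s k) (A k j))
        (sumF-linear a (λ k → r k * A k j) b (λ k → s k * A k j))
      row-set : ∀ M i r → det (set M i r · A) ≈ det (set (row ∘ M) i (row r))
      row-set M i r = det-congruent λ i′ k → reflexive (≡.cong (λ x → x k) (set-map row M i r i′))
      alt : AlternatingMultilinear (λ N → det (N · A))
      alt = record
        { congruent   = λ M≈N → det-congruent λ i → row-cong (M≈N i)
        ; linear      = λ M i a r b s → begin
            det (set M i (λ k → a * r k + b * s k) · A)
              ≈⟨ row-set M i _ ⟩
            det (set (row ∘ M) i (row (λ k → a * r k + b * s k)))
              ≈⟨ det-congruent (set-cong i (λ _ _ → refl) (row-linear a r b s)) ⟩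
            det (set (row ∘ M) i (λ k → a * row r k + b * row s k))
              ≈⟨ det-linear (row ∘ M) i a (row r) b (row s) ⟩
            a * det (set (row ∘ M) i (row r)) + b * det (set (row ∘ M) i (row s))
              ≈⟨ +-cong (*-congˡ (row-set M i r)) (*-congˡ (row-set M i s)) ⟨
            a * det (set M i r · A) + b * det (set M i s · A) ∎
        ; alternating = λ i j i≢j M Mᵢ≈Mⱼ → det-alternating i j i≢j (M · A) (row-cong Mᵢ≈Mⱼ)
        }

  product : ∀ {n} → (Fin n → Carrier) → Carrier
  product {zero}  d = 1#
  product {suc n} d = d zero * product (d ∘ suc)

  det-diag : ∀ {n} (d : Fin n → Carrier) → det (diag d) ≈ product d
  det-diag {zero}  d = refl
  det-diag {suc n} d = begin
    det (diag d)
      ≈⟨ sumF-single (λ j → sign (toℕ j) (diag d zero j * det (minor (diag d) j))) zero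
           (λ { zero 0≢0 → contradiction ≡.refl 0≢0 ; (suc j) _ → sign-zero (suc (toℕ j)) (zeroˡ _) }) ⟩
    d zero * det (minor (diag d) zero)
      ≈⟨ *-congˡ (trans (det-congruent (diag-suc)) (det-diag (d ∘ suc))) ⟩
    d zero * product (d ∘ suc) ∎
    where
      diag-suc : ∀ i k → diag d (suc i) (suc k) ≈ diag (d ∘ suc) i k
      diag-suc i k with i Fin.≟ k
      ... | yes _ = refl
      ... | no  _ = refl

  -- The source is a raw ring, so that evaluation of coefficient lists qualifies without ring laws
  -- for the lists.
  det-homomorphic : ∀ (S : RawRing 0ℓ 0ℓ) (φ : RawRing.Carrier S → Carrier) →
    let module S = RawRing S in
    (∀ x y → φ (x S.+ y) ≈ φ x + φ y) → (∀ x y → φ (x S.* y) ≈ φ x * φ y) →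
    (∀ x → φ (S.- x) ≈ - φ x) → φ S.0# ≈ 0# → φ S.1# ≈ 1# →
    ∀ {n} (M : Mat S.Carrier n) → φ (RawMat.det S M) ≈ det (λ i j → φ (M i j))
  det-homomorphic S φ φ-+ φ-* φ-neg φ-0 φ-1 = φ-det
    where
      module S = RawRing S
      φ-sum : ∀ {n} (f : Fin n → S.Carrier) → φ (RawMat.sumF S f) ≈ sumF (φ ∘ f)
      φ-sum {zero}  f = φ-0
      φ-sum {suc n} f = trans (φ-+ _ _) (+-congˡ (φ-sum (f ∘ suc)))
      φ-sign : ∀ k x → φ (RawMat.sign S k x) ≈ sign k (φ x)
      φ-sign zero          x = refl
      φ-sign (suc zero)    x = φ-neg x
      φ-sign (suc (suc k)) x = φ-sign k x
      φ-det : ∀ {n} (M : Mat S.Carrier n) → φ (RawMat.det S M) ≈ det (λ i j → φ (M i j))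
      φ-det {zero}  M = φ-1
      φ-det {suc n} M = trans
        (φ-sum (λ j → RawMat.sign S (toℕ j) (M zero j S.* RawMat.det S (λ i k → M (suc i) (punchIn j k)))))
        (sumF-cong λ j → trans (φ-sign (toℕ j) _) (sign-cong (toℕ j) (trans (φ-* (M zero j) _) (*-congˡ (φ-det (λ i k → M (suc i) (punchIn j k)))))))

-- Coefficient lists and division with remainder.

module Polynomials {q : ℕ} (F : FiniteField q) where
  open FieldProperties F
  open ≈-Reasoning
  open Poly F
  open Solver using (solve; _:+_; _:*_; _:=_)

  coeff : Pol → ℕ → Carrier
  coeff []      n       = 0#
  coeff (a ∷ f) zero    = a
  coeff (a ∷ f) (suc n) = coeff f n

  -- Coefficients beyond the end of a list read as 0, so trailing zeros are invisible.
  _≐_ : Pol → Pol → Set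
  f ≐ g = ∀ n → coeff f n ≈ coeff g n

  ≐⇒≈P : ∀ f g → f ≐ g → f ≈P g
  ≐⇒≈P []      []      f≐g = tt
  ≐⇒≈P []      (b ∷ g) f≐g = sym (f≐g zero) , ≐⇒≈P [] g (f≐g ∘ suc)
  ≐⇒≈P (a ∷ f) []      f≐g = f≐g zero , ≐⇒≈P f [] (f≐g ∘ suc)
  ≐⇒≈P (a ∷ f) (b ∷ g) f≐g = f≐g zero , ≐⇒≈P f g (f≐g ∘ suc)

  ≈P⇒≐ : ∀ f g → f ≈P g → f ≐ g
  ≈P⇒≐ []      []      _             n       = refl
  ≈P⇒≐ []      (b ∷ g) (b≈0 , _)     zero    = sym b≈0
  ≈P⇒≐ []      (b ∷ g) (_ , []≈g)    (suc n) = ≈P⇒≐ [] g []≈g n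
  ≈P⇒≐ (a ∷ f) []      (a≈0 , _)     zero    = a≈0
  ≈P⇒≐ (a ∷ f) []      (_ , f≈[])    (suc n) = ≈P⇒≐ f [] f≈[] n
  ≈P⇒≐ (a ∷ f) (b ∷ g) (a≈b , _)     zero    = a≈b
  ≈P⇒≐ (a ∷ f) (b ∷ g) (_ , f≈g)     (suc n) = ≈P⇒≐ f g f≈g n

  coeff-+P : ∀ f g n → coeff (f +P g) n ≈ coeff f n + coeff g n
  coeff-+P []      g       n       = sym (+-identityˡ _)
  coeff-+P (a ∷ f) []      n       = sym (+-identityʳ _)
  coeff-+P (a ∷ f) (b ∷ g) zero    = refl
  coeff-+P (a ∷ f) (b ∷ g) (suc n) = coeff-+P f g n

  coeff-scale : ∀ c f n → coeff (scale c f) n ≈ c * coeff f n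
  coeff-scale c []      n       = sym (zeroʳ c)
  coeff-scale c (a ∷ f) zero    = refl
  coeff-scale c (a ∷ f) (suc n) = coeff-scale c f n

  coeff-length : ∀ f n → List.length f ℕ.≤ n → coeff f n ≈ 0#
  coeff-length []      n       _           = refl
  coeff-length (a ∷ f) (suc n) (ℕ.s≤s f≤n) = coeff-length f n f≤n

  coeff-*P-zero : ∀ f g → f ≐ [] → (f *P g) ≐ []
  coeff-*P-zero []      g f≐0 n = refl
  coeff-*P-zero (a ∷ f) g f≐0 n = begin
    coeff (scale a g +P (0# ∷ (f *P g))) n  ≈⟨ coeff-+P (scale a g) _ n ⟩
    coeff (scale a g) n + coeff (0# ∷ (f *P g)) n     ≈⟨ +-cong (trans (coeff-scale a g n) (trans (*-congʳ (f≐0 zero)) (zeroˡ _))) (shifted n) ⟩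
    0# + 0#  ≈⟨ +-identityˡ 0# ⟩
    0#                                                ∎
    where
      shifted : ∀ n → coeff (0# ∷ (f *P g)) n ≈ 0#
      shifted zero    = refl
      shifted (suc n) = coeff-*P-zero f g (f≐0 ∘ suc) n

  DegreeBelow : ℕ → Pol → Set
  DegreeBelow d f = ∀ n → d ℕ.≤ n → coeff f n ≈ 0#

  Monic : ℕ → Pol → Set
  Monic d g = coeff g d ≈ 1# × DegreeBelow (suc d) g

  -- Horner-style: if p = q g + r, then a + X p = (X q) g + s with s = a + X r of degree at most d,
  -- and subtracting c g, with c the coefficient of s at X^d, brings the degree below d.
  divide : ∀ {d g} → Monic d g → ∀ p → ∃₂ λ q r → (p ≐ ((q *P g) +P r)) × DegreeBelow d r
  divide         monic []      = [] , [] , (λ n → refl) , (λ n d≤n → refl)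
  divide {d} {g} monic@(g-lead , g-deg) (a ∷ p) with divide monic p
  ... | q , r , p≐qg+r , r-deg = c ∷ q , s +P scale (- c) g , identity , below
    where
      s : Pol
      s = a ∷ r
      c : Carrier
      c = coeff s d
      shifted : ∀ n → coeff (a ∷ p) n ≈ coeff (0# ∷ (q *P g)) n + coeff s n
      shifted zero    = sym (+-identityˡ a)
      shifted (suc n) = trans (p≐qg+r n) (coeff-+P (q *P g) r n)
      identity : (a ∷ p) ≐ (((c ∷ q) *P g) +P (s +P scale (- c) g))
      identity n = sym (begin
        coeff ((scale c g +P (0# ∷ (q *P g))) +P (s +P scale (- c) g)) n
          ≈⟨ coeff-+P (scale c g +P (0# ∷ (q *P g))) _ n ⟩
        coeff (scale c g +P (0# ∷ (q *P g))) n + coeff (s +P scale (- c) g) n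
          ≈⟨ +-cong (coeff-+P (scale c g) _ n) (coeff-+P s (scale (- c) g) n) ⟩
        (coeff (scale c g) n + x) + (coeff s n + coeff (scale (- c) g) n)
          ≈⟨ +-cong (+-congʳ (coeff-scale c g n)) (+-congˡ (coeff-scale (- c) g n)) ⟩
        (c * coeff g n + x) + (coeff s n + - c * coeff g n)
          ≈⟨ solve 5 (λ c c⁻ g x y → c :* g :+ x :+ (y :+ c⁻ :* g) := (c :+ c⁻) :* g :+ (x :+ y)) refl c (- c) (coeff g n) x (coeff s n) ⟩
        (c - c) * coeff g n + (x + coeff s n)
          ≈⟨ +-congʳ (trans (*-congʳ (-‿inverseʳ c)) (zeroˡ _)) ⟩
        0# + (x + coeff s n)
          ≈⟨ +-identityˡ _ ⟩
        x + coeff s n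
          ≈⟨ shifted n ⟨
        coeff (a ∷ p) n ∎)
        where
          x : Carrier
          x = coeff (0# ∷ (q *P g)) n
      below : DegreeBelow d (s +P scale (- c) g)
      below n d≤n = trans (coeff-+P s (scale (- c) g) n) (trans (+-congˡ (coeff-scale (- c) g n)) (top (ℕₚ.m≤n⇒m<n∨m≡n d≤n)))
        where
          top : d ℕ.< n ⊎ d ≡ n → coeff s n + - c * coeff g n ≈ 0#
          top (inj₂ ≡.refl) = trans (+-congˡ (trans (*-congˡ g-lead) (*-identityʳ _))) (-‿inverseʳ c)
          top (inj₁ d<n@(ℕ.s≤s d≤n′)) = trans (+-cong (r-deg _ d≤n′) (trans (*-congˡ (g-deg n d<n)) (zeroʳ _))) (+-identityˡ 0#)

  leading : ∀ d r → DegreeBelow d r → (r ≐ []) ⊎ ∃ λ e → e ℕ.< d × ¬ (coeff r e ≈ 0#) × DegreeBelow (suc e) r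
  leading zero    r below = inj₁ λ n → below n ℕ.z≤n
  leading (suc d) r below with coeff r d ≟ 0#
  ... | no r_d≉0 = inj₂ (d , ℕₚ.≤-refl , r_d≉0 , below)
  ... | yes r_d≈0 with leading d r (λ n d≤n → lower (ℕₚ.m≤n⇒m<n∨m≡n d≤n))
    where
      lower : ∀ {n} → d ℕ.< n ⊎ d ≡ n → coeff r n ≈ 0#
      lower (inj₁ d<n)    = below _ d<n
      lower (inj₂ ≡.refl) = r_d≈0
  ...   | inj₁ r≐0 = inj₁ r≐0
  ...   | inj₂ (e , e<d , rest) = inj₂ (e , ℕₚ.m<n⇒m<1+n e<d , rest)

-- Conjugate roots of an irreducible polynomial.

module Conjugates {q m : ℕ} (F : FiniteField q) (K : FiniteField m) (ι : FiniteField.Carrier F → FiniteField.Carrier K)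
                  (ι-hom : RingMorphisms.IsRingHomomorphism (FiniteField.rawRing F) (FiniteField.rawRing K) ι) where
  private module F = FieldProperties F
  open Powers K
  open ≈-Reasoning
  open Solver using (solve; _:+_; _:*_; _:=_)
  open Poly F
  open Polynomials F
  open RingMorphisms.IsRingHomomorphism ι-hom using (⟦⟧-cong; +-homo; *-homo; 0#-homo; 1#-homo; -‿homo) public

  ι-injective₀ : ∀ {c} → ι c ≈ 0# → c F.≈ F.0#
  ι-injective₀ {c} ιc≈0 with c F.≟ F.0#
  ... | yes c≈0 = c≈0
  ... | no  c≉0 with c⁻¹ , c*c⁻¹≈1 ← F.inverse c c≉0 = contradiction (begin
    1#  ≈⟨ 1#-homo ⟨
    ι F.1#  ≈⟨ ⟦⟧-cong c*c⁻¹≈1 ⟨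
    ι (c F.* c⁻¹)  ≈⟨ *-homo c c⁻¹ ⟩
    ι c * ι c⁻¹    ≈⟨ *-congʳ ιc≈0 ⟩
    0# * ι c⁻¹     ≈⟨ zeroˡ _ ⟩
    0#             ∎) 1≉0

  ι-injective : ∀ {a b} → ι a ≈ ι b → a F.≈ b
  ι-injective {a} {b} ιa≈ιb = F.x∙y⁻¹≈ε⇒x≈y a b (ι-injective₀ (begin
    ι (a F.- b)      ≈⟨ +-homo a (F.- b) ⟩
    ι a + ι (F.- b)  ≈⟨ +-cong ιa≈ιb (-‿homo b) ⟩
    ι b - ι b        ≈⟨ -‿inverseʳ _ ⟩
    0#               ∎))

  eval : Pol → Carrier → Carrier
  eval []      x = 0#
  eval (a ∷ f) x = ι a + x * eval f x

  eval-≐[] : ∀ f x → f ≐ [] → eval f x ≈ 0#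
  eval-≐[] []      x f≐0 = refl
  eval-≐[] (a ∷ f) x f≐0 = trans (+-cong (trans (⟦⟧-cong (f≐0 zero)) 0#-homo) (trans (*-congˡ (eval-≐[] f x (f≐0 ∘ suc))) (zeroʳ x))) (+-identityˡ 0#)

  eval-≐ : ∀ f g x → f ≐ g → eval f x ≈ eval g x
  eval-≐ []      g       x f≐g = sym (eval-≐[] g x (F.sym ∘ f≐g))
  eval-≐ (a ∷ f) []      x f≐g = eval-≐[] (a ∷ f) x f≐g
  eval-≐ (a ∷ f) (b ∷ g) x f≐g = +-cong (⟦⟧-cong (f≐g zero)) (*-congˡ (eval-≐ f g x (f≐g ∘ suc)))

  eval-+P : ∀ f g x → eval (f +P g) x ≈ eval f x + eval g x
  eval-+P []      g       x = sym (+-identityˡ _)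
  eval-+P (a ∷ f) []      x = sym (+-identityʳ _)
  eval-+P (a ∷ f) (b ∷ g) x = trans (+-cong (+-homo a b) (*-congˡ (eval-+P f g x)))
    (solve 5 (λ a b x f g → a :+ b :+ x :* (f :+ g) := a :+ x :* f :+ (b :+ x :* g)) refl (ι a) (ι b) x (eval f x) (eval g x))

  eval-scale : ∀ c f x → eval (scale c f) x ≈ ι c * eval f x
  eval-scale c []      x = sym (zeroʳ _)
  eval-scale c (a ∷ f) x = trans (+-cong (*-homo c a) (*-congˡ (eval-scale c f x)))
    (solve 4 (λ c a x f → c :* a :+ x :* (c :* f) := c :* (a :+ x :* f)) refl (ι c) (ι a) x (eval f x))

  eval-neg : ∀ f x → eval (-P f) x ≈ - eval f x
  eval-neg []      x = sym -0#≈0#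
  eval-neg (a ∷ f) x = begin
    ι (F.- a) + x * eval (-P f) x   ≈⟨ +-cong (-‿homo a) (trans (*-congˡ (eval-neg f x)) (sym (-‿distribʳ-* x _))) ⟩
    - ι a - x * eval f x  ≈⟨ -‿+-comm _ _ ⟩
    - (ι a + x * eval f x)          ∎

  eval-*P : ∀ f g x → eval (f *P g) x ≈ eval f x * eval g x
  eval-*P []      g x = sym (zeroˡ _)
  eval-*P (a ∷ f) g x = begin
    eval (scale a g +P (F.0# ∷ (f *P g))) x  ≈⟨ eval-+P (scale a g) _ x ⟩
    eval (scale a g) x + (ι F.0# + x * eval (f *P g) x) ≈⟨ +-cong (eval-scale a g x) (trans (+-congʳ 0#-homo) (trans (+-identityˡ _) (*-congˡ (eval-*P f g x)))) ⟩
    ι a * eval g x + x * (eval f x * eval g x)      ≈⟨ solve 4 (λ a g x f → a :* g :+ x :* (f :* g) := (a :+ x :* f) :* g) refl (ι a) (eval g x) x (eval f x) ⟩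
    (ι a + x * eval f x) * eval g x                 ∎

  monomial : ℕ → Pol
  monomial zero    = F.1# ∷ []
  monomial (suc n) = F.0# ∷ monomial n

  eval-monomial : ∀ n x → eval (monomial n) x ≈ x ^ n
  eval-monomial zero    x = trans (+-cong 1#-homo (zeroʳ x)) (+-identityʳ 1#)
  eval-monomial (suc n) x = trans (+-congʳ 0#-homo) (trans (+-identityˡ _) (*-congˡ (eval-monomial n x)))

  normalise : ∀ {x} d r → eval r x ≈ 0# → DegreeBelow d r → (r ≐ []) ⊎ ∃ λ e → e ℕ.< d × ∃ λ g → Monic e g × eval g x ≈ 0#
  normalise {x} d r root below with leading d r below
  ... | inj₁ r≐0 = inj₁ r≐0
  ... | inj₂ (e , e<d , lead≉0 , below′) with c , lead*c≈1 ← F.inverse _ lead≉0 =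
    inj₂ (e , e<d , scale c r ,
      (F.trans (coeff-scale c r e) (F.trans (F.*-comm _ _) lead*c≈1) ,
       λ n e<n → F.trans (coeff-scale c r n) (F.trans (F.*-congˡ (below′ n e<n)) (F.zeroʳ c))) ,
      trans (eval-scale c r x) (trans (*-congˡ root) (zeroʳ _)))

  remainder-root : ∀ {x} p g q r → p ≐ ((q *P g) +P r) → eval p x ≈ 0# → eval g x ≈ 0# → eval r x ≈ 0#
  remainder-root {x} p g q r p≐qg+r p-root g-root = begin
    eval r x  ≈⟨ +-identityˡ _ ⟨
    0# + eval r x  ≈⟨ +-congʳ (trans (eval-*P q g x) (trans (*-congˡ g-root) (zeroʳ _))) ⟨
    eval (q *P g) x + eval r x       ≈⟨ eval-+P (q *P g) r x ⟨
    eval ((q *P g) +P r) x  ≈⟨ eval-≐ p ((q *P g) +P r) x p≐qg+r ⟨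
    eval p x  ≈⟨ p-root ⟩
    0#                               ∎

  drop-remainder : ∀ p g q r → p ≐ ((q *P g) +P r) → r ≐ [] → p ≐ (q *P g)
  drop-remainder p g q r p≐qg+r r≐0 n = F.trans (p≐qg+r n) (F.trans (coeff-+P (q *P g) r n) (F.trans (F.+-congˡ (r≐0 n)) (F.+-identityʳ _)))

  CommonDivisor : Carrier → Pol → Pol → Set
  CommonDivisor x p f = ∃₂ λ d g → Monic d g × eval g x ≈ 0# × (∃ λ q → p ≐ (q *P g)) × (∃ λ q → f ≐ (q *P g))

  -- Descent on the degree of a monic g vanishing at x: a non-zero remainder of p or f
  -- modulo g also vanishes at x and has smaller degree.
  common-divisor : ∀ {x} p f → eval p x ≈ 0# → eval f x ≈ 0# →
    ∀ bound d g → d ℕ.< bound → Monic d g → eval g x ≈ 0# → CommonDivisor x p f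
  common-divisor p f p-root f-root (suc bound) d g (ℕ.s≤s d≤bound) monic g-root
    with divide monic p | divide monic f
  ... | q₁ , r₁ , p≐ , below₁ | q₂ , r₂ , f≐ , below₂
    with normalise d r₁ (remainder-root p g q₁ r₁ p≐ p-root g-root) below₁
       | normalise d r₂ (remainder-root f g q₂ r₂ f≐ f-root g-root) below₂
  ... | inj₁ r₁≐0 | inj₁ r₂≐0 = d , g , monic , g-root ,
    (q₁ , drop-remainder p g q₁ r₁ p≐ r₁≐0) , (q₂ , drop-remainder f g q₂ r₂ f≐ r₂≐0)
  ... | inj₂ (e , e<d , h , h-monic , h-root) | _ =
    common-divisor p f p-root f-root bound e h (ℕₚ.<-≤-trans e<d d≤bound) h-monic h-root
  ... | inj₁ _ | inj₂ (e , e<d , h , h-monic , h-root) =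
    common-divisor p f p-root f-root bound e h (ℕₚ.<-≤-trans e<d d≤bound) h-monic h-root

  constant-coeffs : ∀ {c} g → g ≈P (c ∷ []) → c F.≈ F.0# → g ≐ []
  constant-coeffs {c} g g≈c c≈0 n = F.trans (≈P⇒≐ g (c ∷ []) g≈c n) (zero-coeff n)
    where
      zero-coeff : ∀ n → coeff (c ∷ []) n F.≈ F.0#
      zero-coeff zero    = c≈0
      zero-coeff (suc n) = F.refl

  eval-constant : ∀ {c} g x → g ≈P (c ∷ []) → eval g x ≈ ι c
  eval-constant {c} g x g≈c = trans (eval-≐ g (c ∷ []) x (≈P⇒≐ g (c ∷ []) g≈c)) (trans (+-congˡ (zeroʳ x)) (+-identityʳ _))

  -- A monic common divisor h of p and f that vanishes at x is not constant, so by irreducibility p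
  -- is a non-zero constant times h. Hence h vanishes at y, and f with it. The descent to h starts
  -- from p made monic.
  conjugate-roots : ∀ {x y} p f → Irreducible p → eval p x ≈ 0# → eval p y ≈ 0# → eval f x ≈ 0# → eval f y ≈ 0#
  conjugate-roots {x} {y} p f (¬const , irreducible) px py fx
    with normalise {x} (List.length p) p px (coeff-length p)
  ... | inj₁ p≐0 = contradiction (F.0# , ≐⇒≈P p (F.0# ∷ []) λ { zero → p≐0 zero ; (suc n) → p≐0 (suc n) }) ¬const
  ... | inj₂ (d , _ , g , monic , gx)
    with common-divisor p f px fx (suc d) d g ℕₚ.≤-refl monic gx
  ... | e , h , (h-lead , _) , hx , (q₁ , p≐q₁h) , (q₂ , f≐q₂h)
    with irreducible q₁ h (≐⇒≈P (q₁ *P h) p (F.sym ∘ p≐q₁h))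
  ... | inj₂ (c , h≈c) = contradiction
    (F.trans (F.sym (constant-coeffs h h≈c (ι-injective₀ (trans (sym (eval-constant h x h≈c)) hx)) e)) h-lead) F.0≉1
  ... | inj₁ (c , q₁≈c) with ι c ≟ 0#
  ...   | yes ιc≈0 = contradiction
    (F.0# , ≐⇒≈P p (F.0# ∷ []) λ n → F.trans (p≐q₁h n) (F.trans
      (coeff-*P-zero q₁ h (constant-coeffs q₁ q₁≈c (ι-injective₀ ιc≈0)) n) (zero-coeff n))) ¬const
    where
      zero-coeff : ∀ n → F.0# F.≈ coeff (F.0# ∷ []) n
      zero-coeff zero    = F.refl
      zero-coeff (suc n) = F.refl
  ...   | no ιc≉0 = begin
    eval f y  ≈⟨ eval-≐ f (q₂ *P h) y f≐q₂h ⟩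
    eval (q₂ *P h) y      ≈⟨ eval-*P q₂ h y ⟩
    eval q₂ y * eval h y  ≈⟨ *-congˡ hy ⟩
    eval q₂ y * 0#        ≈⟨ zeroʳ _ ⟩
    0#                    ∎
    where
      hy : eval h y ≈ 0#
      hy = *-cancelˡ ιc≉0 (begin
        ι c * eval h y        ≈⟨ *-congʳ (eval-constant q₁ y q₁≈c) ⟨
        eval q₁ y * eval h y  ≈⟨ eval-*P q₁ h y ⟨
        eval (q₁ *P h) y      ≈⟨ eval-≐ p (q₁ *P h) y p≐q₁h ⟨
        eval p y  ≈⟨ py ⟩
        0#  ≈⟨ zeroʳ (ι c) ⟨
        ι c * 0#              ∎)

-- Eigenvalues, determinant and characteristic polynomial.

module Diagonalised {q m n : ℕ} (F : FiniteField q) (A : Mat (FiniteField.Carrier F) n)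
                    (K : FiniteField m) (ι : FiniteField.Carrier F → FiniteField.Carrier K)
                    (ι-hom : RingMorphisms.IsRingHomomorphism (FiniteField.rawRing F) (FiniteField.rawRing K) ι)
                    (P : Mat (FiniteField.Carrier K) n) (λs : Fin n → FiniteField.Carrier K)
                    (P-invertible : RawMat.Invertible (FiniteField.rawRing K) P)
                    (diagonalises : RawMat._≈M_ (FiniteField.rawRing K)
                      (RawMat._·_ (FiniteField.rawRing K) P (λ i j → ι (A i j)))
                      (RawMat._·_ (FiniteField.rawRing K) (RawMat.diag (FiniteField.rawRing K) λs) P)) where
  private module F = FieldProperties F
  open Powers K
  open ≈-Reasoning
  open Conjugates F K ι ι-hom
  open Determinant (FiniteField.ring K) using (sumF-cong; sumF-comm; sumF-*ˡ; sumF-*ʳ; sumF-+; sumF-single; I-diagonal;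
    I-off-diagonal; det-congruent; det-·; det-diag; det-homomorphic; product)
  open RawMat (FiniteField.rawRing K) using (sumF; det; _·_; I; diag)
  module MF = RawMat (FiniteField.rawRing F)

  P⁻¹ : Mat Carrier n
  P⁻¹ = proj₁ P-invertible

  ι-sumF : ∀ {k} (f : Fin k → F.Carrier) → ι (MF.sumF f) ≈ sumF (ι ∘ f)
  ι-sumF {zero}  f = 0#-homo
  ι-sumF {suc k} f = trans (+-homo _ _) (+-congˡ (ι-sumF (f ∘ suc)))

  ι-I : ∀ {k} (i j : Fin k) → ι (MF.I i j) ≈ I i j
  ι-I i j with i Fin.≟ j
  ... | yes _ = 1#-homo
  ... | no  _ = 0#-homo

  diag-· : ∀ (d : Fin n → Carrier) (M : Mat Carrier n) i j → (diag d · M) i j ≈ d i * M i j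
  diag-· d M i j = trans (sumF-single (λ k → diag d i k * M k j) i λ k i≢k → trans (*-congʳ (off k i≢k)) (zeroˡ _)) (*-congʳ on)
    where
      off : ∀ k → i ≢ k → diag d i k ≈ 0#
      off k i≢k with i Fin.≟ k
      ... | yes i≡k = contradiction i≡k i≢k
      ... | no  _   = refl
      on : diag d i i ≈ d i
      on with i Fin.≟ i
      ... | yes _  = refl
      ... | no i≢i = contradiction ≡.refl i≢i

  left-eigenvector : ∀ i j → sumF (λ k → P i k * ι (A k j)) ≈ λs i * P i j
  left-eigenvector i j = trans (diagonalises i j) (diag-· λs P i j)

  -- The rows of P are left eigenvectors of A, so that powers of A act on row i through powers of λs
  -- i.
  power-eigenvector : ∀ x i j → sumF (λ k → P i k * ι ((A MF.^ x) k j)) ≈ λs i ^ x * P i j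
  power-eigenvector zero i j = begin
    sumF (λ k → P i k * ι (MF.I k j))  ≈⟨ sumF-cong (λ k → *-congˡ (ι-I k j)) ⟩
    sumF (λ k → P i k * I k j)  ≈⟨ sumF-single (λ k → P i k * I k j) j (λ k j≢k → trans (*-congˡ (I-off-diagonal (j≢k ∘ ≡.sym))) (zeroʳ _)) ⟩
    P i j * I j j  ≈⟨ *-congˡ (I-diagonal j) ⟩
    P i j * 1#  ≈⟨ *-comm _ _ ⟩
    1# * P i j                         ∎
  power-eigenvector (suc x) i j = begin
    sumF (λ k → P i k * ι (MF.sumF (λ l → A k l F.* (A MF.^ x) l j)))
      ≈⟨ sumF-cong (λ k → trans (*-congˡ (trans (ι-sumF (λ l → A k l F.* (A MF.^ x) l j)) (sumF-cong {n} λ l → *-homo (A k l) ((A MF.^ x) l j)))) (sym (sumF-*ˡ (P i k) (λ l → ι (A k l) * ι ((A MF.^ x) l j))))) ⟩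
    sumF (λ k → sumF (λ l → P i k * (ι (A k l) * ι ((A MF.^ x) l j))))
      ≈⟨ sumF-comm (λ k l → P i k * (ι (A k l) * ι ((A MF.^ x) l j))) ⟩
    sumF (λ l → sumF (λ k → P i k * (ι (A k l) * ι ((A MF.^ x) l j))))
      ≈⟨ sumF-cong (λ l → trans (sumF-cong (λ k → sym (*-assoc (P i k) (ι (A k l)) (ι ((A MF.^ x) l j)))))
           (trans (sumF-*ʳ (ι ((A MF.^ x) l j)) (λ k → P i k * ι (A k l))) (trans (*-congʳ (left-eigenvector i l)) (*-assoc _ _ _)))) ⟩
    sumF (λ l → λs i * (P i l * ι ((A MF.^ x) l j)))
      ≈⟨ sumF-*ˡ (λs i) (λ l → P i l * ι ((A MF.^ x) l j)) ⟩
    λs i * sumF (λ l → P i l * ι ((A MF.^ x) l j))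
      ≈⟨ *-congˡ (power-eigenvector x i j) ⟩
    λs i * (λs i ^ x * P i j)
      ≈⟨ *-assoc _ _ _ ⟨
    λs i ^ suc x * P i j ∎

  -- Row i of P paired with column i of P⁻¹ gives 1.
  row-cancel : ∀ {x y} i → (∀ j → x * P i j ≈ y * P i j) → x ≈ y
  row-cancel {x} {y} i eq = begin
    x  ≈⟨ recover x ⟨
    sumF (λ j → x * P i j * P⁻¹ j i)        ≈⟨ sumF-cong (λ j → *-congʳ (eq j)) ⟩
    sumF (λ j → y * P i j * P⁻¹ j i)        ≈⟨ recover y ⟩
    y                                       ∎
    where
      recover : ∀ x → sumF (λ j → x * P i j * P⁻¹ j i) ≈ x
      recover x = begin
        sumF (λ j → x * P i j * P⁻¹ j i)    ≈⟨ sumF-cong (λ j → *-assoc x (P i j) (P⁻¹ j i)) ⟩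
        sumF (λ j → x * (P i j * P⁻¹ j i))  ≈⟨ sumF-*ˡ x (λ j → P i j * P⁻¹ j i) ⟩
        x * sumF (λ j → P i j * P⁻¹ j i)    ≈⟨ *-congˡ (trans (proj₁ (proj₂ P-invertible) i i) (I-diagonal i)) ⟩
        x * 1#  ≈⟨ *-identityʳ x ⟩
        x                                   ∎

  eigenvalue-equation : ∀ {a b c d} → ((A MF.^ a) MF.⊕ (A MF.^ b)) MF.≈M ((A MF.^ c) MF.⊕ (A MF.^ d)) →
    ∀ i → λs i ^ a + λs i ^ b ≈ λs i ^ c + λs i ^ d
  eigenvalue-equation {a} {b} {c} {d} eq i = row-cancel i λ j → begin
    (λs i ^ a + λs i ^ b) * P i j
      ≈⟨ combine a b j ⟨
    sumF (λ k → P i k * ι ((A MF.^ a) k j F.+ (A MF.^ b) k j))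
      ≈⟨ sumF-cong (λ k → *-congˡ (⟦⟧-cong (eq k j))) ⟩
    sumF (λ k → P i k * ι ((A MF.^ c) k j F.+ (A MF.^ d) k j))
      ≈⟨ combine c d j ⟩
    (λs i ^ c + λs i ^ d) * P i j ∎
    where
      combine : ∀ a b j → sumF (λ k → P i k * ι ((A MF.^ a) k j F.+ (A MF.^ b) k j)) ≈ (λs i ^ a + λs i ^ b) * P i j
      combine a b j = begin
        sumF (λ k → P i k * ι ((A MF.^ a) k j F.+ (A MF.^ b) k j))
          ≈⟨ sumF-cong {n} (λ k → trans (*-congˡ {P i k} (+-homo ((A MF.^ a) k j) ((A MF.^ b) k j))) (distribˡ (P i k) _ _)) ⟩
        sumF (λ k → P i k * ι ((A MF.^ a) k j) + P i k * ι ((A MF.^ b) k j))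
          ≈⟨ sumF-+ (λ k → P i k * ι ((A MF.^ a) k j)) (λ k → P i k * ι ((A MF.^ b) k j)) ⟩
        sumF (λ k → P i k * ι ((A MF.^ a) k j)) + sumF (λ k → P i k * ι ((A MF.^ b) k j))
          ≈⟨ +-cong (power-eigenvector a i j) (power-eigenvector b i j) ⟩
        λs i ^ a * P i j + λs i ^ b * P i j
          ≈⟨ distribʳ _ _ _ ⟨
        (λs i ^ a + λs i ^ b) * P i j ∎

  eigenvalue-period : ∀ x → (A MF.^ x) MF.≈M MF.I → ∀ i → λs i ^ x ≈ 1#
  eigenvalue-period x eq i = row-cancel i λ j → begin
    λs i ^ x * P i j  ≈⟨ power-eigenvector x i j ⟨
    sumF (λ k → P i k * ι ((A MF.^ x) k j))   ≈⟨ sumF-cong (λ k → *-congˡ (⟦⟧-cong (eq k j))) ⟩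
    sumF (λ k → P i k * ι ((A MF.^ 0) k j))   ≈⟨ power-eigenvector 0 i j ⟩
    1# * P i j                                ∎

  -- Multiplying by P⁻¹ recovers the entries of A^x from the eigenvector relations, which for x and
  -- for 0 have the same right-hand sides; injectivity of ι brings the equality back to F.
  matrix-period : ∀ x → (∀ i → λs i ^ x ≈ 1#) → (A MF.^ x) MF.≈M MF.I
  matrix-period x eq l j = ι-injective (begin
    ι ((A MF.^ x) l j)   ≈⟨ recover x ⟨
    sumF (λ i → P⁻¹ l i * sumF (λ k → P i k * ι ((A MF.^ x) k j)))
                         ≈⟨ sumF-cong (λ i → *-congˡ (trans (power-eigenvector x i j) (trans (*-congʳ (eq i)) (sym (power-eigenvector 0 i j))))) ⟩
    sumF (λ i → P⁻¹ l i * sumF (λ k → P i k * ι ((A MF.^ 0) k j)))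
                         ≈⟨ recover 0 ⟩
    ι (MF.I l j)         ∎)
    where
      recover : ∀ x → sumF (λ i → P⁻¹ l i * sumF (λ k → P i k * ι ((A MF.^ x) k j))) ≈ ι ((A MF.^ x) l j)
      recover x = begin
        sumF (λ i → P⁻¹ l i * sumF (λ k → P i k * v k))
          ≈⟨ sumF-cong (λ i → trans (sym (sumF-*ˡ (P⁻¹ l i) (λ k → P i k * v k))) (sumF-cong λ k → sym (*-assoc (P⁻¹ l i) (P i k) (v k)))) ⟩
        sumF (λ i → sumF (λ k → P⁻¹ l i * P i k * v k))
          ≈⟨ sumF-comm (λ i k → P⁻¹ l i * P i k * v k) ⟩
        sumF (λ k → sumF (λ i → P⁻¹ l i * P i k * v k))
          ≈⟨ sumF-cong (λ k → trans (sumF-*ʳ (v k) (λ i → P⁻¹ l i * P i k)) (*-congʳ (proj₂ (proj₂ P-invertible) l k))) ⟩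
        sumF (λ k → I l k * v k)
          ≈⟨ sumF-single (λ k → I l k * v k) l (λ k l≢k → trans (*-congʳ (I-off-diagonal l≢k)) (zeroˡ _)) ⟩
        I l l * v l
          ≈⟨ trans (*-congʳ (I-diagonal l)) (*-identityˡ _) ⟩
        v l ∎
        where
          v : Fin n → Carrier
          v k = ι ((A MF.^ x) k j)

  detP≉0 : ¬ (det P ≈ 0#)
  detP≉0 detP≈0 = 1≉0 (begin
    1#  ≈⟨ product-1 n ⟨
    product {n} (λ _ → 1#) ≈⟨ det-diag {n} (λ _ → 1#) ⟨
    det {n} (diag (λ _ → 1#))  ≈⟨ det-congruent (proj₁ (proj₂ P-invertible)) ⟨
    det (P · P⁻¹)  ≈⟨ det-· P P⁻¹ ⟩
    det P * det P⁻¹        ≈⟨ *-congʳ detP≈0 ⟩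
    0# * det P⁻¹  ≈⟨ zeroˡ _ ⟩
    0#                     ∎)
    where
      product-1 : ∀ k → product {k} (λ _ → 1#) ≈ 1#
      product-1 zero    = refl
      product-1 (suc k) = trans (*-identityˡ _) (product-1 k)

  -- P B = diag d · P, and det P cancels. Used for A itself and for x I - A.
  similar-det : ∀ (B : Mat Carrier n) d → (∀ i j → (P · B) i j ≈ d i * P i j) → det B ≈ product d
  similar-det B d eq = *-cancelˡ detP≉0 (begin
    det P * det B  ≈⟨ det-· P B ⟨
    det (P · B)  ≈⟨ det-congruent (λ i j → trans (eq i j) (sym (diag-· d P i j))) ⟩
    det (diag d · P)       ≈⟨ det-· (diag d) P ⟩
    det (diag d) * det P   ≈⟨ *-comm _ _ ⟩
    det P * det (diag d)   ≈⟨ *-congˡ (det-diag d) ⟩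
    det P * product d      ∎)

  product≈prod : ∀ {k} (d : Fin k → Carrier) → product d ≈ prod d
  product≈prod {zero}  d = refl
  product≈prod {suc k} d = *-congˡ (product≈prod (d ∘ suc))

  det-eigenvalues : ι (MF.det A) ≈ prod λs
  det-eigenvalues = begin
    ι (MF.det A)  ≈⟨ det-homomorphic (FiniteField.rawRing F) ι +-homo *-homo -‿homo 0#-homo 1#-homo A ⟩
    det (λ i j → ι (A i j))  ≈⟨ similar-det (λ i j → ι (A i j)) λs left-eigenvector ⟩
    product λs  ≈⟨ product≈prod λs ⟩
    prod λs                  ∎

  ι-powE : ∀ x k → ι (MF.powE x k) ≈ ι x ^ k
  ι-powE x zero    = 1#-homo
  ι-powE x (suc k) = trans (*-homo x _) (*-congˡ (ι-powE x k))

  -- The matrix x I - A has the left eigenvectors of A, with eigenvalues x - λs k; at x = λs i one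
  -- of them is 0.
  charPoly-root : ∀ i → eval (Poly.charPoly F A) (λs i) ≈ 0#
  charPoly-root i = begin
    eval (Poly.charPoly F A) x
      ≈⟨ det-homomorphic (Poly.polyRawRing F) (λ f → eval f x) (λ f g → eval-+P f g x) (λ f g → eval-*P f g x) (λ f → eval-neg f x)
           refl (trans (+-cong 1#-homo (zeroʳ x)) (+-identityʳ 1#)) {n} _ ⟩
    det (λ i j → eval (if isYes (i Fin.≟ j) then (F.- A i j) ∷ F.1# ∷ [] else (F.- A i j) ∷ []) x)
      ≈⟨ det-congruent entry ⟩
    det B
      ≈⟨ similar-det B (λ k → x - λs k) PB ⟩
    product (λ k → x - λs k)
      ≈⟨ product≈prod (λ k → x - λs k) ⟩
    prod (λ k → x - λs k)
      ≈⟨ prod-zero (λ k → x - λs k) i (-‿inverseʳ x) ⟩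
    0# ∎
    where
      x : Carrier
      x = λs i
      B : Mat Carrier n
      B k j = I k j * x - ι (A k j)
      entry : ∀ k j → eval (if isYes (k Fin.≟ j) then (F.- A k j) ∷ F.1# ∷ [] else (F.- A k j) ∷ []) x ≈ B k j
      entry k j with k Fin.≟ j
      ... | yes _ = begin
        ι (F.- A k j) + x * (ι F.1# + x * 0#)  ≈⟨ +-cong (-‿homo _) (*-congˡ (trans (+-cong 1#-homo (zeroʳ x)) (+-identityʳ 1#))) ⟩
        - ι (A k j) + x * 1#  ≈⟨ +-comm _ _ ⟩
        x * 1# - ι (A k j)  ≈⟨ +-congʳ (*-comm x 1#) ⟩
        1# * x - ι (A k j)                     ∎
      ... | no _ = begin
        ι (F.- A k j) + x * 0#  ≈⟨ +-cong (-‿homo _) (zeroʳ x) ⟩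
        - ι (A k j) + 0#  ≈⟨ +-comm _ _ ⟩
        0# - ι (A k j)  ≈⟨ +-congʳ (zeroˡ x) ⟨
        0# * x - ι (A k j)                     ∎
      PB : ∀ l j → (P · B) l j ≈ (x - λs l) * P l j
      PB l j = begin
        sumF (λ k → P l k * (I k j * x - ι (A k j)))
          ≈⟨ sumF-cong (λ k → trans (distribˡ (P l k) (I k j * x) (- ι (A k j))) (+-congˡ (trans (sym (-‿distribʳ-* _ _)) (sym (-1*x≈-x _))))) ⟩
        sumF (λ k → P l k * (I k j * x) + - 1# * (P l k * ι (A k j)))
          ≈⟨ sumF-+ (λ k → P l k * (I k j * x)) (λ k → - 1# * (P l k * ι (A k j))) ⟩
        sumF (λ k → P l k * (I k j * x)) + sumF (λ k → - 1# * (P l k * ι (A k j)))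
          ≈⟨ +-cong (sumF-single (λ k → P l k * (I k j * x)) j
                       (λ k j≢k → trans (*-congˡ (trans (*-congʳ (I-off-diagonal (j≢k ∘ ≡.sym))) (zeroˡ x))) (zeroʳ _)))
                    (sumF-*ˡ (- 1#) (λ k → P l k * ι (A k j))) ⟩
        P l j * (I j j * x) + - 1# * sumF (λ k → P l k * ι (A k j))
          ≈⟨ +-cong (trans (*-congˡ (trans (*-congʳ (I-diagonal j)) (*-identityˡ x))) (*-comm _ _))
                    (trans (-1*x≈-x _) (trans (-‿cong (left-eigenvector l j)) (-‿distribˡ-* _ _))) ⟩
        x * P l j + - λs l * P l j
          ≈⟨ distribʳ _ _ _ ⟨
        (x - λs l) * P l j ∎

  -- `conjugate-roots` applied to the polynomial X^(x+1) - 1.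
  irreducible-period : Poly.Irreducible F (Poly.charPoly F A) → ∀ x i j → λs i ^ suc x ≈ 1# → λs j ^ suc x ≈ 1#
  irreducible-period irreducible x i j λᵢ^x≈1 = x∙y⁻¹≈ε⇒x≈y _ _ (trans (sym (eval-f j))
    (conjugate-roots (Poly.charPoly F A) f irreducible (charPoly-root i) (charPoly-root j)
      (trans (eval-f i) (trans (+-congʳ λᵢ^x≈1) (-‿inverseʳ 1#)))))
    where
      f : Poly.Pol F
      f = (F.- F.1#) ∷ monomial x
      eval-f : ∀ k → eval f (λs k) ≈ λs k ^ suc x - 1#
      eval-f k = trans (+-cong (trans (-‿homo _) (-‿cong 1#-homo)) (*-congˡ (eval-monomial x (λs k)))) (+-comm _ _)

  -- From the matrix to its spectrum.

  module Orders (τ t : ℕ) (A-order : MF.IsOrderM A τ) (det-order : MF.IsOrderE (MF.det A) t) where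
    open Energy F using (decM; ind; E; sumℕ)

    Q : ℕ → ℕ → ℕ → ℕ → ℕ
    Q a b c d = ind (isYes (decM ((A MF.^ a) MF.⊕ (A MF.^ b)) ((A MF.^ c) MF.⊕ (A MF.^ d))))

    Q≤1 : ∀ a b c d → Q a b c d ℕ.≤ 1
    Q≤1 a b c d with isYes (decM ((A MF.^ a) MF.⊕ (A MF.^ b)) ((A MF.^ c) MF.⊕ (A MF.^ d)))
    ... | true  = ℕₚ.≤-refl
    ... | false = ℕ.z≤n

    Q≢0 : ∀ a b c d → Q a b c d ≢ 0 → ((A MF.^ a) MF.⊕ (A MF.^ b)) MF.≈M ((A MF.^ c) MF.⊕ (A MF.^ d))
    Q≢0 a b c d ≢0 with decM ((A MF.^ a) MF.⊕ (A MF.^ b)) ((A MF.^ c) MF.⊕ (A MF.^ d))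
    ... | yes eq = eq
    ... | no  _  = contradiction ≡.refl ≢0

    open EnergyBound K Q Q≤1 τ t (proj₁ A-order) (proj₁ det-order) public using (Spectrum; energy; energy-bound)
    open Reduction K Q Q≤1 τ t (proj₁ A-order) (proj₁ det-order) public using (X; bound₁; bound₂)
    open Counting using (∑; ∑-cong)

    sumℕ-∑ : ∀ n {f : Fin n → ℕ} {g : ℕ → ℕ} → (∀ i → f i ≡ g (toℕ i)) → sumℕ f ≡ ∑ n g
    sumℕ-∑ zero    f≗g = ≡.refl
    sumℕ-∑ (suc n) f≗g = ≡.cong₂ ℕ._+_ (f≗g zero) (sumℕ-∑ n (f≗g ∘ suc))

    E≡energy : E A τ ≡ energy
    E≡energy = sumℕ-∑ τ λ a → sumℕ-∑ τ λ b → sumℕ-∑ τ λ c → sumℕ-∑ τ λ d → ≡.refl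

    τ-multiple : ∀ x → (∀ i → λs i ^ x ≈ 1#) → τ ∣ x
    τ-multiple x eq = ∣.m%n≡0⇒n∣m x τ (remainder-zero (x ℕ.% τ) ≡.refl)
      where
        instance
          τ-nonZero : ℕ.NonZero τ
          τ-nonZero = ℕ.>-nonZero (proj₁ A-order)
        remainder-zero : ∀ r → x ℕ.% τ ≡ r → x ℕ.% τ ≡ 0
        remainder-zero zero    x%τ≡0 = x%τ≡0
        remainder-zero (suc r) x%τ≡r = contradiction
          (matrix-period (suc r) λ i → trans
            (^-mod (λs i) τ (suc r) x (eigenvalue-period τ (proj₁ (proj₂ A-order)) i)
              (≡.trans (≡.cong (ℕ._% τ) (≡.sym x%τ≡r)) (DivMod.m%n%n≡m%n x τ)))
            (eq i))
          (proj₂ (proj₂ A-order) (suc r) (ℕ.s≤s ℕ.z≤n) (≡.subst (ℕ._< τ) x%τ≡r (DivMod.m%n<n x τ)))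

    -- The initial state: nothing is discarded, so M = 1 and N = τ.
    spectrum : Spectrum {l = 0} λs (λ ()) 1 τ
    spectrum = record
      { τ≡N*M   = ≡.sym (ℕₚ.*-identityʳ τ)
      ; solJ    = λ a b c d ≢0 → eigenvalue-equation {a} {b} {c} {d} (Q≢0 a b c d ≢0)
      ; solR    = λ _ _ _ _ _ ()
      ; J^τ≈1   = eigenvalue-period τ (proj₁ (proj₂ A-order))
      ; R^M≈1   = λ ()
      ; orderR  = λ x _ → ∣.1∣ x
      ; order   = λ x eq _ → τ-multiple x eq
      ; det^t≈1 = begin
          (prod λs * 1#) ^ t     ≈⟨ ^-congˡ t (trans (*-identityʳ _) (sym det-eigenvalues)) ⟩
          ι (MF.det A) ^ t       ≈⟨ ι-powE (MF.det A) t ⟨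
          ι (MF.powE (MF.det A) t) ≈⟨ ⟦⟧-cong (proj₁ (proj₂ det-order)) ⟩
          ι F.1#  ≈⟨ 1#-homo ⟩
          1#                     ∎
      }

    -- A period of one eigenvalue is a period of all, hence of A; so μ = τ is admissible.
    irreducible-order : Poly.Irreducible F (Poly.charPoly F A) → ∀ j x → 1 ℕ.≤ x → x ℕ.< τ → ¬ (λs j ^ (x ℕ.* 1) ≈ 1#)
    irreducible-order irreducible j (suc x) 1≤x x<τ λ^x≈1 = proj₂ (proj₂ A-order) (suc x) 1≤x x<τ
      (matrix-period (suc x) λ i → irreducible-period irreducible x j i (trans (^-congʳ (λs j) (≡.sym (ℕₚ.*-identityʳ (suc x)))) λ^x≈1))

open import Data.Nat using (ℕ; _*_; _^_; _≤_; _∸_)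
open import Data.Product using (Σ; _×_)

theorem2p1 : (n : ℕ) → 2 ≤ n → Σ ℕ λ c →
    ∀ {q : ℕ} (F : FiniteField q) (A : Mat (FiniteField.Carrier F) n) (τ t : ℕ) →
    RawMat.Invertible (FiniteField.rawRing F) A →
    DiagonalisableOverClosure F A →
    RawMat.IsOrderM (FiniteField.rawRing F) A τ →
    RawMat.IsOrderE (FiniteField.rawRing F) (RawMat.det (FiniteField.rawRing F) A) t →
    ((Energy.E F A τ ^ (n * n)) * τ ≤ c * (τ ^ (3 * (n * n)) * t ^ (n * n))
    × (Energy.E F A τ ^ (n * (n ∸ 1))) * τ ≤ c * (τ ^ (3 * (n * (n ∸ 1))) * t ^ (n * n)))
    × (Poly.Irreducible F (Poly.charPoly F A) →
    (Energy.E F A τ ^ n) * τ ≤ c * (t ^ n * τ ^ (3 * n)))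
-- Writing n as m + 2 provides the two eigenvalues at which the second recursion stops. The sum of
-- the three constants serves all three bounds.
theorem2p1 n@(suc (suc m)) (ℕ.s≤s (ℕ.s≤s _)) = c₁ ℕ.+ c₂ ℕ.+ c₃ ,
  λ { F A τ t _ (_ , K , ι , ι-hom , P , λs , P-invertible , diagonalises) A-order det-order →
      bounds F A τ t K ι ι-hom P λs P-invertible diagonalises A-order det-order }
  where
    c₁ c₂ c₃ : ℕ
    c₁ = constant₁ (suc m)
    c₂ = constant₂ m
    c₃ = kst-constant n

    X^k : ∀ t τ k → (t * τ ^ 3) ^ k ≡ t ^ k * τ ^ (3 * k)
    X^k t τ k = ≡.trans (Counting.^-distribʳ-* k t (τ ^ 3)) (≡.cong (t ^ k *_) (ℕₚ.^-*-assoc τ 3 k))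

    module _ {q m′ : ℕ} (F : FiniteField q) (A : Mat (FiniteField.Carrier F) n) (τ t : ℕ)
             (K : FiniteField m′) (ι : FiniteField.Carrier F → FiniteField.Carrier K)
             (ι-hom : RingMorphisms.IsRingHomomorphism (FiniteField.rawRing F) (FiniteField.rawRing K) ι)
             (P : Mat (FiniteField.Carrier K) n) (λs : Fin n → FiniteField.Carrier K)
             (P-invertible : RawMat.Invertible (FiniteField.rawRing K) P)
             (diagonalises : RawMat._≈M_ (FiniteField.rawRing K)
               (RawMat._·_ (FiniteField.rawRing K) P (λ i j → ι (A i j)))
               (RawMat._·_ (FiniteField.rawRing K) (RawMat.diag (FiniteField.rawRing K) λs) P))
             (A-order : RawMat.IsOrderM (FiniteField.rawRing F) A τ)
             (det-order : RawMat.IsOrderE (FiniteField.rawRing F) (RawMat.det (FiniteField.rawRing F) A) t) where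
      open Diagonalised F A K ι ι-hom P λs P-invertible diagonalises
      open Orders τ t A-order det-order
      open ℕₚ.≤-Reasoning

      e : ℕ
      e = Energy.E F A τ

      first : e ^ (n * n) * τ ≤ (c₁ ℕ.+ c₂ ℕ.+ c₃) * (τ ^ (3 * (n * n)) * t ^ (n * n))
      first = begin
        e ^ (n * n) * τ  ≡⟨ ≡.cong (λ e → e ^ (n * n) * τ) E≡energy ⟩
        energy ^ (n * n) * τ  ≤⟨ bound₁ (suc m) spectrum ⟩
        c₁ * (t * τ ^ 3) ^ (n * n)  ≡⟨ ≡.cong (c₁ *_) (≡.trans (X^k t τ (n * n)) (ℕₚ.*-comm (t ^ (n * n)) _)) ⟩
        c₁ * (τ ^ (3 * (n * n)) * t ^ (n * n))  ≤⟨ ℕₚ.*-monoˡ-≤ _ (ℕₚ.≤-trans (ℕₚ.m≤m+n c₁ c₂) (ℕₚ.m≤m+n _ c₃)) ⟩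
        (c₁ ℕ.+ c₂ ℕ.+ c₃) * (τ ^ (3 * (n * n)) * t ^ (n * n)) ∎

      second : e ^ (n * suc m) * τ ≤ (c₁ ℕ.+ c₂ ℕ.+ c₃) * (τ ^ (3 * (n * suc m)) * t ^ (n * n))
      second = begin
        e ^ k * τ  ≡⟨ ≡.cong (λ e → e ^ k * τ) E≡energy ⟩
        energy ^ k * τ  ≤⟨ bound₂ m spectrum ⟩
        c₂ * ((t * τ ^ 3) ^ k * t ^ n)  ≡⟨ ≡.cong (λ x → c₂ * (x * t ^ n)) (X^k t τ k) ⟩
        c₂ * (t ^ k * τ ^ (3 * k) * t ^ n)  ≡⟨ ≡.cong (c₂ *_) (rearrange (t ^ k) (τ ^ (3 * k)) (t ^ n)) ⟩
        -- The exponents of t, namely n from `bound₂` and n (n - 1) from the power of t τ^3, add up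
        -- to n^2.
        c₂ * (τ ^ (3 * k) * (t ^ n * t ^ k))  ≡⟨ ≡.cong (λ x → c₂ * (τ ^ (3 * k) * x)) (≡.trans (≡.sym (ℕₚ.^-distribˡ-+-* t n k)) (≡.cong (t ^_) (≡.sym (ℕₚ.*-suc n (suc m))))) ⟩
        c₂ * (τ ^ (3 * k) * t ^ (n * n))  ≤⟨ ℕₚ.*-monoˡ-≤ _ (ℕₚ.≤-trans (ℕₚ.m≤n+m c₂ c₁) (ℕₚ.m≤m+n _ c₃)) ⟩
        (c₁ ℕ.+ c₂ ℕ.+ c₃) * (τ ^ (3 * k) * t ^ (n * n)) ∎
        where
          k : ℕ
          k = n * suc m
          rearrange : ∀ a b c → a * b * c ≡ b * (c * a)
          rearrange = solve-∀

      third : Poly.Irreducible F (Poly.charPoly F A) → e ^ n * τ ≤ (c₁ ℕ.+ c₂ ℕ.+ c₃) * (t ^ n * τ ^ (3 * n))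
      third irreducible = begin
        e ^ n * τ  ≡⟨ ≡.cong (λ e → e ^ n * τ) E≡energy ⟩
        -- Every order already equals τ, so the estimate applies to the full spectrum with M = 1 and
        -- μ = τ.
        energy ^ n * τ  ≤⟨ energy-bound spectrum τ (proj₁ A-order) (irreducible-order irreducible) ⟩
        c₃ * (t * τ ^ 3) ^ n  ≡⟨ ≡.cong (c₃ *_) (X^k t τ n) ⟩
        c₃ * (t ^ n * τ ^ (3 * n))  ≤⟨ ℕₚ.*-monoˡ-≤ _ (ℕₚ.m≤n+m c₃ (c₁ ℕ.+ c₂)) ⟩
        (c₁ ℕ.+ c₂ ℕ.+ c₃) * (t ^ n * τ ^ (3 * n))       ∎

      bounds :
        (e ^ (n * n) * τ ≤ (c₁ ℕ.+ c₂ ℕ.+ c₃) * (τ ^ (3 * (n * n)) * t ^ (n * n))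
          × e ^ (n * suc m) * τ ≤ (c₁ ℕ.+ c₂ ℕ.+ c₃) * (τ ^ (3 * (n * suc m)) * t ^ (n * n)))
        × (Poly.Irreducible F (Poly.charPoly F A) → e ^ n * τ ≤ (c₁ ℕ.+ c₂ ℕ.+ c₃) * (t ^ n * τ ^ (3 * n)))
      bounds = (first , second) , third
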